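{- Let $\lambda_2$ be a positive integer, $\delta$ a non-negative integer, and $\lambda_1=\lambda_2+\delta$. The average case complexity of the Novelli--Pak--Stoyanovskii algorithm on the partition $\lambda=(\lambda_1,\lambda_2)$ satisfies $$\begin{aligned} C(\lambda_1,\lambda_2)={}&\frac{\lambda_1(\lambda_1-1)}{4}+\frac{\lambda_2(\lambda_2-3)}{4}\\ &-2\Bigg(\Big(-1-\delta+\frac{(\delta+1)2^{2\lambda_2}}{\binom{2\lambda_2}{\lambda_2}}\Big)\sum_{i=1}^{\delta}\frac{2^i\binom{i+\lambda_2}{i}}{\binom{i+2\lambda_2}{i}(1+i+2\lambda_2)}\\ &\quad+\frac{2^{\delta+2}\lambda_2(1+\delta+\lambda_2)\binom{\delta+\lambda_2}{\delta}}{\binom{\delta+2\lambda_2}{\delta}(1+\delta+2\lambda_2)}\sum_{i=1}^{\delta}\frac{2^{ -i}\binom{i+2\lambda_2}{i}}{\binom{i+\lambda_2}{i}(i+2\lambda_2)}\\ &\quad-2(\delta+1)\lambda_2\sum_{i=1}^{\delta}\frac{2^i\binom{i+\lambda_2}{i}}{\binom{i+2\lambda_2}{i}(1+i+2\lambda_2)}\sum_{j=1}^{i}\frac{2^{ -j}\binom{j+2\lambda_2}{j}}{\binom{j+\lambda_2}{j}(j+2\lambda_2)}\\ &\quad+\frac{2^{2\lambda_2}(\delta+1)}{\binom{2\lambda_2}{\lambda_2}(2\lambda_2+1)}+\frac{2^{\delta+1}(1+\delta+\lambda_2)\binom{\delta+\lambda_2}{\delta}}{\binom{\delta+2\lambda_2}{\delta}\binom{2\lambda_2}{\lambda_2}(1+\delta+2\lambda_2)}\Big(-2^{2\lambda_2}+\binom{2\lambda_2}{\lambda_2}\Big)\\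 &\quad-\frac{\delta+1}{2\lambda_2+1}+(\delta+1)H_{\delta+2\lambda_2}+\tfrac12(\delta+1)H_{\lambda_2}-(\delta+1)H_{2\lambda_2}-(\delta+1)H_\delta\Bigg). \end{aligned}$$
   Context: $H_m=\sum_{\ell=1}^m\frac1\ell$ denotes the $m$-th harmonic number ($H_0=0$). A partition $\lambda$ of $n$ is identified with its Young diagram $\{(i,j):1\le i\le l(\lambda),\ 1\le j\le\lambda_i\}$ ($l(\lambda)$ is the number of parts), whose elements are called cells. A cell $(i,j)$ is a corner of $\lambda$ if neither $(i+1,j)$ nor $(i,j+1)$ belongs to $\lambda$. A tableau of shape $\lambda$ is a bijection $T:\lambda\to\{1,\dots,n\}$; the set of tableaux is $\mathrm{T}(\lambda)$. The (column-wise) Novelli--Pak--Stoyanovskii (NPS) algorithm applied to $T\in \mathrm{T}(\lambda)$: order cells by $(i,j)\preceq(i',j')$ if $j<j'$, or $j=j'$ and $i\le i'$. Let $(i_1,j_1)\succ\dots\succ(i_n,j_n)$ be the cells of $\lambda$ in decreasing order, put $k_r=T(i_r,j_r)$ (entries of the initial tableau) and $T_0=T$. For $r=1,\dots,n$ the tableau $T_r$ is obtained from $T_{r-1}$ as follows. Start with the current tableau equal to $T_{r-1}$ and repeat: let $(i,j)$ be the cell of the current tableau containing $k_r$. If $(i,j)$ is a corner of $\lambda$, stop. Otherwise let $m$ be the minimum of the entries of the current tableau in the cells of $\lambda\cap\{(i+1,j),(i,j+1)\}$. If $k_r<m$, stop. If $m<k_r$, exchange the entries $m$ and $k_r$ (one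 exchange) and repeat. When stopped, $T_r$ is the current tableau. $n(T)$ is the total number of exchanges performed during the construction of $T_1,\dots,T_n$, and $C(\lambda)=\frac1{n!}\sum_{T\in \mathrm{T}(\lambda)}n(T)$; $C(\lambda_1,\lambda_2)$ means $C(\lambda)$ for $\lambda=(\lambda_1,\lambda_2)$. -}

module Defs where

open import Data.Fin as Fin using (Fin; zero; suc; toℕ; fromℕ<)
open import Data.Fin.Permutation as Perm using (Permutation′; insert; transpose)
import Data.Fin.Properties as Fin
open import Data.Integer as ℤ using (+_)
open import Data.List using
  (List; []; _∷_; map; mapMaybe; concatMap; foldr; length; lookup; upTo; allFin; reverse)
import Data.List.Extrema
open import Data.List.Membership.Propositional using (_∈_; lose)
open import Data.List.Membership.Propositional.Properties using (∈-upTo⁺; ∈-allFin)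
open import Data.List.Relation.Unary.All as All using (All; []; _∷_)
import Data.List.Relation.Unary.All.Properties as All
open import Data.List.Relation.Unary.AllPairs as AllPairs using (AllPairs; []; _∷_)
import Data.List.Relation.Unary.AllPairs.Properties as AllPairs
open import Data.List.Relation.Unary.Any as Any using (Any; here)
import Data.List.Relation.Unary.Any.Properties as Any
open import Data.List.Relation.Unary.Linked using (Linked; [-]; _∷_)
open import Data.Maybe using (Maybe; just; nothing)
import Data.Maybe.Relation.Unary.All as Maybe
import Data.Maybe.Relation.Unary.Any as MAny
open import Data.Nat as ℕ using (ℕ; zero; suc; _+_; _*_; _^_; _⊔_; _≤_; _≥_; _<_; _!; NonZero)
open import Data.Nat.Combinatorics using (_C_; nCk+nC[k+1]≡[n+1]C[k+1])
open import Data.Nat.ListAction using (sum)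
import Data.Nat.Properties as ℕ
open import Data.Product using (Σ; _×_; _,_; proj₁; proj₂; map₂)
open import Data.Rational as ℚ using (ℚ; 0ℚ; 1ℚ; ½; _/_)
open import Data.Sum using (_⊎_; inj₁; inj₂)
open import Data.Sum.Function.Propositional using (_⊎-↔_)
open import Function using (_↔_; Inverse; mk↔ₛ′; _∘_)
open import Function.Construct.Composition using (_↔-∘_)
open import Function.Construct.Identity using (↔-id)
open import Function.Construct.Symmetry using (↔-sym)
open import Relation.Binary.PropositionalEquality using
  (_≡_; refl; sym; trans; cong; cong₂; subst)
open import Relation.Nullary using (¬_; yes; no; contradiction)

------------------------------------------------------------------------
-- Partitions and tableaux

record Partition : Set where
  constructor partition
  field
    parts      : List ℕ
    decreasing : Linked _≥_ parts
    positive   : All (0 <_) parts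

open Partition public

size : Partition → ℕ
size μ = sum (parts μ)

-- Rows and columns are numbered from 0.
Cell : Partition → Set
Cell μ = Σ (Fin (length (parts μ))) λ i → Fin (lookup (parts μ) i)

coords : ∀ μ → Cell μ → ℕ × ℕ
coords μ (i , j) = toℕ i , toℕ j

cellInRow : ∀ μ → Fin (length (parts μ)) → ℕ → Maybe (Cell μ)
cellInRow μ i j with j ℕ.<? lookup (parts μ) i
... | yes j<μᵢ = just (i , fromℕ< j<μᵢ)
... | no  _    = nothing

cellAt : ∀ μ → ℕ × ℕ → Maybe (Cell μ)
cellAt μ (i , j) with i ℕ.<? length (parts μ)
... | yes i<l = cellInRow μ (fromℕ< i<l) j
... | no  _   = nothing

-- The entries 1, …, n are represented by the elements 0, …, n - 1 of Fin n.
Tableau : Partition → Set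
Tableau μ = Cell μ ↔ Fin (size μ)

------------------------------------------------------------------------
-- The column-wise Novelli–Pak–Stoyanovskii algorithm

-- The cells of μ in increasing column-wise order; see _≺_ and
-- columnwise-increasing below.
columnwise : ∀ μ → List (Cell μ)
columnwise μ = mapMaybe (cellAt μ)
  (concatMap (λ j → map (λ i → i , j) (upTo (length (parts μ))))
             (upTo (foldr _⊔_ 0 (parts μ))))

module _ (μ : Partition) where

  -- μ ∩ {(i+1, j), (i, j+1)}; c is a corner iff this is empty.
  neighbours : Cell μ → List (Cell μ)
  neighbours (i , j) =
    mapMaybe (cellAt μ) ((suc (toℕ i) , toℕ j) ∷ (toℕ i , suc (toℕ j)) ∷ [])

  exchange : Fin (size μ) → Fin (size μ) → Tableau μ → Tableau μ
  exchange a b T = transpose a b ↔-∘ T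

  -- One round of the loop for the entry k; nothing means "stop".
  step : Fin (size μ) → Tableau μ → Maybe (Tableau μ)
  step k T with map (Inverse.to T) (neighbours (Inverse.from T k))
  ... | []     = nothing
  ... | e ∷ es with Data.List.Extrema.min (Fin.≤-totalOrder (size μ)) e es
  ...   | m with m Fin.<? k
  ...     | yes _ = just (exchange m k T)
  ...     | no  _ = nothing

  -- The loop for the entry k, cut off after the given number of exchanges;
  -- returns the final tableau and the number of exchanges performed.
  slide : ℕ → Fin (size μ) → Tableau μ → Tableau μ × ℕ
  slide zero       k T = T , 0
  slide (suc fuel) k T with step k T
  ... | nothing = T , 0
  ... | just T′ = map₂ suc (slide fuel k T′)

  -- Every exchange increases i + j by one, where (i , j) is the cell containing
  -- k, and i + j < size μ, so size μ exchanges always suffice: see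
  -- slide-terminates.
  process : List (Fin (size μ)) → Tableau μ → ℕ
  process []       T = 0
  process (k ∷ ks) T with slide (size μ) k T
  ... | T′ , e = e + process ks T′

  -- n(T); the entries k_r are read off the initial tableau.
  exchanges : Tableau μ → ℕ
  exchanges T = process (map (Inverse.to T) (reverse (columnwise μ))) T

------------------------------------------------------------------------
-- Enumeration of all tableaux and the average C(μ)

split : ∀ x (xs : List ℕ) →
        Σ (Fin (suc (length xs))) (Fin ∘ lookup (x ∷ xs)) ↔
        (Fin x ⊎ Σ (Fin (length xs)) (Fin ∘ lookup xs))
split x xs = mk↔ₛ′
  (λ { (zero , j) → inj₁ j ; (suc i , j) → inj₂ (i , j) })
  (λ { (inj₁ j) → zero , j ; (inj₂ (i , j)) → suc i , j })
  (λ { (inj₁ _) → refl ; (inj₂ _) → refl })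
  (λ { (zero , _) → refl ; (suc _ , _) → refl })

rowReading : ∀ xs → Σ (Fin (length xs)) (Fin ∘ lookup xs) ↔ Fin (sum xs)
rowReading []       = mk↔ₛ′ (λ ()) (λ ()) (λ ()) (λ ())
rowReading (x ∷ xs) =
  ↔-sym Fin.+↔⊎ ↔-∘ ((↔-id (Fin x) ⊎-↔ rowReading xs) ↔-∘ split x xs)

rowTableau : ∀ μ → Tableau μ
rowTableau μ = rowReading (parts μ)

permutations : ∀ n → List (Permutation′ n)
permutations zero    = Perm.id ∷ []
permutations (suc n) =
  concatMap (λ i → map (insert zero i) (permutations n)) (allFin (suc n))

-- Every tableau exactly once (see tableaux-complete and tableaux-unique below).
tableaux : ∀ μ → List (Tableau μ)
tableaux μ = map (_↔-∘ rowTableau μ) (permutations (size μ))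

averageComplexity : Partition → ℚ
averageComplexity μ =
  (+ sum (map (exchanges μ) (tableaux μ)) / size μ !) {{size μ ℕ.!≢0}}

twoRows : ∀ {λ₁ λ₂} → λ₂ ≤ λ₁ → 0 < λ₂ → Partition
twoRows {λ₁} {λ₂} λ₂≤λ₁ 0<λ₂ = partition
  (λ₁ ∷ λ₂ ∷ [])
  (λ₂≤λ₁ ∷ [-])
  (ℕ.≤-trans 0<λ₂ λ₂≤λ₁ ∷ 0<λ₂ ∷ [])

------------------------------------------------------------------------
-- The encodings above are adequate

-- columnwise lists every cell exactly once, in increasing order.

_≺_ : ℕ × ℕ → ℕ × ℕ → Set
(i , j) ≺ (i′ , j′) = j < j′ ⊎ (j ≡ j′ × i < i′)

module _ (μ : Partition) where

  cellAt-sound : ∀ p → Maybe.All (λ c → coords μ c ≡ p) (cellAt μ p)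
  cellAt-sound (i , j) with i ℕ.<? length (parts μ)
  ... | no  _   = Maybe.nothing
  ... | yes i<l with j ℕ.<? lookup (parts μ) (fromℕ< i<l)
  ...   | no  _    = Maybe.nothing
  ...   | yes j<μᵢ = Maybe.just (cong₂ _,_ (Fin.toℕ-fromℕ< i<l) (Fin.toℕ-fromℕ< j<μᵢ))

  cellInRow-complete : ∀ i j → cellInRow μ i (toℕ j) ≡ just (i , j)
  cellInRow-complete i j with toℕ j ℕ.<? lookup (parts μ) i
  ... | no  j≮μᵢ = contradiction (Fin.toℕ<n j) j≮μᵢ
  ... | yes j<μᵢ = cong (λ j → just (i , j)) (Fin.fromℕ<-toℕ j j<μᵢ)

  cellAt-complete : ∀ c → cellAt μ (coords μ c) ≡ just c
  cellAt-complete (i , j) with toℕ i ℕ.<? length (parts μ)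
  ... | no  i≮l = contradiction (Fin.toℕ<n i) i≮l
  ... | yes i<l = trans (cong (λ i → cellInRow μ i (toℕ j)) (Fin.fromℕ<-toℕ i i<l))
                        (cellInRow-complete i j)

  columnwise-complete : ∀ c → c ∈ columnwise μ
  columnwise-complete c@(i , j) = Any.mapMaybe⁺ (cellAt μ) _ (Any.map⁺
    (Any.concatMap⁺ _ (lose (∈-upTo⁺ j<cols)
      (Any.map⁺ (lose (∈-upTo⁺ (Fin.toℕ<n i)) found)))))
    where
    found : MAny.Any (c ≡_) (cellAt μ (coords μ c))
    found rewrite cellAt-complete c = MAny.just refl

    part≤max : ∀ xs (i : Fin (length xs)) → lookup xs i ≤ foldr _⊔_ 0 xs
    part≤max (x ∷ xs) zero    = ℕ.m≤m⊔n x _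
    part≤max (x ∷ xs) (suc i) = ℕ.≤-trans (part≤max xs i) (ℕ.m≤n⊔m x _)

    j<cols : toℕ j < foldr _⊔_ 0 (parts μ)
    j<cols = ℕ.<-≤-trans (Fin.toℕ<n j) (part≤max (parts μ) i)

  columnwise-increasing : AllPairs (λ c c′ → coords μ c ≺ coords μ c′) (columnwise μ)
  columnwise-increasing = mapMaybe-≺ (AllPairs.concat⁺
    (All.map⁺ (All.universal column js))
    (AllPairs.map⁺ {f = columnCoords} (AllPairs.applyUpTo⁺₁ (λ j → j) cols λ {j} {j′} j<j′ _ →
      All.map⁺ {f = _, j} (All.universal
        (λ _ → All.map⁺ {f = _, j′} (All.universal (λ _ → inj₁ j<j′) is)) is))))
    where
    cols : ℕ
    cols = foldr _⊔_ 0 (parts μ)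

    is js : List ℕ
    is = upTo (length (parts μ))
    js = upTo cols

    columnCoords : ℕ → List (ℕ × ℕ)
    columnCoords j = map (_, j) is

    column : ∀ j → AllPairs _≺_ (columnCoords j)
    column j = AllPairs.map⁺ (AllPairs.applyUpTo⁺₁ (λ i → i) _ λ i<i′ _ → inj₂ (refl , i<i′))

    after : ∀ p c → coords μ c ≡ p → ∀ {ps} → All (p ≺_) ps →
            All (λ c′ → coords μ c ≺ coords μ c′) (mapMaybe (cellAt μ) ps)
    after p c refl = All.mapMaybe⁺ ∘ All.map⁺ ∘ All.map
      (λ {q} p≺q → Maybe.map (λ { refl → p≺q }) (cellAt-sound q))

    mapMaybe-≺ : ∀ {ps} → AllPairs _≺_ ps →
      AllPairs (λ c c′ → coords μ c ≺ coords μ c′) (mapMaybe (cellAt μ) ps)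
    mapMaybe-≺ []                      = []
    mapMaybe-≺ {p ∷ ps} (p≺ps ∷ pairs) with cellAt μ p | cellAt-sound p
    ... | nothing | _               = mapMaybe-≺ pairs
    ... | just c  | Maybe.just eq   = after p c eq p≺ps ∷ mapMaybe-≺ pairs

  -- The loop for one entry stops after at most size μ exchanges.

  private
    diagonal : Cell μ → ℕ
    diagonal (i , j) = toℕ i + toℕ j

    diagonal<size : ∀ c → diagonal c < size μ
    diagonal<size (i , j) = go (parts μ) (positive μ) i j
      where
      go : ∀ xs → All (0 <_) xs → (i : Fin (length xs)) (j : Fin (lookup xs i)) →
           toℕ i + toℕ j < sum xs
      go (x ∷ xs) _          zero    j = ℕ.<-≤-trans (Fin.toℕ<n j) (ℕ.m≤m+n x _)
      go (x ∷ xs) (0<x ∷ ps) (suc i) j = ℕ.+-mono-≤ 0<x (go xs ps i j)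

    neighbours-diagonal : ∀ c →
      All (λ c′ → diagonal c′ ≡ suc (diagonal c)) (neighbours μ c)
    neighbours-diagonal (i , j) = All.mapMaybe⁺ {xs = below ∷ right ∷ []} {f = cellAt μ}
      ( Maybe.map (λ eq → cong₂ _+_ (cong proj₁ eq) (cong proj₂ eq)) (cellAt-sound below)
      ∷ Maybe.map (λ eq → trans (cong₂ _+_ (cong proj₁ eq) (cong proj₂ eq))
                                (ℕ.+-suc (toℕ i) (toℕ j))) (cellAt-sound right)
      ∷ [])
      where
      below right : ℕ × ℕ
      below = suc (toℕ i) , toℕ j
      right = toℕ i , suc (toℕ j)

    transpose-k-m-k : ∀ {n} (m k : Fin n) → transpose m k Perm.⟨$⟩ˡ k ≡ m
    transpose-k-m-k m k with k Fin.≟ k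
    ... | yes _   = refl
    ... | no  k≢k = contradiction refl k≢k

    entries-diagonal : ∀ k (T : Tableau μ) →
      All (λ e → diagonal (Inverse.from T e) ≡ suc (diagonal (Inverse.from T k)))
          (map (Inverse.to T) (neighbours μ (Inverse.from T k)))
    entries-diagonal k T = All.map⁺ (All.map
      (λ {c} → trans (cong diagonal (Inverse.strictlyInverseʳ T c)))
      (neighbours-diagonal (Inverse.from T k)))

    step-diagonal : ∀ k (T : Tableau μ) → Maybe.All
      (λ T′ → diagonal (Inverse.from T′ k) ≡ suc (diagonal (Inverse.from T k)))
      (step μ k T)
    step-diagonal k T
      with map (Inverse.to T) (neighbours μ (Inverse.from T k))
         | entries-diagonal k T
    ... | []     | _        = Maybe.nothing
    ... | e ∷ es | pe ∷ pes
      with Data.List.Extrema.min (Fin.≤-totalOrder (size μ)) e es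
         | Data.List.Extrema.argmin-all (Fin.≤-totalOrder (size μ)) (λ e → e) pe pes
    ...   | m | pm with m Fin.<? k
    ...     | yes _ = Maybe.just
      (trans (cong (diagonal ∘ Inverse.from T) (transpose-k-m-k m k)) pm)
    ...     | no  _ = Maybe.nothing

    stops : ∀ fuel k T → size μ ≤ fuel + diagonal (Inverse.from T k) →
            step μ k (proj₁ (slide μ fuel k T)) ≡ nothing
    stops zero       k T le = contradiction le (ℕ.<⇒≱ (diagonal<size (Inverse.from T k)))
    stops (suc fuel) k T le with step μ k T in eq | step-diagonal k T
    ... | nothing | _             = eq
    ... | just T′ | Maybe.just eq′ = stops fuel k T′
      (subst (size μ ≤_) (trans (sym (ℕ.+-suc fuel _)) (cong (λ d → fuel + d) (sym eq′))) le)

  slide-terminates : ∀ k T → step μ k (proj₁ (slide μ (size μ) k T)) ≡ nothing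
  slide-terminates k T = stops (size μ) k T (ℕ.m≤m+n (size μ) _)

-- tableaux lists every tableau exactly once.

private
  insert-injective : ∀ {n} (i j : Fin (suc n)) (π ρ : Permutation′ n) →
    insert zero i π Perm.≈ insert zero j ρ → i ≡ j × π Perm.≈ ρ
  insert-injective i j π ρ eq with eq zero
  ... | refl = refl , λ k → Fin.punchIn-injective i _ _
    (trans (sym (Perm.insert-punchIn zero i π k))
           (trans (eq (suc k)) (Perm.insert-punchIn zero j ρ k)))

  insert-cong : ∀ {n} (i : Fin (suc n)) {π ρ : Permutation′ n} →
    π Perm.≈ ρ → insert zero i π Perm.≈ insert zero i ρ
  insert-cong i eq zero    = refl
  insert-cong i eq (suc k) = cong (Fin.punchIn i) (eq k)

permutations-complete : ∀ n (π : Permutation′ n) → Any (π Perm.≈_) (permutations n)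
permutations-complete zero    π = here λ ()
permutations-complete (suc n) π = Any.concatMap⁺ _ (lose (∈-allFin (π Perm.⟨$⟩ʳ zero))
  (Any.map⁺ (Any.map
    (λ {ρ} eq k → trans (sym (Perm.insert-remove zero π k)) (insert-cong _ {ρ = ρ} eq k))
    (permutations-complete n (Perm.remove zero π)))))

permutations-unique : ∀ n → AllPairs (λ π ρ → ¬ π Perm.≈ ρ) (permutations n)
permutations-unique zero    = [] ∷ []
permutations-unique (suc n) = AllPairs.concat⁺
  (All.map⁺ (All.universal (λ i → AllPairs.map⁺ (AllPairs.map
    (λ {π} {ρ} π≉ρ eq → π≉ρ (proj₂ (insert-injective i i π ρ eq)))
    (permutations-unique n))) _))
  (AllPairs.map⁺ (AllPairs.tabulate⁺ λ {i} {j} i≢j →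
    All.map⁺ (All.universal (λ π → All.map⁺ (All.universal
      (λ ρ eq → i≢j (proj₁ (insert-injective i j π ρ eq))) _)) _)))

module _ (μ : Partition) where

  _≈ₜ_ : Tableau μ → Tableau μ → Set
  T ≈ₜ U = ∀ c → Inverse.to T c ≡ Inverse.to U c

  tableaux-complete : ∀ T → Any (T ≈ₜ_) (tableaux μ)
  tableaux-complete T = Any.map⁺ (Any.map
    (λ eq c → trans (cong (Inverse.to T) (sym (Inverse.strictlyInverseʳ (rowTableau μ) c)))
                    (eq (Inverse.to (rowTableau μ) c)))
    (permutations-complete (size μ) (T ↔-∘ ↔-sym (rowTableau μ))))

  tableaux-unique : AllPairs (λ T U → ¬ T ≈ₜ U) (tableaux μ)
  tableaux-unique = AllPairs.map⁺ (AllPairs.map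
    (λ {π} {ρ} π≉ρ eq → π≉ρ λ k →
      subst (λ k → π Perm.⟨$⟩ʳ k ≡ ρ Perm.⟨$⟩ʳ k)
            (Inverse.strictlyInverseˡ (rowTableau μ) k)
            (eq (Inverse.from (rowTableau μ) k)))
    (permutations-unique (size μ)))

------------------------------------------------------------------------
-- Notation for the closed formula

fromℕ : ℕ → ℚ
fromℕ n = + n / 1

-- ∑ n f = f 1 + … + f n
∑ : ℕ → (ℕ → ℚ) → ℚ
∑ zero    f = 0ℚ
∑ (suc n) f = ∑ n f ℚ.+ f (suc n)

syntax ∑ n (λ i → e) = ∑[1≤ i ≤ n ] e

infix 6.5 ∑

H : ℕ → ℚ
H zero    = 0ℚ
H (suc m) = H m ℚ.+ + 1 / suc m

C-nonZero : ∀ k m → NonZero ((k + m) C k)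
C-nonZero zero    m = _
C-nonZero (suc k) m = subst NonZero (nCk+nC[k+1]≡[n+1]C[k+1] (k + m) k)
  (ℕ.>-nonZero (ℕ.≤-trans (ℕ.>-nonZero⁻¹ _ {{C-nonZero k m}}) (ℕ.m≤m+n _ _)))

module ClosedForm (λ₂ δ : ℕ) .{{_ : NonZero λ₂}} where

  λ₁ : ℕ
  λ₁ = λ₂ + δ

  u : ℕ → ℚ
  u i = + (2 ^ i * ((i + λ₂) C i)) / (((i + 2 * λ₂) C i) * (1 + i + 2 * λ₂))
    where instance _ = ℕ.m*n≢0 _ (1 + i + 2 * λ₂) {{C-nonZero i (2 * λ₂)}}

  -- The factor 2^(-i) is written as 2^i in the denominator.
  v : ℕ → ℚ
  v i = + ((i + 2 * λ₂) C i) / (2 ^ i * ((i + λ₂) C i) * (i + 2 * λ₂))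
    where
    2^i≢0    = ℕ.m^n≢0 2 i
    i+2λ₂≢0  = ℕ.≢-nonZero λ eq →
      ℕ.≢-nonZero⁻¹ λ₂ (ℕ.m+n≡0⇒m≡0 λ₂ (ℕ.m+n≡0⇒n≡0 i eq))
    instance
      _ = ℕ.m*n≢0 _ (i + 2 * λ₂)
            {{ℕ.m*n≢0 (2 ^ i) _ {{2^i≢0}} {{C-nonZero i λ₂}}}} {{i+2λ₂≢0}}

  closedForm : ℚ
  closedForm =
    + λ₁ ℤ.* (+ λ₁ ℤ.- + 1) / 4 ℚ.+ + λ₂ ℤ.* (+ λ₂ ℤ.- + 3) / 4
    ℚ.- fromℕ 2 ℚ.*
      ( (ℚ.- 1ℚ ℚ.- fromℕ δ ℚ.+ + ((δ + 1) * 2 ^ (2 * λ₂)) / ((2 * λ₂) C λ₂))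
          ℚ.* (∑[1≤ i ≤ δ ] u i)
      ℚ.+ + (2 ^ (δ + 2) * λ₂ * (1 + δ + λ₂) * ((δ + λ₂) C δ))
            / (((δ + 2 * λ₂) C δ) * (1 + δ + 2 * λ₂))
          ℚ.* (∑[1≤ i ≤ δ ] v i)
      ℚ.- fromℕ (2 * (δ + 1) * λ₂)
          ℚ.* (∑[1≤ i ≤ δ ] u i ℚ.* (∑[1≤ j ≤ i ] v j))
      ℚ.+ + (2 ^ (2 * λ₂) * (δ + 1)) / (((2 * λ₂) C λ₂) * (1 + 2 * λ₂))
      ℚ.+ + (2 ^ (δ + 1) * (1 + δ + λ₂) * ((δ + λ₂) C δ))
            / (((δ + 2 * λ₂) C δ) * ((2 * λ₂) C λ₂) * (1 + δ + 2 * λ₂))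
          ℚ.* (ℚ.- fromℕ (2 ^ (2 * λ₂)) ℚ.+ fromℕ ((2 * λ₂) C λ₂))
      ℚ.- + (δ + 1) / (1 + 2 * λ₂)
      ℚ.+ fromℕ (δ + 1) ℚ.* H (δ + 2 * λ₂)
      ℚ.+ ½ ℚ.* fromℕ (δ + 1) ℚ.* H λ₂
      ℚ.- fromℕ (δ + 1) ℚ.* H (2 * λ₂)
      ℚ.- fromℕ (δ + 1) ℚ.* H δ
      )
    where
    C₁≢0 = C-nonZero λ₂ (λ₂ + 0)
    C₂≢0 = C-nonZero δ (2 * λ₂)
    instance
      _ = C₁≢0
      _ = ℕ.m*n≢0 _ (1 + δ + 2 * λ₂) {{C₂≢0}}
      _ = ℕ.m*n≢0 _ (1 + 2 * λ₂) {{C₁≢0}}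
      _ = ℕ.m*n≢0 _ (1 + δ + 2 * λ₂) {{ℕ.m*n≢0 _ _ {{C₂≢0}} {{C₁≢0}}}}

{-# OPTIONS --safe #-}
-- Let T n δ = [zⁿ] c(z)^δ / (1 − 4z) with c the Catalan generating function,
-- and let Y n δ = 1 − 2 T n δ / (2n+δ+1 choose n).
--
-- The relative order of the entries in the processed columns is a ballot word.
-- Processing one more column inserts two entries of uniformly distributed rank;
-- lower entry: a letter D is inserted; upper entry: if the path of the word
-- before the new entry stays nonnegative, a letter U is inserted, and otherwise
-- the first D that reaches height −1 becomes a U and a D is inserted.  Every
-- ballot word arises equally often, so that the expected number of exchanges in
-- a column is an average of explicit statistics over all ballot words.  These
-- averages satisfy the lattice recursion of the ballot numbers, which yields
--
--   C(n+1+δ, n+1) − C(n+δ, n) = (2n+δ−1)/2 − 2 Y n δ / (2n+δ+2).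
--
-- Finally Y satisfies first order recursions in both variables.  The one in δ
-- turns the sums of the closed formula into sums of multiples of Y, and with the
-- one in n these telescope to ∑ Y (b−1) δ / (2b+δ), summed over 1 ≤ b ≤ λ₂.
module Submission where

-- A slide only compares entries, so a processed block may be replaced by its ballot word. The new
-- upper entry follows the height of that word: an upper entry met gives it one column of credit, a
-- lower entry uses one up, and a lower entry met without credit forces it down. Different pairs of
-- ranks may give the same word, so a statement on multiplicities is needed. No bijection is built:
-- every count is stated for an arbitrary test function `φ` and proved by induction on the largest
-- letter, and an identity valid for all `φ` says how often each word arises.
--
-- The shape of the averages comes from generating functions. With s = √(1 - 4z), the binomials
-- `paths n δ` are the coefficients of c^δ / s. A sum over initial segments of paths is a
-- convolution, and the product of two such series has the form c^δ / s², whose coefficients are the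
-- `T n δ`. Hence the averages are sought as combinations of `T` and `paths` with polynomial
-- coefficients, and only their recursion has to be checked.

-- Ballot words and the insertion of one column.

module BallotWords where

  open import Data.Nat
  open import Data.Nat.Properties
  open import Algebra.Properties.CommutativeSemigroup +-commutativeSemigroup using () renaming (interchange to +-interchange)
  open import Data.Nat.Tactic.RingSolver using (solve-∀)
  open import Data.List using (List; []; _∷_; length)
  open import Data.Maybe using (Maybe; just; nothing)
  import Data.Maybe as Maybe
  open import Data.Product
  open import Data.Sum
  open import Function using (_∘_)
  open import Relation.Binary.PropositionalEquality

  -- The entries of the processed cells of two rows are recorded, up to order
  -- isomorphism, by the word of their rows (U upper, D lower).  Words are stored
  -- with the largest entry first, so that a tail of a word is an initial segment
  -- of the entries.
  data Letter : Set where
    U D : Letter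

  Word : Set
  Word = List Letter

  descend : Maybe ℕ → Maybe ℕ
  descend (just (suc h)) = just h
  descend (just zero)    = nothing
  descend nothing        = nothing

  -- nothing once a D has occurred at height 0.
  height : Word → Maybe ℕ
  height []      = just 0
  height (U ∷ r) = Maybe.map suc (height r)
  height (D ∷ r) = descend (height r)

  onValid onInvalid : (Word → ℕ) → Word → ℕ
  onValid φ Q with height Q
  ... | just _  = φ Q
  ... | nothing = 0
  onInvalid φ Q with height Q
  ... | just _  = 0
  ... | nothing = φ Q

  -- Meant for words whose height becomes negative: the recursion descends to the longest tail that
  -- is still nonnegative, so that the letter in front of it is the `D` reaching height -1.
  flip : Word → Word
  flip []      = []
  flip (x ∷ r) with height r
  ... | just _  = U ∷ r
  ... | nothing = x ∷ flip r

  -- What becomes of Q when a new entry larger than all others slides in from the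
  -- left of the upper row: if the height of Q becomes negative, then the entry
  -- responsible for this moves up and the new entry ends in the lower row.
  close : Word → Word
  close Q with height Q
  ... | just _  = U ∷ Q
  ... | nothing = D ∷ flip Q

  #U #D : Word → ℕ
  #U []      = 0
  #U (U ∷ r) = suc (#U r)
  #U (D ∷ r) = #U r
  #D []      = 0
  #D (U ∷ r) = #D r
  #D (D ∷ r) = suc (#D r)

  -- Sums over all ranks of a new entry. The test function absorbs the letters of the larger
  -- entries, which stay in place; only the tail is changed.
  ∑D ∑U : (Word → ℕ) → Word → ℕ
  ∑D φ []      = φ (D ∷ [])
  ∑D φ (x ∷ r) = φ (D ∷ x ∷ r) + ∑D (φ ∘ (x ∷_)) r
  ∑U φ []      = φ (close [])
  ∑U φ (x ∷ r) = φ (close (x ∷ r)) + ∑U (φ ∘ (x ∷_)) r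

  -- The sum of φ over the ballot words with n letters D and final height δ.
  V : ℕ → ℕ → (Word → ℕ) → ℕ
  V zero    zero    φ = φ []
  V zero    (suc δ) φ = V zero δ (φ ∘ (U ∷_))
  V (suc n) zero    φ = V n 1 (φ ∘ (D ∷_))
  V (suc n) (suc δ) φ = V (suc n) δ (φ ∘ (U ∷_)) + V n (suc (suc δ)) (φ ∘ (D ∷_))

  record Ballot (n δ : ℕ) (r : Word) : Set where
    constructor ballot
    field
      height≡ : height r ≡ just δ
      #U≡     : #U r ≡ n + δ
      #D≡     : #D r ≡ n

  open Ballot public

  U-ballot : ∀ {n δ r} → Ballot n δ r → Ballot n (suc δ) (U ∷ r)
  U-ballot {n} {δ} (ballot h u d) = ballot (cong (Maybe.map suc) h) (trans (cong suc u) (sym (+-suc n δ))) d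

  D-ballot : ∀ {n δ r} → Ballot n (suc δ) r → Ballot (suc n) δ (D ∷ r)
  D-ballot {n} {δ} (ballot h u d) = ballot (cong descend h) (trans u (+-suc n δ)) (cong suc d)

  V-cong : ∀ n δ {φ ψ : Word → ℕ} → (∀ r → Ballot n δ r → φ r ≡ ψ r) → V n δ φ ≡ V n δ ψ
  V-cong zero    zero    eq = eq [] (ballot refl refl refl)
  V-cong zero    (suc δ) eq = V-cong zero δ λ r b → eq (U ∷ r) (U-ballot b)
  V-cong (suc n) zero    eq = V-cong n 1 λ r b → eq (D ∷ r) (D-ballot b)
  V-cong (suc n) (suc δ) eq =
    cong₂ _+_ (V-cong (suc n) δ λ r b → eq (U ∷ r) (U-ballot b))
              (V-cong n (2 + δ) λ r b → eq (D ∷ r) (D-ballot b))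

  V-+ : ∀ n δ (φ ψ : Word → ℕ) → V n δ (λ r → φ r + ψ r) ≡ V n δ φ + V n δ ψ
  V-+ zero    zero    φ ψ = refl
  V-+ zero    (suc δ) φ ψ = V-+ zero δ _ _
  V-+ (suc n) zero    φ ψ = V-+ n 1 _ _
  V-+ (suc n) (suc δ) φ ψ =
    trans (cong₂ _+_ (V-+ (suc n) δ _ _) (V-+ n (2 + δ) _ _)) (+-interchange (V (suc n) δ _) _ _ _)

  V-* : ∀ n δ c (φ : Word → ℕ) → V n δ (λ r → c * φ r) ≡ c * V n δ φ
  V-* zero    zero    c φ = refl
  V-* zero    (suc δ) c φ = V-* zero δ c _
  V-* (suc n) zero    c φ = V-* n 1 c _
  V-* (suc n) (suc δ) c φ =
    trans (cong₂ _+_ (V-* (suc n) δ c _) (V-* n (2 + δ) c _)) (sym (*-distribˡ-+ c _ _))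

  -- What is known after a `D` has been inserted into a nonnegative path of height `h`: from the
  -- insertion on, the path runs one lower, which may take it below 0.
  InsertedHeight : Maybe ℕ → Word → Set
  InsertedHeight h Q = height Q ≡ nothing ⊎ Maybe.map suc (height Q) ≡ h

  -- Under `∑D` an identity is only needed for words one step below a ballot word, so the laws of
  -- `onValid` and `onInvalid` that depend on the height can be applied there.
  ∑D-cong : ∀ {φ ψ : Word → ℕ} r {h} → height r ≡ just h →
    (∀ Q → InsertedHeight (just h) Q → #U Q ≡ #U r → #D Q ≡ suc (#D r) → φ Q ≡ ψ Q) →
    ∑D φ r ≡ ∑D ψ r
  ∑D-cong []      refl eq = eq _ (inj₁ refl) refl refl
  ∑D-cong {φ} {ψ} (x ∷ r) {h} hr eq =
    cong₂ _+_ (eq _ (top h hr) refl refl) (below x hr eq)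
    where
    top : ∀ h → height (x ∷ r) ≡ just h → InsertedHeight (just h) (D ∷ x ∷ r)
    top zero    e = inj₁ (cong descend e)
    top (suc h) e = inj₂ (cong (Maybe.map suc ∘ descend) e)

    below : ∀ x → height (x ∷ r) ≡ just h →
      (∀ Q → InsertedHeight (just h) Q → #U Q ≡ #U (x ∷ r) → #D Q ≡ suc (#D (x ∷ r)) → φ Q ≡ ψ Q) →
      ∑D (φ ∘ (x ∷_)) r ≡ ∑D (ψ ∘ (x ∷_)) r
    below U hr eq with height r in e
    below U refl eq | just g = ∑D-cong r e λ Q i u d → eq (U ∷ Q) (up Q i) (cong suc u) d
      where
      up : ∀ Q → InsertedHeight (just g) Q → InsertedHeight (just (suc g)) (U ∷ Q)
      up Q (inj₁ i) = inj₁ (cong (Maybe.map suc) i)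
      up Q (inj₂ i) = inj₂ (cong (Maybe.map suc) i)
    below D hr eq with height r in e
    below D refl eq | just (suc g) = ∑D-cong r e λ Q i u d → eq (D ∷ Q) (down Q i) u (cong suc d)
      where
      down : ∀ Q → InsertedHeight (just (suc g)) Q → InsertedHeight (just g) (D ∷ Q)
      down Q (inj₁ i) = inj₁ (cong descend i)
      down Q (inj₂ i) with height Q
      down Q (inj₂ refl) | just zero = inj₁ refl
      down Q (inj₂ refl) | just (suc k) = inj₂ refl

  ∑D-+ : ∀ (φ ψ : Word → ℕ) r → ∑D (λ Q → φ Q + ψ Q) r ≡ ∑D φ r + ∑D ψ r
  ∑D-+ φ ψ []      = refl
  ∑D-+ φ ψ (x ∷ r) = trans (cong (φ (D ∷ x ∷ r) + ψ (D ∷ x ∷ r) +_) (∑D-+ (φ ∘ (x ∷_)) (ψ ∘ (x ∷_)) r))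
    (+-interchange (φ (D ∷ x ∷ r)) _ _ _)

  ∑D-* : ∀ c (φ : Word → ℕ) r → ∑D (λ Q → c * φ Q) r ≡ c * ∑D φ r
  ∑D-* c φ []      = refl
  ∑D-* c φ (x ∷ r) = trans (cong (c * φ (D ∷ x ∷ r) +_) (∑D-* c (φ ∘ (x ∷_)) r))
      (sym (*-distribˡ-+ c (φ (D ∷ x ∷ r)) _))

  ∑D-1 : ∀ r → ∑D (λ _ → 1) r ≡ suc (length r)
  ∑D-1 []      = refl
  ∑D-1 (x ∷ r) = cong suc (∑D-1 r)

  ∑D-0 : ∀ r → ∑D (λ _ → 0) r ≡ 0
  ∑D-0 []      = refl
  ∑D-0 (x ∷ r) = ∑D-0 r

  onValid-nothing : ∀ χ Q → height Q ≡ nothing → onValid χ Q ≡ 0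
  onValid-nothing χ Q e with height Q
  onValid-nothing χ Q refl | nothing = refl

  onValid-just : ∀ χ Q {h} → height Q ≡ just h → onValid χ Q ≡ χ Q
  onValid-just χ Q e with height Q
  onValid-just χ Q refl | just _ = refl

  onInvalid-nothing : ∀ χ Q → height Q ≡ nothing → onInvalid χ Q ≡ χ Q
  onInvalid-nothing χ Q e with height Q
  onInvalid-nothing χ Q refl | nothing = refl

  onInvalid-just : ∀ χ Q {h} → height Q ≡ just h → onInvalid χ Q ≡ 0
  onInvalid-just χ Q e with height Q
  onInvalid-just χ Q refl | just _ = refl

  onValid-U : ∀ χ Q → onValid χ (U ∷ Q) ≡ onValid (χ ∘ (U ∷_)) Q
  onValid-U χ Q with height Q
  ... | just _  = refl
  ... | nothing = refl

  onInvalid-U : ∀ χ Q → onInvalid (χ ∘ flip) (U ∷ Q) ≡ onInvalid (χ ∘ (U ∷_) ∘ flip) Q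
  onInvalid-U χ Q with height Q in e
  ... | just _  = refl
  ... | nothing rewrite e = refl

  onValid-D : ∀ χ Q {h} → InsertedHeight (just (2 + h)) Q → onValid χ (D ∷ Q) ≡ onValid (χ ∘ (D ∷_)) Q
  onValid-D χ Q i with height Q
  onValid-D χ Q (inj₁ refl) | nothing = refl
  onValid-D χ Q (inj₂ refl) | just _  = refl

  onValid-D₀ : ∀ χ Q → InsertedHeight (just 1) Q → onValid χ (D ∷ Q) ≡ 0
  onValid-D₀ χ Q i with height Q
  onValid-D₀ χ Q (inj₁ refl) | nothing = refl
  onValid-D₀ χ Q (inj₂ refl) | just _  = refl

  onInvalid-D : ∀ χ Q {h} → InsertedHeight (just (2 + h)) Q →
    onInvalid (χ ∘ flip) (D ∷ Q) ≡ onInvalid (χ ∘ (D ∷_) ∘ flip) Q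
  onInvalid-D χ Q i with height Q in e
  onInvalid-D χ Q (inj₁ refl) | nothing rewrite e = refl
  onInvalid-D χ Q (inj₂ refl) | just _  = refl

  -- Here a valid `Q` has height 0, so the `D` on top of it is the one that reaches -1, and `flip`
  -- turns this very letter into `U`.
  onInvalid-D₀ : ∀ χ Q → InsertedHeight (just 1) Q →
    onInvalid (χ ∘ flip) (D ∷ Q) ≡ onInvalid (χ ∘ (D ∷_) ∘ flip) Q + onValid (χ ∘ (U ∷_)) Q
  onInvalid-D₀ χ Q i with height Q in e
  onInvalid-D₀ χ Q (inj₁ refl) | nothing rewrite e = sym (+-identityʳ _)
  onInvalid-D₀ χ Q (inj₂ refl) | just _  rewrite e = refl

  onClose : ∀ φ Q → φ (close Q) ≡ onValid (φ ∘ (U ∷_)) Q + onInvalid (φ ∘ (D ∷_) ∘ flip) Q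
  onClose φ Q with height Q
  ... | just _  = sym (+-identityʳ _)
  ... | nothing = refl

  close-ballot : ∀ {n δ r} → Ballot n δ r → close r ≡ U ∷ r
  close-ballot {r = r} b with height r | height≡ b
  ... | just _ | _ = refl

  ∑D-valid-U : ∀ χ {n δ r} → Ballot n δ r → ∑D (onValid χ ∘ (U ∷_)) r ≡ ∑D (onValid (χ ∘ (U ∷_))) r
  ∑D-valid-U χ {r = r} b = ∑D-cong r (height≡ b) λ Q _ _ _ → onValid-U χ Q

  ∑D-valid-D : ∀ χ {n δ r} → Ballot n (2 + δ) r → ∑D (onValid χ ∘ (D ∷_)) r ≡ ∑D (onValid (χ ∘ (D ∷_))) r
  ∑D-valid-D χ {r = r} b = ∑D-cong r (height≡ b) λ Q i _ _ → onValid-D χ Q i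

  ∑D-invalid-U : ∀ χ {n δ r} → Ballot n δ r →
    ∑D (onInvalid (χ ∘ flip) ∘ (U ∷_)) r ≡ ∑D (onInvalid (χ ∘ (U ∷_) ∘ flip)) r
  ∑D-invalid-U χ {r = r} b = ∑D-cong r (height≡ b) λ Q _ _ _ → onInvalid-U χ Q

  ∑D-invalid-D : ∀ χ {n δ r} → Ballot n (2 + δ) r →
    ∑D (onInvalid (χ ∘ flip) ∘ (D ∷_)) r ≡ ∑D (onInvalid (χ ∘ (D ∷_) ∘ flip)) r
  ∑D-invalid-D χ {r = r} b = ∑D-cong r (height≡ b) λ Q i _ _ → onInvalid-D χ Q i

  -- The sum over the possible results of inserting a `D`: one letter `D` more, height `δ` lowered
  -- by one, and nothing if that is negative.
  V-pred : ℕ → ℕ → (Word → ℕ) → ℕ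
  V-pred n zero    χ = 0
  V-pred n (suc δ) χ = V (suc n) δ χ

  V-0 : ∀ n δ → V n δ (λ _ → 0) ≡ 0
  V-0 n δ = V-* n δ 0 (λ _ → 0)

  -- Deleting any `D` from a ballot word leaves a ballot word, so each word on the right arises once
  -- for each of its `n + 1` letters `D`.
  valid-insertions : ∀ n δ χ → V n δ (∑D (onValid χ)) ≡ suc n * V-pred n δ χ
  valid-insertions zero zero χ = refl
  valid-insertions zero (suc δ) χ = begin
    V zero δ (λ r → onValid χ (D ∷ U ∷ r) + ∑D (onValid χ ∘ (U ∷_)) r)
      ≡⟨ V-cong zero δ (λ r b →
          cong₂ _+_ (onValid-just χ (D ∷ U ∷ r) (cong (descend ∘ Maybe.map suc) (height≡ b)))
              (∑D-valid-U χ b)) ⟩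
    V zero δ (λ r → χ (D ∷ U ∷ r) + ∑D (onValid (χ ∘ (U ∷_))) r)
      ≡⟨ V-+ zero δ _ _ ⟩
    V zero (suc δ) (χ ∘ (D ∷_)) + V zero δ (∑D (onValid (χ ∘ (U ∷_))))
      ≡⟨ cong (V zero (suc δ) (χ ∘ (D ∷_)) +_) (valid-insertions zero δ (χ ∘ (U ∷_))) ⟩
    V zero (suc δ) (χ ∘ (D ∷_)) + 1 * V-pred zero δ (χ ∘ (U ∷_))
      ≡⟨ last δ ⟩
    1 * V 1 δ χ ∎
    where
    open ≡-Reasoning
    last : ∀ δ → V zero (suc δ) (χ ∘ (D ∷_)) + 1 * V-pred zero δ (χ ∘ (U ∷_)) ≡ 1 * V 1 δ χ
    last zero    = refl
    last (suc δ) = lem (V 1 δ (χ ∘ (U ∷_))) (V zero (2 + δ) (χ ∘ (D ∷_)))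
      where
      lem : ∀ a b → b + 1 * a ≡ 1 * (a + b)
      lem = solve-∀
  valid-insertions (suc n) zero χ = begin
    V n 1 (λ r → onValid χ (D ∷ D ∷ r) + ∑D (onValid χ ∘ (D ∷_)) r)
      ≡⟨ V-cong n 1 (λ r b → cong₂ _+_ (onValid-nothing χ (D ∷ D ∷ r) (cong (descend ∘ descend) (height≡ b)))
           (trans (∑D-cong r (height≡ b) λ Q i _ _ → onValid-D₀ χ Q i) (∑D-0 r))) ⟩
    V n 1 (λ r → 0) ≡⟨ V-0 n 1 ⟩
    0 ≡⟨ sym (*-zeroʳ (2 + n)) ⟩
    (2 + n) * 0 ∎
    where open ≡-Reasoning
  valid-insertions (suc n) (suc δ) χ = begin
    V (suc n) δ (λ r → onValid χ (D ∷ U ∷ r) + ∑D (onValid χ ∘ (U ∷_)) r)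
    + V n (2 + δ) (λ r → onValid χ (D ∷ D ∷ r) + ∑D (onValid χ ∘ (D ∷_)) r)
      ≡⟨ cong₂ _+_
           (V-cong (suc n) δ λ r b →
               cong₂ _+_ (onValid-just χ (D ∷ U ∷ r) (cong (descend ∘ Maybe.map suc) (height≡ b)))
                   (∑D-valid-U χ b))
           (V-cong n (2 + δ) λ r b →
               cong₂ _+_ (onValid-just χ (D ∷ D ∷ r) (cong (descend ∘ descend) (height≡ b))) (∑D-valid-D χ b)) ⟩
    V (suc n) δ (λ r → χ (D ∷ U ∷ r) + ∑D (onValid (χ ∘ (U ∷_))) r)
    + V n (2 + δ) (λ r → χ (D ∷ D ∷ r) + ∑D (onValid (χ ∘ (D ∷_))) r)
      ≡⟨ cong₂ _+_ (V-+ (suc n) δ _ _) (V-+ n (2 + δ) _ _) ⟩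
    (V (suc n) δ (χ ∘ (D ∷_) ∘ (U ∷_)) + V (suc n) δ (∑D (onValid (χ ∘ (U ∷_)))))
    + (V n (2 + δ) (χ ∘ (D ∷_) ∘ (D ∷_)) + V n (2 + δ) (∑D (onValid (χ ∘ (D ∷_)))))
      ≡⟨ cong₂ (λ a b → (V (suc n) δ (χ ∘ (D ∷_) ∘ (U ∷_)) + a) + (V n (2 + δ) (χ ∘ (D ∷_) ∘ (D ∷_)) + b))
           (valid-insertions (suc n) δ (χ ∘ (U ∷_))) (valid-insertions n (2 + δ) (χ ∘ (D ∷_))) ⟩
    (V (suc n) δ (χ ∘ (D ∷_) ∘ (U ∷_)) + (2 + n) * V-pred (suc n) δ (χ ∘ (U ∷_)))
    + (V n (2 + δ) (χ ∘ (D ∷_) ∘ (D ∷_)) + (1 + n) * V (suc n) (suc δ) (χ ∘ (D ∷_)))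
      ≡⟨ last δ ⟩
    (2 + n) * V (2 + n) δ χ ∎
    where
    open ≡-Reasoning
    last : ∀ δ →
      (V (suc n) δ (χ ∘ (D ∷_) ∘ (U ∷_)) + (2 + n) * V-pred (suc n) δ (χ ∘ (U ∷_)))
      + (V n (2 + δ) (χ ∘ (D ∷_) ∘ (D ∷_)) + (1 + n) * V (suc n) (suc δ) (χ ∘ (D ∷_)))
      ≡ (2 + n) * V (2 + n) δ χ
    last zero = lem n (V (suc n) 0 (χ ∘ (D ∷_) ∘ (U ∷_))) (V n 2 (χ ∘ (D ∷_) ∘ (D ∷_)))
      where
      lem : ∀ n a b → (a + (2 + n) * 0) + (b + (1 + n) * (a + b)) ≡ (2 + n) * (a + b)
      lem = solve-∀
    last (suc δ) = lem n (V (suc n) (suc δ) (χ ∘ (D ∷_) ∘ (U ∷_))) (V n (3 + δ) (χ ∘ (D ∷_) ∘ (D ∷_)))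
                         (V (2 + n) δ (χ ∘ (U ∷_)))
      where
      lem : ∀ n a b c → (a + (2 + n) * c) + (b + (1 + n) * (a + b)) ≡ (2 + n) * (c + (a + b))
      lem = solve-∀

  -- The two ways to gain one `U`: insert it, or insert a `D` that spoils the path and repair the
  -- path with `flip`.
  closing : (Word → ℕ) → Word → ℕ
  closing χ r = ∑U χ r + ∑D (onInvalid (χ ∘ flip)) r

  closing-U : ∀ χ {n δ r} → Ballot n δ r → closing χ (U ∷ r) ≡ χ (U ∷ U ∷ r) + closing (χ ∘ (U ∷_)) r
  closing-U χ {n} {δ} {r} b = begin
    χ (close (U ∷ r)) + ∑U (χ ∘ (U ∷_)) r
        + (onInvalid (χ ∘ flip) (D ∷ U ∷ r) + ∑D (onInvalid (χ ∘ flip) ∘ (U ∷_)) r)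
      ≡⟨ cong₂ _+_ (cong (λ w → χ w + ∑U (χ ∘ (U ∷_)) r) (close-ballot (U-ballot b)))
          (cong₂ _+_ (onInvalid-just (χ ∘ flip) (D ∷ U ∷ r) (cong (descend ∘ Maybe.map suc) (height≡ b)))
              (∑D-invalid-U χ b)) ⟩
    χ (U ∷ U ∷ r) + ∑U (χ ∘ (U ∷_)) r + ∑D (onInvalid (χ ∘ (U ∷_) ∘ flip)) r
      ≡⟨ +-assoc (χ (U ∷ U ∷ r)) _ _ ⟩
    χ (U ∷ U ∷ r) + closing (χ ∘ (U ∷_)) r ∎
    where open ≡-Reasoning

  closing-D : ∀ χ {n δ r} → Ballot n (2 + δ) r → closing χ (D ∷ r) ≡ χ (U ∷ D ∷ r) + closing (χ ∘ (D ∷_)) r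
  closing-D χ {n} {δ} {r} b = begin
    χ (close (D ∷ r)) + ∑U (χ ∘ (D ∷_)) r
        + (onInvalid (χ ∘ flip) (D ∷ D ∷ r) + ∑D (onInvalid (χ ∘ flip) ∘ (D ∷_)) r)
      ≡⟨ cong₂ _+_ (cong (λ w → χ w + ∑U (χ ∘ (D ∷_)) r) (close-ballot (D-ballot b)))
          (cong₂ _+_ (onInvalid-just (χ ∘ flip) (D ∷ D ∷ r) (cong (descend ∘ descend) (height≡ b)))
              (∑D-invalid-D χ b)) ⟩
    χ (U ∷ D ∷ r) + ∑U (χ ∘ (D ∷_)) r + ∑D (onInvalid (χ ∘ (D ∷_) ∘ flip)) r
      ≡⟨ +-assoc (χ (U ∷ D ∷ r)) _ _ ⟩
    χ (U ∷ D ∷ r) + closing (χ ∘ (D ∷_)) r ∎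
    where open ≡-Reasoning

  -- A path that ends at height 0 has two additional sources. A `D` put on top is repaired at once,
  -- which gives a second copy of `U ∷ D ∷ r`; and an insertion that is valid in `r` is spoiled by
  -- the last `D`, which is then the letter that flips.
  closing-D₀ : ∀ χ {n r} → Ballot n 1 r →
    closing χ (D ∷ r) ≡ 2 * χ (U ∷ D ∷ r) + (closing (χ ∘ (D ∷_)) r + ∑D (onValid (χ ∘ (U ∷_))) r)
  closing-D₀ χ {n} {r} b = begin
    χ (close (D ∷ r)) + ∑U (χ ∘ (D ∷_)) r
        + (onInvalid (χ ∘ flip) (D ∷ D ∷ r) + ∑D (onInvalid (χ ∘ flip) ∘ (D ∷_)) r)
      ≡⟨ cong₂ _+_ (cong (λ w → χ w + ∑U (χ ∘ (D ∷_)) r) (close-ballot (D-ballot b)))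
          (cong₂ _+_ (trans (onInvalid-nothing (χ ∘ flip) (D ∷ D ∷ r) (cong (descend ∘ descend) (height≡ b)))
              (cong χ flipped))
            (trans (∑D-cong r (height≡ b) λ Q i _ _ → onInvalid-D₀ χ Q i) (∑D-+ _ _ r))) ⟩
    χ (U ∷ D ∷ r) + ∑U (χ ∘ (D ∷_)) r
    + (χ (U ∷ D ∷ r) + (∑D (onInvalid (χ ∘ (D ∷_) ∘ flip)) r + ∑D (onValid (χ ∘ (U ∷_))) r))
      ≡⟨ lem (χ (U ∷ D ∷ r)) _ _ _ ⟩
    2 * χ (U ∷ D ∷ r) + (closing (χ ∘ (D ∷_)) r + ∑D (onValid (χ ∘ (U ∷_))) r) ∎
    where
    open ≡-Reasoning
    lem : ∀ a b c d → a + b + (a + (c + d)) ≡ 2 * a + (b + c + d)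
    lem = solve-∀
    flipped : flip (D ∷ D ∷ r) ≡ U ∷ D ∷ r
    flipped with height r | height≡ b
    ... | just 1 | refl = refl

  -- Each resulting word has `n + δ + 1` letters `U` and arises once more than that. When the old
  -- path ends at height 0 with `suc n` letters `D`, the words with largest letter `U` are found
  -- directly only twice; `valid-insertions` supplies the missing `n + 1` copies.
  closings : ∀ n δ χ → V n δ (closing χ) ≡ (2 + n + δ) * V n (suc δ) χ
  closings zero zero χ = lem (χ (U ∷ []))
    where
    lem : ∀ a → a + a ≡ 2 * a
    lem = solve-∀
  closings zero (suc δ) χ = begin
    V zero δ (closing χ ∘ (U ∷_)) ≡⟨ V-cong zero δ (λ r → closing-U χ) ⟩
    V zero δ (λ r → χ (U ∷ U ∷ r) + closing (χ ∘ (U ∷_)) r) ≡⟨ V-+ zero δ _ _ ⟩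
    V zero (2 + δ) χ + V zero δ (closing (χ ∘ (U ∷_)))
      ≡⟨ cong (V zero (2 + δ) χ +_) (closings zero δ (χ ∘ (U ∷_))) ⟩
    (3 + δ) * V zero (2 + δ) χ ∎
    where open ≡-Reasoning
  closings (suc n) zero χ = begin
    V n 1 (closing χ ∘ (D ∷_)) ≡⟨ V-cong n 1 (λ r → closing-D₀ χ) ⟩
    V n 1 (λ r → 2 * χ (U ∷ D ∷ r) + (closing (χ ∘ (D ∷_)) r + ∑D (onValid (χ ∘ (U ∷_))) r))
      ≡⟨ trans (V-+ n 1 _ _) (cong₂ _+_ (V-* n 1 2 _) (V-+ n 1 _ _)) ⟩
    2 * V (suc n) 0 (χ ∘ (U ∷_)) + (V n 1 (closing (χ ∘ (D ∷_))) + V n 1 (∑D (onValid (χ ∘ (U ∷_)))))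
      ≡⟨ cong (2 * V (suc n) 0 (χ ∘ (U ∷_)) +_)
          (cong₂ _+_ (closings n 1 (χ ∘ (D ∷_))) (valid-insertions n 1 (χ ∘ (U ∷_)))) ⟩
    2 * V (suc n) 0 (χ ∘ (U ∷_)) + ((2 + n + 1) * V n 2 (χ ∘ (D ∷_)) + suc n * V (suc n) 0 (χ ∘ (U ∷_)))
      ≡⟨ lem n (V (suc n) 0 (χ ∘ (U ∷_))) (V n 2 (χ ∘ (D ∷_))) ⟩
    (3 + n + 0) * V (suc n) 1 χ ∎
    where
    open ≡-Reasoning
    lem : ∀ n a b → 2 * a + ((2 + n + 1) * b + suc n * a) ≡ (3 + n + 0) * (a + b)
    lem = solve-∀
  closings (suc n) (suc δ) χ = begin
    V (suc n) δ (closing χ ∘ (U ∷_)) + V n (2 + δ) (closing χ ∘ (D ∷_))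
      ≡⟨ cong₂ _+_ (V-cong (suc n) δ λ r → closing-U χ) (V-cong n (2 + δ) λ r → closing-D χ) ⟩
    V (suc n) δ (λ r → χ (U ∷ U ∷ r) + closing (χ ∘ (U ∷_)) r)
    + V n (2 + δ) (λ r → χ (U ∷ D ∷ r) + closing (χ ∘ (D ∷_)) r)
      ≡⟨ cong₂ _+_ (V-+ (suc n) δ _ _) (V-+ n (2 + δ) _ _) ⟩
    (V (suc n) δ (χ ∘ (U ∷_) ∘ (U ∷_)) + V (suc n) δ (closing (χ ∘ (U ∷_))))
    + (V n (2 + δ) (χ ∘ (U ∷_) ∘ (D ∷_)) + V n (2 + δ) (closing (χ ∘ (D ∷_))))
      ≡⟨ cong₂ (λ a b → (V (suc n) δ (χ ∘ (U ∷_) ∘ (U ∷_)) + a) + (V n (2 + δ) (χ ∘ (U ∷_) ∘ (D ∷_)) + b))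
           (closings (suc n) δ (χ ∘ (U ∷_))) (closings n (2 + δ) (χ ∘ (D ∷_))) ⟩
    (V (suc n) δ (χ ∘ (U ∷_) ∘ (U ∷_)) + (3 + n + δ) * V (suc n) (suc δ) (χ ∘ (U ∷_)))
    + (V n (2 + δ) (χ ∘ (U ∷_) ∘ (D ∷_)) + (2 + n + (2 + δ)) * V n (3 + δ) (χ ∘ (D ∷_)))
      ≡⟨ lem n δ (V (suc n) δ (χ ∘ (U ∷_) ∘ (U ∷_))) (V n (2 + δ) (χ ∘ (U ∷_) ∘ (D ∷_)))
          (V n (3 + δ) (χ ∘ (D ∷_))) ⟩
    (3 + n + suc δ) * V (suc n) (2 + δ) χ ∎
    where
    open ≡-Reasoning
    lem : ∀ n δ a b c → (a + (3 + n + δ) * (a + b))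
        + (b + (2 + n + (2 + δ)) * c) ≡ (3 + n + suc δ) * (a + b + c)
    lem = solve-∀

  -- The pairs of insertions in which a new entry is the largest of all: the lower one in the first
  -- summand, the upper one in the second. The remaining pairs keep the largest letter and fall to
  -- the induction.
  newest : (Word → ℕ) → Word → ℕ
  newest φ r = ∑U (φ ∘ (D ∷_)) r + ∑D (φ ∘ close) r

  ∑D∑U-∷ : ∀ φ x r → ∑D (∑U φ) (x ∷ r) ≡ newest φ (x ∷ r) + ∑D (∑U (φ ∘ (x ∷_))) r
  ∑D∑U-∷ φ x r = begin
    φ (close (D ∷ x ∷ r)) + ∑U (φ ∘ (D ∷_)) (x ∷ r) + ∑D (λ Q → φ (close (x ∷ Q)) + ∑U (φ ∘ (x ∷_)) Q) r
      ≡⟨ cong (φ (close (D ∷ x ∷ r)) + ∑U (φ ∘ (D ∷_)) (x ∷ r) +_) (∑D-+ _ _ r) ⟩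
    φ (close (D ∷ x ∷ r)) + ∑U (φ ∘ (D ∷_)) (x ∷ r) + (∑D (φ ∘ close ∘ (x ∷_)) r + ∑D (∑U (φ ∘ (x ∷_))) r)
      ≡⟨ lem (φ (close (D ∷ x ∷ r))) _ _ _ ⟩
    newest φ (x ∷ r) + ∑D (∑U (φ ∘ (x ∷_))) r ∎
    where
    open ≡-Reasoning
    lem : ∀ a b c d → a + b + (c + d) ≡ b + (a + c) + d
    lem = solve-∀

  -- `close` puts `U` on top of a valid word and `D` on top of a repaired one. The results with `D`
  -- on top unite with the first summand to `closing`; those with `U` on top are valid insertions.
  newest-sum : ∀ n δ φ → V n δ (newest φ) ≡ (2 + n + δ) * V n (suc δ) (φ ∘ (D ∷_))
      + suc n * V-pred n δ (φ ∘ (U ∷_))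
  newest-sum n δ φ = begin
    V n δ (newest φ)
      ≡⟨ V-cong n δ (λ r b → trans
           (cong (∑U (φ ∘ (D ∷_)) r +_) (trans (∑D-cong r (height≡ b) λ Q _ _ _ → onClose φ Q) (∑D-+ _ _ r)))
           (lem (∑U (φ ∘ (D ∷_)) r) _ _)) ⟩
    V n δ (λ r → closing (φ ∘ (D ∷_)) r + ∑D (onValid (φ ∘ (U ∷_))) r) ≡⟨ V-+ n δ _ _ ⟩
    V n δ (closing (φ ∘ (D ∷_))) + V n δ (∑D (onValid (φ ∘ (U ∷_))))
      ≡⟨ cong₂ _+_ (closings n δ _) (valid-insertions n δ _) ⟩
    (2 + n + δ) * V n (suc δ) (φ ∘ (D ∷_)) + suc n * V-pred n δ (φ ∘ (U ∷_)) ∎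
    where
    open ≡-Reasoning
    lem : ∀ a b c → a + (b + c) ≡ a + c + b
    lem = solve-∀

  -- The Novelli–Pak–Stoyanovskii theorem for one column: the factor is the product
  -- of the hook lengths of its two cells.
  column-insertions : ∀ n δ φ → V n δ (∑D (∑U φ)) ≡ (2 + n + δ) * suc n * V (suc n) δ φ
  column-insertions zero zero φ = trans (newest-sum zero zero φ) (lem (V zero 1 (φ ∘ (D ∷_))))
    where
    lem : ∀ a → 2 * a + 1 * 0 ≡ 2 * 1 * a
    lem = solve-∀
  column-insertions zero (suc δ) φ = begin
    V zero δ (λ r → ∑D (∑U φ) (U ∷ r)) ≡⟨ V-cong zero δ (λ r b → ∑D∑U-∷ φ U r) ⟩
    V zero δ (λ r → newest φ (U ∷ r) + ∑D (∑U (φ ∘ (U ∷_))) r) ≡⟨ V-+ zero δ _ _ ⟩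
    V zero (suc δ) (newest φ) + V zero δ (∑D (∑U (φ ∘ (U ∷_))))
      ≡⟨ cong₂ _+_ (newest-sum zero (suc δ) φ) (column-insertions zero δ (φ ∘ (U ∷_))) ⟩
    (3 + δ) * V zero (2 + δ) (φ ∘ (D ∷_)) + 1 * V 1 δ (φ ∘ (U ∷_)) + (2 + δ) * 1 * V 1 δ (φ ∘ (U ∷_))
      ≡⟨ lem δ (V 1 δ (φ ∘ (U ∷_))) (V zero (2 + δ) (φ ∘ (D ∷_))) ⟩
    (2 + suc δ) * 1 * V 1 (suc δ) φ ∎
    where
    open ≡-Reasoning
    lem : ∀ δ a b → (3 + δ) * b + 1 * a + (2 + δ) * 1 * a ≡ (2 + suc δ) * 1 * (a + b)
    lem = solve-∀
  column-insertions (suc n) zero φ = begin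
    V n 1 (λ r → ∑D (∑U φ) (D ∷ r)) ≡⟨ V-cong n 1 (λ r b → ∑D∑U-∷ φ D r) ⟩
    V n 1 (λ r → newest φ (D ∷ r) + ∑D (∑U (φ ∘ (D ∷_))) r) ≡⟨ V-+ n 1 _ _ ⟩
    V (suc n) 0 (newest φ) + V n 1 (∑D (∑U (φ ∘ (D ∷_))))
      ≡⟨ cong₂ _+_ (newest-sum (suc n) 0 φ) (column-insertions n 1 (φ ∘ (D ∷_))) ⟩
    (3 + n + 0) * V (suc n) 1 (φ ∘ (D ∷_)) + (2 + n) * 0 + (2 + n + 1) * suc n * V (suc n) 1 (φ ∘ (D ∷_))
      ≡⟨ lem n (V (suc n) 1 (φ ∘ (D ∷_))) ⟩
    (3 + n + 0) * (2 + n) * V (2 + n) 0 φ ∎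
    where
    open ≡-Reasoning
    lem : ∀ n a → (3 + n + 0) * a + (2 + n) * 0 + (2 + n + 1) * suc n * a ≡ (3 + n + 0) * (2 + n) * a
    lem = solve-∀
  column-insertions (suc n) (suc δ) φ = begin
    V (suc n) δ (λ r → ∑D (∑U φ) (U ∷ r)) + V n (2 + δ) (λ r → ∑D (∑U φ) (D ∷ r))
      ≡⟨ cong₂ _+_ (V-cong (suc n) δ (λ r b → ∑D∑U-∷ φ U r)) (V-cong n (2 + δ) (λ r b → ∑D∑U-∷ φ D r)) ⟩
    V (suc n) δ (λ r → newest φ (U ∷ r) + ∑D (∑U (φ ∘ (U ∷_))) r)
    + V n (2 + δ) (λ r → newest φ (D ∷ r) + ∑D (∑U (φ ∘ (D ∷_))) r)
      ≡⟨ cong₂ _+_ (V-+ (suc n) δ _ _) (V-+ n (2 + δ) _ _) ⟩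
    (V (suc n) δ (newest φ ∘ (U ∷_)) + V (suc n) δ (∑D (∑U (φ ∘ (U ∷_)))))
    + (V n (2 + δ) (newest φ ∘ (D ∷_)) + V n (2 + δ) (∑D (∑U (φ ∘ (D ∷_)))))
      ≡⟨ +-interchange (V (suc n) δ (newest φ ∘ (U ∷_))) _ _ _ ⟩
    V (suc n) (suc δ) (newest φ)
    + (V (suc n) δ (∑D (∑U (φ ∘ (U ∷_)))) + V n (2 + δ) (∑D (∑U (φ ∘ (D ∷_)))))
      ≡⟨ cong₂ _+_ (newest-sum (suc n) (suc δ) φ)
           (cong₂ _+_ (column-insertions (suc n) δ (φ ∘ (U ∷_))) (column-insertions n (2 + δ) (φ ∘ (D ∷_)))) ⟩
    (3 + n + suc δ) * V (suc n) (2 + δ) (φ ∘ (D ∷_)) + (2 + n) * V (2 + n) δ (φ ∘ (U ∷_))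
    + ((3 + n + δ) * (2 + n) * V (2 + n) δ (φ ∘ (U ∷_))
        + (2 + n + (2 + δ)) * suc n * V (suc n) (2 + δ) (φ ∘ (D ∷_)))
      ≡⟨ lem n δ (V (2 + n) δ (φ ∘ (U ∷_))) (V (suc n) (2 + δ) (φ ∘ (D ∷_))) ⟩
    (3 + n + suc δ) * (2 + n) * V (2 + n) (suc δ) φ ∎
    where
    open ≡-Reasoning
    lem : ∀ n δ a b → (3 + n + suc δ) * b + (2 + n) * a
        + ((3 + n + δ) * (2 + n) * a + (2 + n + (2 + δ)) * suc n * b)
      ≡ (3 + n + suc δ) * (2 + n) * (a + b)
    lem = solve-∀

-- Numbers of ballot words and of their insertions.

module BallotCounts where

  open BallotWords
  open import Data.Nat
  open import Data.Nat.Properties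
  open import Algebra.Properties.CommutativeSemigroup +-commutativeSemigroup using () renaming (interchange to +-interchange)
  open import Data.Nat.Tactic.RingSolver using (solve-∀)
  open import Data.List using ([]; _∷_; length)
  open import Data.Maybe using (just; nothing)
  open import Function using (_∘_)
  open import Relation.Binary.PropositionalEquality

  ∑P : (Word → ℕ) → Word → ℕ
  ∑P φ []      = φ []
  ∑P φ (x ∷ r) = φ (x ∷ r) + ∑P φ r

  -- The new entry passes the letters U up to the first time at height −1, which are as
  -- many as the letters D before that time, and the letters D from then on.
  closeCost : Word → ℕ
  closeCost Q with height Q
  ... | just _  = #U Q
  ... | nothing = #D Q

  -- The number of all words with n letters D and n + δ letters U; see paths≡C.
  paths : ℕ → ℕ → ℕ
  paths zero    δ       = 1
  paths (suc n) zero    = 2 * paths n 1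
  paths (suc n) (suc δ) = paths (suc n) δ + paths n (2 + δ)

  -- In binomials: (n+1) C(2n+2+δ, n+1) = (n+2+δ) C(2n+2+δ, n).
  paths-absorption : ∀ n δ → suc n * paths (suc n) δ ≡ (2 + n + δ) * paths n (2 + δ)
  paths-absorption zero zero = refl
  paths-absorption zero (suc δ) = begin
    1 * (paths 1 δ + 1) ≡⟨ l₁ (paths 1 δ) ⟩
    1 * paths 1 δ + 1 ≡⟨ cong (_+ 1) (paths-absorption zero δ) ⟩
    (2 + δ) * 1 + 1 ≡⟨ l₂ δ ⟩
    (3 + δ) * 1 ∎
    where
    open ≡-Reasoning
    l₁ : ∀ a → 1 * (a + 1) ≡ 1 * a + 1
    l₁ = solve-∀
    l₂ : ∀ δ → (2 + δ) * 1 + 1 ≡ (3 + δ) * 1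
    l₂ = solve-∀
  paths-absorption (suc m) zero = begin
    (2 + m) * (2 * a) ≡⟨ l₁ m a ⟩
    (3 + m) * a + suc m * a ≡⟨ cong ((3 + m) * a +_) (paths-absorption m 1) ⟩
    (3 + m) * a + (2 + m + 1) * b ≡⟨ l₂ m a b ⟩
    (3 + m + 0) * (a + b) ∎
    where
    open ≡-Reasoning
    a b : ℕ
    a = paths (suc m) 1
    b = paths m 3
    l₁ : ∀ m a → (2 + m) * (2 * a) ≡ (3 + m) * a + suc m * a
    l₁ = solve-∀
    l₂ : ∀ m a b → (3 + m) * a + (2 + m + 1) * b ≡ (3 + m + 0) * (a + b)
    l₂ = solve-∀
  paths-absorption (suc m) (suc δ) = begin
    (2 + m) * (paths (2 + m) δ + a) ≡⟨ *-distribˡ-+ (2 + m) (paths (2 + m) δ) a ⟩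
    (2 + m) * paths (2 + m) δ + (2 + m) * a ≡⟨ cong (_+ (2 + m) * a) (paths-absorption (suc m) δ) ⟩
    (3 + m + δ) * a + (2 + m) * a ≡⟨ l₁ m δ a ⟩
    (4 + m + δ) * a + suc m * a ≡⟨ cong ((4 + m + δ) * a +_) (paths-absorption m (2 + δ)) ⟩
    (4 + m + δ) * a + (2 + m + (2 + δ)) * b ≡⟨ l₂ m δ a b ⟩
    (3 + m + suc δ) * (a + b) ∎
    where
    open ≡-Reasoning
    a b : ℕ
    a = paths (suc m) (2 + δ)
    b = paths m (4 + δ)
    l₁ : ∀ m δ a → (3 + m + δ) * a + (2 + m) * a ≡ (4 + m + δ) * a + suc m * a
    l₁ = solve-∀
    l₂ : ∀ m δ a b → (4 + m + δ) * a + (2 + m + (2 + δ)) * b ≡ (3 + m + suc δ) * (a + b)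
    l₂ = solve-∀

  ballots : ℕ → ℕ → ℕ
  ballots n δ = V n δ (λ _ → 1)

  -- The reflection principle: reflecting up to the first visit of -1 turns the bad words into all
  -- words that rise by `δ + 2` and have one `D` less.
  ballots-suc : ∀ n δ → ballots (suc n) δ + paths n (2 + δ) ≡ paths (suc n) δ
  ballots-zero : ∀ δ → ballots zero δ ≡ 1
  ballots-zero zero    = refl
  ballots-zero (suc δ) = ballots-zero δ
  ballots-suc zero    zero    = refl
  ballots-suc zero    (suc δ) = begin
    ballots 1 δ + ballots zero (2 + δ) + 1 ≡⟨ cong (λ a → ballots 1 δ + a + 1) (ballots-zero (2 + δ)) ⟩
    ballots 1 δ + 1 + 1 ≡⟨ cong (_+ 1) (ballots-suc zero δ) ⟩
    paths 1 δ + 1 ∎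
    where open ≡-Reasoning
  ballots-suc (suc m) zero = begin
    ballots (suc m) 1 + (paths (suc m) 1 + paths m 3) ≡⟨ lem (ballots (suc m) 1) (paths (suc m) 1) (paths m 3) ⟩
    paths (suc m) 1 + (ballots (suc m) 1 + paths m 3) ≡⟨ cong (paths (suc m) 1 +_) (ballots-suc m 1) ⟩
    paths (suc m) 1 + paths (suc m) 1 ≡⟨ cong (paths (suc m) 1 +_) (sym (+-identityʳ _)) ⟩
    2 * paths (suc m) 1 ∎
    where
    open ≡-Reasoning
    lem : ∀ a b c → a + (b + c) ≡ b + (a + c)
    lem = solve-∀
  ballots-suc (suc m) (suc δ) = begin
    ballots (2 + m) δ + ballots (suc m) (2 + δ) + (paths (suc m) (2 + δ) + paths m (4 + δ))
      ≡⟨ lem (ballots (2 + m) δ) _ _ _ ⟩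
    ballots (2 + m) δ + paths (suc m) (2 + δ) + (ballots (suc m) (2 + δ) + paths m (4 + δ))
      ≡⟨ cong₂ _+_ (ballots-suc (suc m) δ) (ballots-suc m (2 + δ)) ⟩
    paths (2 + m) δ + paths (suc m) (2 + δ) ∎
    where
    open ≡-Reasoning
    lem : ∀ a b c d → a + b + (c + d) ≡ a + c + (b + d)
    lem = solve-∀

  -- The ballot number (δ+1)/(2n+δ+1) · C(2n+δ+1, n) without its denominator. The left side is also
  -- the number of ways to insert a letter into a ballot word.
  ballots-paths : ∀ n δ → (1 + 2 * n + δ) * ballots n δ ≡ suc δ * paths n (suc δ)
  ballots-paths zero δ = cong (suc δ *_) (ballots-zero δ)
  ballots-paths (suc n) δ = +-cancelʳ-≡ _ _ _ (begin
    (1 + 2 * suc n + δ) * v + (1 + 2 * suc n + δ) * b ≡⟨ sym (*-distribˡ-+ (1 + 2 * suc n + δ) v b) ⟩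
    (1 + 2 * suc n + δ) * (v + b) ≡⟨ cong ((1 + 2 * suc n + δ) *_) (ballots-suc n δ) ⟩
    (1 + 2 * suc n + δ) * a ≡⟨ l₁ n δ a ⟩
    suc δ * a + 2 * (suc n * a) ≡⟨ cong (λ z → suc δ * a + 2 * z) (paths-absorption n δ) ⟩
    suc δ * a + 2 * ((2 + n + δ) * b) ≡⟨ l₂ n δ a b ⟩
    suc δ * (a + b) + (1 + 2 * suc n + δ) * b ∎)
    where
    open ≡-Reasoning
    a b v : ℕ
    a = paths (suc n) δ
    b = paths n (2 + δ)
    v = ballots (suc n) δ
    l₁ : ∀ n δ a → (1 + 2 * suc n + δ) * a ≡ suc δ * a + 2 * (suc n * a)
    l₁ = solve-∀
    l₂ : ∀ n δ a b → suc δ * a + 2 * ((2 + n + δ) * b) ≡ suc δ * (a + b) + (1 + 2 * suc n + δ) * b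
    l₂ = solve-∀

  -- Compared with `ballots-paths`: of the `suc δ * paths n (suc δ)` insertions of a `D`, all but
  -- `paths n (suc δ)` keep the path nonnegative.
  V-∑D-valid : ∀ n δ → V n δ (∑D (onValid (λ _ → 1))) ≡ δ * paths n (suc δ)
  V-∑D-valid n zero    = trans (valid-insertions n zero (λ _ → 1)) (*-zeroʳ (suc n))
  V-∑D-valid n (suc δ) = trans (valid-insertions n (suc δ) (λ _ → 1)) (+-cancelʳ-≡ _ _ _ (begin
    suc n * v + suc n * b ≡⟨ sym (*-distribˡ-+ (suc n) v b) ⟩
    suc n * (v + b) ≡⟨ cong (suc n *_) (ballots-suc n δ) ⟩
    suc n * paths (suc n) δ ≡⟨ paths-absorption n δ ⟩
    (2 + n + δ) * b ≡⟨ lem n δ b ⟩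
    suc δ * b + suc n * b ∎))
    where
    open ≡-Reasoning
    b v : ℕ
    b = paths n (2 + δ)
    v = ballots (suc n) δ
    lem : ∀ n δ b → (2 + n + δ) * b ≡ suc δ * b + suc n * b
    lem = solve-∀

  length-ballot : ∀ r → length r ≡ #U r + #D r
  length-ballot []      = refl
  length-ballot (U ∷ r) = cong suc (length-ballot r)
  length-ballot (D ∷ r) = trans (cong suc (length-ballot r)) (sym (+-suc (#U r) (#D r)))

  -- After the insertion `closeCost` takes only two values, `n + δ` on valid and `n + 1` on invalid
  -- words. The number of invalid words is known as a difference, so `suc n * cv` is added to both
  -- sides first.
  V-∑D-closeCost : ∀ n δ → V n δ (∑D closeCost) ≡ ((n + δ) * δ + suc n) * paths n (suc δ)
  V-∑D-closeCost n δ = +-cancelʳ-≡ _ _ _ (begin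
    V n δ (∑D closeCost) + suc n * cv
      ≡⟨ cong (λ z → z + suc n * cv) (V-cong n δ pointwise) ⟩
    V n δ (λ r → (n + δ) * ∑D (onValid one) r + suc n * ∑D (onInvalid one) r) + suc n * cv
      ≡⟨ cong (_+ suc n * cv) (trans (V-+ n δ _ _) (cong₂ _+_ (V-* n δ (n + δ) _) (V-* n δ (suc n) _))) ⟩
    (n + δ) * cv + suc n * ci + suc n * cv ≡⟨ l₀ n δ cv ci ⟩
    (n + δ) * cv + suc n * (cv + ci) ≡⟨ cong₂ (λ x y → (n + δ) * x + suc n * y) (V-∑D-valid n δ) total ⟩
    (n + δ) * (δ * k) + suc n * (suc δ * k) ≡⟨ l₁ n δ k ⟩
    ((n + δ) * δ + suc n) * k + suc n * (δ * k)
        ≡⟨ cong (λ z → ((n + δ) * δ + suc n) * k + suc n * z) (sym (V-∑D-valid n δ)) ⟩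
    ((n + δ) * δ + suc n) * k + suc n * cv ∎)
    where
    open ≡-Reasoning
    one : Word → ℕ
    one _ = 1
    cv ci k : ℕ
    cv = V n δ (∑D (onValid one))
    ci = V n δ (∑D (onInvalid one))
    k  = paths n (suc δ)
    split : ∀ Q a b → #U Q ≡ a → #D Q ≡ b → closeCost Q ≡ a * onValid one Q + b * onInvalid one Q
    split Q a b refl refl with height Q
    ... | just _  = lem (#U Q) (#D Q)
      where
      lem : ∀ a b → a ≡ a * 1 + b * 0
      lem = solve-∀
    ... | nothing = lem (#U Q) (#D Q)
      where
      lem : ∀ a b → b ≡ a * 0 + b * 1
      lem = solve-∀
    pointwise : ∀ r → Ballot n δ r →
      ∑D closeCost r ≡ (n + δ) * ∑D (onValid one) r + suc n * ∑D (onInvalid one) r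
    pointwise r b = trans
      (∑D-cong r (height≡ b) λ Q _ u d → split Q (n + δ) (suc n) (trans u (#U≡ b)) (trans d (cong suc (#D≡ b))))
      (trans (∑D-+ _ _ r) (cong₂ _+_ (∑D-* (n + δ) _ r) (∑D-* (suc n) _ r)))
    both : ∀ Q → onValid one Q + onInvalid one Q ≡ 1
    both Q with height Q
    ... | just _  = refl
    ... | nothing = refl
    total : cv + ci ≡ suc δ * k
    total = begin
      cv + ci ≡⟨ sym (V-+ n δ _ _) ⟩
      V n δ (λ r → ∑D (onValid one) r + ∑D (onInvalid one) r)
        ≡⟨ V-cong n δ (λ r b → trans (sym (∑D-+ _ _ r)) (trans (∑D-cong r (height≡ b) λ Q _ _ _ → both Q)
             (trans (∑D-1 r) (trans (cong suc (trans (length-ballot r) (cong₂ _+_ (#U≡ b) (#D≡ b))))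
                 (l₂ n δ))))) ⟩
      V n δ (λ r → (1 + 2 * n + δ) * 1) ≡⟨ V-* n δ (1 + 2 * n + δ) one ⟩
      (1 + 2 * n + δ) * ballots n δ ≡⟨ ballots-paths n δ ⟩
      suc δ * k ∎
      where
      l₂ : ∀ n δ → suc (n + δ + n) ≡ (1 + 2 * n + δ) * 1
      l₂ = solve-∀
    l₀ : ∀ n δ cv ci → (n + δ) * cv + suc n * ci + suc n * cv ≡ (n + δ) * cv + suc n * (cv + ci)
    l₀ = solve-∀
    l₁ : ∀ n δ k → (n + δ) * (δ * k) + suc n * (suc δ * k) ≡ ((n + δ) * δ + suc n) * k + suc n * (δ * k)
    l₁ = solve-∀

  closeCost-ballot : ∀ {n δ r} → Ballot n δ r → closeCost r ≡ n + δ
  closeCost-ballot {r = r} b with height r | height≡ b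
  ... | just _ | _ = #U≡ b

  -- What the largest letter adds to `∑D (∑P closeCost)`: all tails below a `D` inserted on top, and
  -- the complete word for each position of `D`.
  topIncrement : Word → ℕ
  topIncrement r = ∑P closeCost r + ∑D closeCost r

  topIncrement-∷ : ∀ x r → ∑D (∑P closeCost) (x ∷ r) ≡ topIncrement (x ∷ r) + ∑D (∑P closeCost) r
  topIncrement-∷ x r = begin
    closeCost (D ∷ x ∷ r) + ∑P closeCost (x ∷ r) + ∑D (λ Q → closeCost (x ∷ Q) + ∑P closeCost Q) r
      ≡⟨ cong (closeCost (D ∷ x ∷ r) + ∑P closeCost (x ∷ r) +_) (∑D-+ _ _ r) ⟩
    closeCost (D ∷ x ∷ r) + ∑P closeCost (x ∷ r) + (∑D (closeCost ∘ (x ∷_)) r + ∑D (∑P closeCost) r)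
      ≡⟨ lem (closeCost (D ∷ x ∷ r)) (∑P closeCost (x ∷ r)) _ _ ⟩
    topIncrement (x ∷ r) + ∑D (∑P closeCost) r ∎
    where
    open ≡-Reasoning
    lem : ∀ a b c d → a + b + (c + d) ≡ b + (a + c) + d
    lem = solve-∀

-- Embedding of ℕ into ℚ and polynomial certificates.

module RationalArithmetic where

  open import Defs using (fromℕ)
  open import Data.Nat as ℕ using (ℕ; suc)
  import Data.Nat.Properties as ℕ
  open import Data.Integer as ℤ using (ℤ; +_)
  import Data.Integer.Properties as ℤ
  open import Data.Integer.Tactic.RingSolver as ℤS using ()
  open import Data.Rational as ℚ using (ℚ; 0ℚ; 1ℚ; _/_; _+_; _*_; _-_; -_)
  open import Data.Rational.Properties
  open import Data.Rational.Unnormalised as ℚᵘ using (mkℚᵘ; *≡*)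
  import Data.Rational.Unnormalised.Properties as ℚᵘ
  open import Data.Rational.Solver
  open import Relation.Binary.PropositionalEquality
  open +-*-Solver using (solve; con; _:+_; _:*_; _:-_; :-_; _:=_)

  2ℚ 3ℚ 4ℚ 8ℚ 10ℚ ¼ : ℚ
  2ℚ  = fromℕ 2
  3ℚ  = fromℕ 3
  4ℚ  = fromℕ 4
  8ℚ  = fromℕ 8
  10ℚ = fromℕ 10
  ¼   = + 1 / 4

  fromℚᵘ-+ : ∀ p q → ℚ.fromℚᵘ (p ℚᵘ.+ q) ≡ ℚ.fromℚᵘ p + ℚ.fromℚᵘ q
  fromℚᵘ-+ p q = toℚᵘ-injective (ℚᵘ.≃-trans (toℚᵘ-fromℚᵘ (p ℚᵘ.+ q)) (ℚᵘ.≃-sym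
    (ℚᵘ.≃-trans (toℚᵘ-homo-+ (ℚ.fromℚᵘ p) (ℚ.fromℚᵘ q)) (ℚᵘ.+-cong (toℚᵘ-fromℚᵘ p) (toℚᵘ-fromℚᵘ q)))))

  fromℚᵘ-* : ∀ p q → ℚ.fromℚᵘ (p ℚᵘ.* q) ≡ ℚ.fromℚᵘ p * ℚ.fromℚᵘ q
  fromℚᵘ-* p q = toℚᵘ-injective (ℚᵘ.≃-trans (toℚᵘ-fromℚᵘ (p ℚᵘ.* q)) (ℚᵘ.≃-sym
    (ℚᵘ.≃-trans (toℚᵘ-homo-* (ℚ.fromℚᵘ p) (ℚ.fromℚᵘ q)) (ℚᵘ.*-cong (toℚᵘ-fromℚᵘ p) (toℚᵘ-fromℚᵘ q)))))

  fromℤ : ℤ → ℚ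
  fromℤ i = i / 1

  fromℤ-+ : ∀ i j → fromℤ (i ℤ.+ j) ≡ fromℤ i + fromℤ j
  fromℤ-+ i j = trans (fromℚᵘ-cong {mkℚᵘ (i ℤ.+ j) 0} {mkℚᵘ i 0 ℚᵘ.+ mkℚᵘ j 0} (*≡* (lem i j)))
    (fromℚᵘ-+ (mkℚᵘ i 0) (mkℚᵘ j 0))
    where
    lem : ∀ i j → (i ℤ.+ j) ℤ.* + 1 ≡ (i ℤ.* + 1 ℤ.+ j ℤ.* + 1) ℤ.* + 1
    lem = ℤS.solve-∀

  fromℤ-* : ∀ i j → fromℤ (i ℤ.* j) ≡ fromℤ i * fromℤ j
  fromℤ-* i j = trans (fromℚᵘ-cong {mkℚᵘ (i ℤ.* j) 0} {mkℚᵘ i 0 ℚᵘ.* mkℚᵘ j 0} (*≡* refl))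
    (fromℚᵘ-* (mkℚᵘ i 0) (mkℚᵘ j 0))

  /-cancel : ∀ i n .{{_ : ℕ.NonZero n}} → (i / n) * fromℕ n ≡ fromℤ i
  /-cancel i n@(suc m) = trans (sym (fromℚᵘ-* (mkℚᵘ i m) (mkℚᵘ (+ n) 0)))
    (fromℚᵘ-cong {mkℚᵘ i m ℚᵘ.* mkℚᵘ (+ n) 0} {mkℚᵘ i 0}
      (*≡* (trans (ℤ.*-identityʳ (i ℤ.* + n)) (cong (λ k → i ℤ.* + k) (sym (ℕ.*-identityʳ n))))))

  fromℕ-+ : ∀ m n → fromℕ (m ℕ.+ n) ≡ fromℕ m + fromℕ n
  fromℕ-+ m n = fromℤ-+ (+ m) (+ n)

  fromℕ-* : ∀ m n → fromℕ (m ℕ.* n) ≡ fromℕ m * fromℕ n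
  fromℕ-* m n = trans (cong fromℤ (ℤ.pos-* m n)) (fromℤ-* (+ m) (+ n))

  fromℕ-suc : ∀ n → fromℕ (suc n) ≡ 1ℚ + fromℕ n
  fromℕ-suc = fromℕ-+ 1

  fromℕ-≢0 : ∀ n .{{_ : ℕ.NonZero n}} → fromℕ n ≢ 0ℚ
  fromℕ-≢0 (suc n) eq with fromℚᵘ-injective {mkℚᵘ (+ suc n) 0} {mkℚᵘ (+ 0) 0} eq
  ... | *≡* ()

  -- The tool behind the rational identities with hypotheses: the difference of the two sides is
  -- written as a combination of the hypotheses with explicit cofactors `c`, and the ring solver
  -- checks the polynomial identity that is left.
  modulo : ∀ {x y p q} c → p ≡ q → x ≡ y + c * (p - q) → x ≡ y
  modulo {x} {y} {p} c refl eq = trans eq (lem y c p)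
    where
    lem : ∀ y c p → y + c * (p - p) ≡ y
    lem = solve 3 (λ y c p →
        y :+ c :* (p :- p)
        := y) refl

  *-cancelˡ-≢0 : ∀ {x y} c → c ≢ 0ℚ → c * x ≡ c * y → x ≡ y
  *-cancelˡ-≢0 {x} {y} c c≢0 eq = begin
    x ≡⟨ sym (*-identityˡ x) ⟩
    1ℚ * x ≡⟨ cong (_* x) (sym (*-inverseˡ c)) ⟩
    (ℚ.1/ c) * c * x ≡⟨ *-assoc (ℚ.1/ c) c x ⟩
    (ℚ.1/ c) * (c * x) ≡⟨ cong ((ℚ.1/ c) *_) eq ⟩
    (ℚ.1/ c) * (c * y) ≡⟨ sym (*-assoc (ℚ.1/ c) c y) ⟩
    (ℚ.1/ c) * c * y ≡⟨ cong (_* y) (*-inverseˡ c) ⟩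
    1ℚ * y ≡⟨ *-identityˡ y ⟩
    y ∎
    where
    open ≡-Reasoning
    instance _ = ℚ.≢-nonZero c≢0

  /-unique : ∀ m n .{{_ : ℕ.NonZero n}} {x} → fromℕ m ≡ fromℕ n * x → + m / n ≡ x
  /-unique m n {x} eq = *-cancelˡ-≢0 (fromℕ n) (fromℕ-≢0 n)
    (trans (*-comm (fromℕ n) (+ m / n)) (trans (/-cancel (+ m) n) eq))

-- Closed forms of the cost statistics over ballot words.

module CostSums where

  open import Defs using (fromℕ)
  open BallotWords
  open RationalArithmetic
  open BallotCounts
  open import Data.Nat as ℕ using (ℕ; zero; suc)
  import Data.Nat.Properties as ℕ
  open import Algebra.Properties.CommutativeSemigroup ℕ.+-commutativeSemigroup using () renaming (interchange to +-interchange)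
  open import Data.Rational as ℚ using (ℚ; 0ℚ; 1ℚ; ½; _+_; _*_; _-_; -_)
  import Data.Rational.Properties as ℚ
  open import Data.Rational.Solver
  open import Data.List using ([]; _∷_)
  open import Data.Product using (_×_)
  open import Function using (_∘_)
  open import Relation.Binary.PropositionalEquality
  open +-*-Solver using (solve; Polynomial; con; _:+_; _:*_; _:-_; :-_; _:=_)

  prev : (ℕ → ℕ → ℚ) → ℕ → ℕ → ℚ
  prev X zero    zero    = 0ℚ
  prev X zero    (suc δ) = X zero δ
  prev X (suc n) zero    = X n 1
  prev X (suc n) (suc δ) = X (suc n) δ + X n (2 ℕ.+ δ)

  module _ (X S : ℕ → ℕ → ℚ) (X-rec : ∀ n δ → X n δ ≡ S n δ + prev X n δ)
           (g s : Word → ℕ) (g-[] : g [] ≡ s []) (g-∷ : ∀ x r → g (x ∷ r) ≡ s (x ∷ r) ℕ.+ g r)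
           (s-sum : ∀ n δ → fromℕ (V n δ s) ≡ S n δ) where

    -- The largest letter adds `s` to `g`, so the sums of `g` obey the ballot recursion with source
    -- `S`. A closed form `X` therefore need only be checked against that recursion.
    lattice-sum : ∀ n δ → fromℕ (V n δ g) ≡ X n δ
    lattice-sum n δ = trans (by-last n δ) (sym (X-rec n δ))
      where
      open ≡-Reasoning
      by-last : ∀ n δ → fromℕ (V n δ g) ≡ S n δ + prev X n δ
      by-last zero zero = trans (cong fromℕ g-[]) (trans (s-sum 0 0) (sym (ℚ.+-identityʳ (S 0 0))))
      by-last zero (suc δ) = begin
        fromℕ (V zero δ (g ∘ (U ∷_))) ≡⟨ cong fromℕ (trans (V-cong zero δ λ r _ → g-∷ U r) (V-+ zero δ _ g)) ⟩
        fromℕ (V zero (suc δ) s ℕ.+ V zero δ g) ≡⟨ fromℕ-+ (V zero (suc δ) s) _ ⟩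
        fromℕ (V zero (suc δ) s) + fromℕ (V zero δ g) ≡⟨ cong₂ _+_ (s-sum zero (suc δ)) (lattice-sum zero δ) ⟩
        S zero (suc δ) + X zero δ ∎
      by-last (suc n) zero = begin
        fromℕ (V n 1 (g ∘ (D ∷_))) ≡⟨ cong fromℕ (trans (V-cong n 1 λ r _ → g-∷ D r) (V-+ n 1 _ g)) ⟩
        fromℕ (V (suc n) zero s ℕ.+ V n 1 g) ≡⟨ fromℕ-+ (V (suc n) zero s) _ ⟩
        fromℕ (V (suc n) zero s) + fromℕ (V n 1 g) ≡⟨ cong₂ _+_ (s-sum (suc n) zero) (lattice-sum n 1) ⟩
        S (suc n) zero + X n 1 ∎
      by-last (suc n) (suc δ) = begin
        fromℕ (V (suc n) δ (g ∘ (U ∷_)) ℕ.+ V n (2 ℕ.+ δ) (g ∘ (D ∷_)))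
          ≡⟨ cong fromℕ (cong₂ ℕ._+_ (trans (V-cong (suc n) δ λ r _ → g-∷ U r) (V-+ (suc n) δ _ g))
                                      (trans (V-cong n (2 ℕ.+ δ) λ r _ → g-∷ D r) (V-+ n (2 ℕ.+ δ) _ g))) ⟩
        fromℕ ((V (suc n) δ (s ∘ (U ∷_)) ℕ.+ V (suc n) δ g)
            ℕ.+ (V n (2 ℕ.+ δ) (s ∘ (D ∷_)) ℕ.+ V n (2 ℕ.+ δ) g))
          ≡⟨ cong fromℕ (+-interchange (V (suc n) δ (s ∘ (U ∷_))) _ _ _) ⟩
        fromℕ (V (suc n) (suc δ) s ℕ.+ (V (suc n) δ g ℕ.+ V n (2 ℕ.+ δ) g))
          ≡⟨ trans (fromℕ-+ (V (suc n) (suc δ) s) _)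
              (cong (fromℕ (V (suc n) (suc δ) s) +_) (fromℕ-+ (V (suc n) δ g) _)) ⟩
        fromℕ (V (suc n) (suc δ) s) + (fromℕ (V (suc n) δ g) + fromℕ (V n (2 ℕ.+ δ) g))
          ≡⟨ cong₂ _+_ (s-sum (suc n) (suc δ)) (cong₂ _+_ (lattice-sum (suc n) δ) (lattice-sum n (2 ℕ.+ δ))) ⟩
        S (suc n) (suc δ) + (X (suc n) δ + X n (2 ℕ.+ δ)) ∎

  pathsℚ pathsℚ₋ : ℕ → ℕ → ℚ
  pathsℚ n δ = fromℕ (paths n δ)
  pathsℚ₋ zero    δ = 0ℚ
  pathsℚ₋ (suc n) δ = pathsℚ n (2 ℕ.+ δ)

  pathsℚ-pascal : ∀ n δ → pathsℚ n (suc δ) ≡ pathsℚ n δ + pathsℚ₋ n δ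
  pathsℚ-pascal zero    δ       = refl
  pathsℚ-pascal (suc n) δ = fromℕ-+ (paths (suc n) δ) _

  -- T n δ = [zⁿ] c(z)^δ / (1 − 4z), where c is the Catalan generating function.
  T : ℕ → ℕ → ℚ
  T n zero    = fromℕ (4 ℕ.^ n)
  T n (suc δ) = 2ℚ * T n δ - pathsℚ n (suc δ)

  T-0 : ∀ δ → T 0 δ ≡ 1ℚ
  T-0 zero    = refl
  T-0 (suc δ) = cong (λ t → 2ℚ * t - 1ℚ) (T-0 δ)

  -- With s = √(1 - 4z) one has c (1 + s) = 2 and 2zc = 1 - s. Multiplied by c^δ / s², the first
  -- identity is the defining recursion of `T` and the second one is this lemma.
  T-suc : ∀ n δ → 2ℚ * T n (suc δ) ≡ T (suc n) δ - pathsℚ (suc n) δ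
  T-suc n zero = begin
    2ℚ * (2ℚ * T n 0 - pathsℚ n 1) ≡⟨ lem (T n 0) (pathsℚ n 1) ⟩
    4ℚ * T n 0 - 2ℚ * pathsℚ n 1 ≡⟨ sym (cong₂ _-_ (fromℕ-* 4 (4 ℕ.^ n)) (fromℕ-* 2 (paths n 1))) ⟩
    T (suc n) 0 - pathsℚ (suc n) 0 ∎
    where
    open ≡-Reasoning
    lem : ∀ t a → 2ℚ * (2ℚ * t - a) ≡ 4ℚ * t - 2ℚ * a
    lem = solve 2 (λ t a →
        con 2ℚ :* (con 2ℚ :* t :- a)
        := con 4ℚ :* t :- con 2ℚ :* a) refl
  T-suc n (suc δ) = begin
    2ℚ * (2ℚ * T n (suc δ) - b) ≡⟨ cong (λ z → 2ℚ * (z - b)) (T-suc n δ) ⟩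
    2ℚ * (T (suc n) δ - a - b) ≡⟨ lem (T (suc n) δ) a b ⟩
    2ℚ * T (suc n) δ - (a + b) - (a + b)
        ≡⟨ cong (λ z → 2ℚ * T (suc n) δ - z - z) (sym (fromℕ-+ (paths (suc n) δ) _)) ⟩
    T (suc n) (suc δ) - pathsℚ (suc n) (suc δ) ∎
    where
    open ≡-Reasoning
    a b : ℚ
    a = pathsℚ (suc n) δ
    b = pathsℚ n (2 ℕ.+ δ)
    lem : ∀ t a b → 2ℚ * (t - a - b) ≡ 2ℚ * t - (a + b) - (a + b)
    lem = solve 3 (λ t a b →
        con 2ℚ :* (t :- a :- b)
        := con 2ℚ :* t :- (a :+ b) :- (a :+ b)) refl

  halve : ∀ {x y} → 2ℚ * x ≡ y → x ≡ ½ * y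
  halve {x} refl = lem x
    where
    lem : ∀ x → x ≡ ½ * (2ℚ * x)
    lem = solve 1 (λ x →
        x
        := con ½ :* (con 2ℚ :* x)) refl

  pathsℚ-absorption : ∀ n δ → (1ℚ + fromℕ n) * pathsℚ (suc n) δ ≡ (2ℚ + fromℕ n + fromℕ δ) * pathsℚ n (2 ℕ.+ δ)
  pathsℚ-absorption n δ = begin
    (1ℚ + fromℕ n) * pathsℚ (suc n) δ ≡⟨ cong (_* pathsℚ (suc n) δ) (sym (fromℕ-suc n)) ⟩
    fromℕ (suc n) * pathsℚ (suc n) δ ≡⟨ sym (fromℕ-* (suc n) (paths (suc n) δ)) ⟩
    fromℕ (suc n ℕ.* paths (suc n) δ) ≡⟨ cong fromℕ (paths-absorption n δ) ⟩
    fromℕ ((2 ℕ.+ n ℕ.+ δ) ℕ.* paths n (2 ℕ.+ δ)) ≡⟨ fromℕ-* (2 ℕ.+ n ℕ.+ δ) (paths n (2 ℕ.+ δ)) ⟩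
    fromℕ (2 ℕ.+ n ℕ.+ δ) * pathsℚ n (2 ℕ.+ δ)
        ≡⟨ cong (_* pathsℚ n (2 ℕ.+ δ)) (trans (fromℕ-+ (2 ℕ.+ n) δ) (cong (_+ fromℕ δ) (fromℕ-+ 2 n))) ⟩
    (2ℚ + fromℕ n + fromℕ δ) * pathsℚ n (2 ℕ.+ δ) ∎
    where open ≡-Reasoning

  -- The variables ν, d, t, k, a, b stand for n, δ, T n δ, paths n (1 + δ) and its two
  -- summands in Pascal's rule.  The boundary cases of the recursion are X-step at
  -- ν = −1 and at d = −1.
  module _ (X : ℚ → ℚ → ℚ → ℚ → ℚ) (S : ℚ → ℚ → ℚ → ℚ → ℚ → ℚ)
           (X-boundary : ∀ ν t k → X ν (- 1ℚ) t k ≡ 0ℚ)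
           (X-zero : ∀ ν d → X ν d 0ℚ 0ℚ ≡ 0ℚ)
           (X-step : ∀ ν d t a b → (1ℚ + ν) * a ≡ (3ℚ + ν + d) * b →
             X (1ℚ + ν) (1ℚ + d) t (a + b)
             ≡ S (1ℚ + ν) (1ℚ + d) t a b + (X (1ℚ + ν) d (½ * (t + a)) a + X ν (2ℚ + d) (½ * (t - a)) b))
           where

    closed : ℕ → ℕ → ℚ
    closed n δ = X (fromℕ n) (fromℕ δ) (T n δ) (pathsℚ n (suc δ))

    source : ℕ → ℕ → ℚ
    source n δ = S (fromℕ n) (fromℕ δ) (T n δ) (pathsℚ n δ) (pathsℚ₋ n δ)

    -- `½ * (t + a)` and `½ * (t - a)` are the values of `T` at the two predecessors, by the
    -- definition of `T` and by `T-suc`. A predecessor outside the lattice contributes 0, by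
    -- `X-boundary` and `X-zero`.
    closed-rec : ∀ n δ → closed n δ ≡ source n δ + prev closed n δ
    closed-rec zero zero = begin
      X 0ℚ 0ℚ 1ℚ 1ℚ ≡⟨ X-step (- 1ℚ) (- 1ℚ) 1ℚ 1ℚ 0ℚ refl ⟩
      source 0 0 + (X 0ℚ (- 1ℚ) 1ℚ 1ℚ + X (- 1ℚ) 1ℚ 0ℚ 0ℚ)
        ≡⟨ cong (source 0 0 +_) (cong₂ _+_ (X-boundary 0ℚ 1ℚ 1ℚ) (X-zero (- 1ℚ) 1ℚ)) ⟩
      source 0 0 + 0ℚ ∎
      where open ≡-Reasoning
    closed-rec zero (suc δ) = begin
      X 0ℚ (fromℕ (suc δ)) (T 0 (suc δ)) 1ℚ
        ≡⟨ cong₂ (λ d t → X 0ℚ d t 1ℚ) (fromℕ-suc δ) (T-0 (suc δ)) ⟩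
      X 0ℚ (1ℚ + fromℕ δ) 1ℚ 1ℚ ≡⟨ X-step (- 1ℚ) (fromℕ δ) 1ℚ 1ℚ 0ℚ (sym (ℚ.*-zeroʳ (3ℚ + - 1ℚ + fromℕ δ))) ⟩
      S 0ℚ (1ℚ + fromℕ δ) 1ℚ 1ℚ 0ℚ + (X 0ℚ (fromℕ δ) 1ℚ 1ℚ + X (- 1ℚ) (2ℚ + fromℕ δ) 0ℚ 0ℚ)
        ≡⟨ cong₂ (λ a b → a + (X 0ℚ (fromℕ δ) 1ℚ 1ℚ + b))
             (cong₂ (λ d t → S 0ℚ d t 1ℚ 0ℚ) (sym (fromℕ-suc δ)) (sym (T-0 (suc δ))))
                 (X-zero (- 1ℚ) (2ℚ + fromℕ δ)) ⟩
      source 0 (suc δ) + (X 0ℚ (fromℕ δ) 1ℚ 1ℚ + 0ℚ)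
        ≡⟨ cong (source 0 (suc δ) +_)
            (trans (ℚ.+-identityʳ _) (cong (λ t → X 0ℚ (fromℕ δ) t 1ℚ) (sym (T-0 δ)))) ⟩
      source 0 (suc δ) + closed 0 δ ∎
      where open ≡-Reasoning
    closed-rec (suc n) zero = begin
      closed (suc n) 0 ≡⟨ cong₂ (λ ν k → X ν 0ℚ t k) (fromℕ-suc n) (pathsℚ-pascal (suc n) 0) ⟩
      X (1ℚ + fromℕ n) 0ℚ t (a + b) ≡⟨ X-step (fromℕ n) (- 1ℚ) t a b hyp ⟩
      S (1ℚ + fromℕ n) 0ℚ t a b + (X (1ℚ + fromℕ n) (- 1ℚ) (½ * (t + a)) a + X (fromℕ n) 1ℚ (½ * (t - a)) b)
        ≡⟨ cong₂ _+_ (cong (λ ν → S ν 0ℚ t a b) (sym (fromℕ-suc n)))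
             (trans (cong₂ _+_ (X-boundary (1ℚ + fromℕ n) (½ * (t + a)) a)
                 (cong (λ t → X (fromℕ n) 1ℚ t b) (sym (halve (T-suc n 0)))))
                    (ℚ.+-identityˡ _)) ⟩
      source (suc n) 0 + closed n 1 ∎
      where
      open ≡-Reasoning
      t a b : ℚ
      t = T (suc n) 0
      a = pathsℚ (suc n) 0
      b = pathsℚ n 2
      lem : ∀ ν b → (2ℚ + ν + 0ℚ) * b ≡ (3ℚ + ν + - 1ℚ) * b
      lem = solve 2 (λ ν b →
          (con 2ℚ :+ ν :+ con 0ℚ) :* b
          := (con 3ℚ :+ ν :+ :- con 1ℚ) :* b) refl
      hyp : (1ℚ + fromℕ n) * a ≡ (3ℚ + fromℕ n + - 1ℚ) * b
      hyp = trans (pathsℚ-absorption n 0) (lem (fromℕ n) b)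
    closed-rec (suc n) (suc δ) = begin
      closed (suc n) (suc δ)
        ≡⟨ trans (cong₂ (λ ν d → X ν d t (pathsℚ (suc n) (2 ℕ.+ δ))) (fromℕ-suc n) (fromℕ-suc δ))
                 (cong (X (1ℚ + fromℕ n) (1ℚ + fromℕ δ) t) (pathsℚ-pascal (suc n) (suc δ))) ⟩
      X (1ℚ + fromℕ n) (1ℚ + fromℕ δ) t (a + b) ≡⟨ X-step (fromℕ n) (fromℕ δ) t a b hyp ⟩
      S (1ℚ + fromℕ n) (1ℚ + fromℕ δ) t a b
      + (X (1ℚ + fromℕ n) (fromℕ δ) (½ * (t + a)) a + X (fromℕ n) (2ℚ + fromℕ δ) (½ * (t - a)) b)
        ≡⟨ cong₂ _+_ (cong₂ (λ ν d → S ν d t a b) (sym (fromℕ-suc n)) (sym (fromℕ-suc δ)))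
             (cong₂ _+_ (cong₂ (λ ν t → X ν (fromℕ δ) t a) (sym (fromℕ-suc n)) (sym (halve twice-T)))
               (cong₂ (λ d t → X (fromℕ n) d t b) (sym (fromℕ-+ 2 δ)) (sym (halve (T-suc n (suc δ)))))) ⟩
      source (suc n) (suc δ) + (closed (suc n) δ + closed n (2 ℕ.+ δ)) ∎
      where
      open ≡-Reasoning
      t a b : ℚ
      t = T (suc n) (suc δ)
      a = pathsℚ (suc n) (suc δ)
      b = pathsℚ n (3 ℕ.+ δ)
      lem : ∀ ν d b → (2ℚ + ν + (1ℚ + d)) * b ≡ (3ℚ + ν + d) * b
      lem = solve 3 (λ ν d b →
          (con 2ℚ :+ ν :+ (con 1ℚ :+ d)) :* b
          := (con 3ℚ :+ ν :+ d) :* b) refl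
      hyp : (1ℚ + fromℕ n) * a ≡ (3ℚ + fromℕ n + fromℕ δ) * b
      hyp = trans (pathsℚ-absorption n (suc δ))
          (trans (cong (λ d → (2ℚ + fromℕ n + d) * b) (fromℕ-suc δ)) (lem (fromℕ n) (fromℕ δ) b))
      lem′ : ∀ t a → 2ℚ * t ≡ 2ℚ * t - a + a
      lem′ = solve 2 (λ t a →
          con 2ℚ :* t
          := con 2ℚ :* t :- a :+ a) refl
      twice-T : 2ℚ * T (suc n) δ ≡ t + a
      twice-T = lem′ (T (suc n) δ) a

  ballots-pathsℚ : ∀ n δ → fromℕ (ballots n δ) ≡ pathsℚ n δ - pathsℚ₋ n δ
  ballots-pathsℚ zero    δ = cong fromℕ (ballots-zero δ)
  ballots-pathsℚ (suc n) δ = begin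
    fromℕ (ballots (suc n) δ) ≡⟨ lem _ (pathsℚ n (2 ℕ.+ δ)) ⟩
    fromℕ (ballots (suc n) δ) + pathsℚ n (2 ℕ.+ δ) - pathsℚ n (2 ℕ.+ δ)
      ≡⟨ cong (_- pathsℚ n (2 ℕ.+ δ))
          (trans (sym (fromℕ-+ (ballots (suc n) δ) _)) (cong fromℕ (ballots-suc n δ))) ⟩
    pathsℚ (suc n) δ - pathsℚ n (2 ℕ.+ δ) ∎
    where
    open ≡-Reasoning
    lem : ∀ a b → a ≡ a + b - b
    lem = solve 2 (λ a b →
        a
        := a :+ b :- b) refl

  -- All three solutions are linear in `t` and `k`, hence 0 at `t = k = 0`, and carry the factor
  -- `d + 1`, hence vanish at `d = −1`. The solver needs them as syntax, the statements as
  -- functions.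
  X₁ᵖ Xₑᵖ X₂ᵖ : ∀ {n} → Polynomial n → Polynomial n → Polynomial n → Polynomial n → Polynomial n
  X₁ᵖ ν d t k = con ½ :* (d :+ con 1ℚ) :* ((ν :+ con 1ℚ) :* k :- t)
  Xₑᵖ ν d t k = con ½ :* (d :+ con 1ℚ) :* ((ν :+ d :- con 1ℚ) :* k :+ t)
  X₂ᵖ ν d t k = con ½ :* (d :+ con 1ℚ) :* ((con 2ℚ :* ν :+ d :+ con 10ℚ) :* t
    :+ (con 2ℚ :* ν :* ν :+ con 3ℚ :* ν :* d :- con 2ℚ :* ν :+ d :* d :- con 8ℚ) :* k)

  X₁ Xₑ X₂ : ℚ → ℚ → ℚ → ℚ → ℚ
  X₁ ν d t k = ½ * (d + 1ℚ) * ((ν + 1ℚ) * k - t)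
  Xₑ ν d t k = ½ * (d + 1ℚ) * ((ν + d - 1ℚ) * k + t)
  X₂ ν d t k = ½ * (d + 1ℚ) * ((2ℚ * ν + d + 10ℚ) * t
    + (2ℚ * ν * ν + 3ℚ * ν * d - 2ℚ * ν + d * d - 8ℚ) * k)

  -- The goal `X-step` for the solver; `c` is the cofactor of the absorption relation between `a`
  -- and `b`.
  step-equation : (Polynomial 5 → Polynomial 5 → Polynomial 5 → Polynomial 5 → Polynomial 5) →
    (Polynomial 5 → Polynomial 5 → Polynomial 5 → Polynomial 5 → Polynomial 5 → Polynomial 5) →
    (Polynomial 5 → Polynomial 5 → Polynomial 5) →
    Polynomial 5 → Polynomial 5 → Polynomial 5 → Polynomial 5 → Polynomial 5 → Polynomial 5 × Polynomial 5
  step-equation x s c ν d t a b =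
    x (con 1ℚ :+ ν) (con 1ℚ :+ d) t (a :+ b)
    := s (con 1ℚ :+ ν) (con 1ℚ :+ d) t a b
       :+ (x (con 1ℚ :+ ν) d (con ½ :* (t :+ a)) a :+ x ν (con 2ℚ :+ d) (con ½ :* (t :- a)) b)
       :+ c ν d :* ((con 1ℚ :+ ν) :* a :- (con 3ℚ :+ ν :+ d) :* b)

  -- The lower entry passes the smaller entries of its row, so `∑P #D` is its cost summed over its
  -- ranks. The source is easy because `#D` is constant on the ballot words summed over.
  V-∑P-#D : ∀ n δ → fromℕ (V n δ (∑P #D)) ≡ X₁ (fromℕ n) (fromℕ δ) (T n δ) (pathsℚ n (suc δ))
  V-∑P-#D = lattice-sum _ _ (closed-rec X₁ (λ ν d t a b → ν * (a - b))
      (solve 3 (λ ν t k → X₁ᵖ ν (:- con 1ℚ) t k := con 0ℚ) refl)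
      (solve 2 (λ ν d → X₁ᵖ ν d (con 0ℚ) (con 0ℚ) := con 0ℚ) refl)
      λ ν d t a b h → modulo (- ½) h
        (solve 5 (step-equation X₁ᵖ (λ ν d t a b → ν :* (a :- b)) (λ ν d → :- con ½)) refl ν d t a b))
    (∑P #D) #D refl (λ x r → refl) λ n δ → begin
      fromℕ (V n δ #D)
        ≡⟨ cong fromℕ (trans (V-cong n δ λ r b → trans (#D≡ b) (sym (ℕ.*-identityʳ n))) (V-* n δ n (λ _ → 1))) ⟩
      fromℕ (n ℕ.* ballots n δ) ≡⟨ trans (fromℕ-* n (ballots n δ)) (cong (fromℕ n *_) (ballots-pathsℚ n δ)) ⟩
      fromℕ n * (pathsℚ n δ - pathsℚ₋ n δ) ∎
    where open ≡-Reasoning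

  V-∑P-closeCost : ∀ n δ → fromℕ (V n δ (∑P closeCost)) ≡ Xₑ (fromℕ n) (fromℕ δ) (T n δ) (pathsℚ n (suc δ))
  V-∑P-closeCost = lattice-sum _ _ (closed-rec Xₑ (λ ν d t a b → (ν + d) * (a - b))
      (solve 3 (λ ν t k → Xₑᵖ ν (:- con 1ℚ) t k := con 0ℚ) refl)
      (solve 2 (λ ν d → Xₑᵖ ν d (con 0ℚ) (con 0ℚ) := con 0ℚ) refl)
      λ ν d t a b h → modulo (- ½) h
        (solve 5 (step-equation Xₑᵖ (λ ν d t a b → (ν :+ d) :* (a :- b)) (λ ν d → :- con ½)) refl ν d t a b))
    (∑P closeCost) closeCost refl (λ x r → refl) λ n δ → begin
      fromℕ (V n δ closeCost)
        ≡⟨ cong fromℕ (trans (V-cong n δ λ r b → trans (closeCost-ballot b) (sym (ℕ.*-identityʳ (n ℕ.+ δ))))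
            (V-* n δ (n ℕ.+ δ) (λ _ → 1))) ⟩
      fromℕ ((n ℕ.+ δ) ℕ.* ballots n δ)
          ≡⟨ trans (fromℕ-* (n ℕ.+ δ) (ballots n δ)) (cong₂ _*_ (fromℕ-+ n δ) (ballots-pathsℚ n δ)) ⟩
      (fromℕ n + fromℕ δ) * (pathsℚ n δ - pathsℚ₋ n δ) ∎
    where open ≡-Reasoning

  -- The cost of the upper entry, summed over the ranks of both new entries. The source
  -- `topIncrement` contains a sum of the same kind, whence the previous closed form `Xₑ`.
  V-∑D-∑P-closeCost : ∀ n δ →
      fromℕ (V n δ (∑D (∑P closeCost))) ≡ X₂ (fromℕ n) (fromℕ δ) (T n δ) (pathsℚ n (suc δ))
  V-∑D-∑P-closeCost = lattice-sum _ _
      (closed-rec X₂ (λ ν d t a b → Xₑ ν d t (a + b) + ((ν + d) * d + (1ℚ + ν)) * (a + b))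
      (solve 3 (λ ν t k → X₂ᵖ ν (:- con 1ℚ) t k := con 0ℚ) refl)
      (solve 2 (λ ν d → X₂ᵖ ν d (con 0ℚ) (con 0ℚ) := con 0ℚ) refl)
      λ ν d t a b h → modulo (1ℚ + 3ℚ * ½ * d + ν) h
        (solve 5 (step-equation X₂ᵖ
            (λ ν d t a b → Xₑᵖ ν d t (a :+ b) :+ ((ν :+ d) :* d :+ (con 1ℚ :+ ν)) :* (a :+ b))
          (λ ν d → con 1ℚ :+ con 3ℚ :* con ½ :* d :+ ν)) refl ν d t a b))
    (∑D (∑P closeCost)) topIncrement refl topIncrement-∷ λ n δ → begin
      fromℕ (V n δ topIncrement) ≡⟨ trans (cong fromℕ (V-+ n δ _ _)) (fromℕ-+ (V n δ (∑P closeCost)) _) ⟩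
      fromℕ (V n δ (∑P closeCost)) + fromℕ (V n δ (∑D closeCost))
          ≡⟨ cong₂ _+_ (V-∑P-closeCost n δ) (cong fromℕ (V-∑D-closeCost n δ)) ⟩
      Xₑ (fromℕ n) (fromℕ δ) (T n δ) (pathsℚ n (suc δ))
          + fromℕ (((n ℕ.+ δ) ℕ.* δ ℕ.+ suc n) ℕ.* paths n (suc δ))
        ≡⟨ cong₂ (λ k z → Xₑ (fromℕ n) (fromℕ δ) (T n δ) k + z) (pathsℚ-pascal n δ)
             (trans (fromℕ-* ((n ℕ.+ δ) ℕ.* δ ℕ.+ suc n) _) (cong₂ _*_ (coefficient n δ) (pathsℚ-pascal n δ))) ⟩
      Xₑ (fromℕ n) (fromℕ δ) (T n δ) (pathsℚ n δ + pathsℚ₋ n δ)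
          + ((fromℕ n + fromℕ δ) * fromℕ δ + (1ℚ + fromℕ n)) * (pathsℚ n δ + pathsℚ₋ n δ) ∎
    where
    open ≡-Reasoning
    coefficient : ∀ n δ → fromℕ ((n ℕ.+ δ) ℕ.* δ ℕ.+ suc n) ≡ (fromℕ n + fromℕ δ) * fromℕ δ + (1ℚ + fromℕ n)
    coefficient n δ = trans (fromℕ-+ ((n ℕ.+ δ) ℕ.* δ) (suc n)) (cong₂ _+_
      (trans (fromℕ-* (n ℕ.+ δ) δ) (cong (_* fromℕ δ) (fromℕ-+ n δ))) (fromℕ-suc n))

-- Recursions of `Y` and the telescoping of the closed formula.

module ColumnRecurrence where

  open import Defs using (fromℕ; ∑; H)
  open BallotWords
  open RationalArithmetic
  open BallotCounts
  open CostSums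
  open import Data.Nat as ℕ using (ℕ; zero; suc)
  import Data.Nat.Properties as ℕ
  import Data.Nat.Tactic.RingSolver as ℕS
  open import Data.Integer using (+_)
  open import Data.Rational as ℚ using (ℚ; 0ℚ; 1ℚ; ½; _/_; _+_; _*_; _-_; -_)
  import Data.Rational.Properties as ℚ
  open import Data.Rational.Solver
  open import Relation.Binary.PropositionalEquality
  open +-*-Solver using (solve; con; _:+_; _:*_; _:-_; :-_; _:=_)

  infixl 6 _⊕_
  infixl 7 _⊗_
  -- Syntax of natural number expressions, so that `expand` moves `fromℕ` to the atoms in one step.
  data Expr : Set where
    ⟨_⟩     : ℕ → Expr
    _⊕_ _⊗_ : Expr → Expr → Expr

  ⟦_⟧ℕ : Expr → ℕ
  ⟦ ⟨ n ⟩ ⟧ℕ = n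
  ⟦ e ⊕ f ⟧ℕ = ⟦ e ⟧ℕ ℕ.+ ⟦ f ⟧ℕ
  ⟦ e ⊗ f ⟧ℕ = ⟦ e ⟧ℕ ℕ.* ⟦ f ⟧ℕ

  ⟦_⟧ : Expr → ℚ
  ⟦ ⟨ n ⟩ ⟧ = fromℕ n
  ⟦ e ⊕ f ⟧ = ⟦ e ⟧ + ⟦ f ⟧
  ⟦ e ⊗ f ⟧ = ⟦ e ⟧ * ⟦ f ⟧

  expand : ∀ e → fromℕ ⟦ e ⟧ℕ ≡ ⟦ e ⟧
  expand ⟨ n ⟩   = refl
  expand (e ⊕ f) = trans (fromℕ-+ ⟦ e ⟧ℕ ⟦ f ⟧ℕ) (cong₂ _+_ (expand e) (expand f))
  expand (e ⊗ f) = trans (fromℕ-* ⟦ e ⟧ℕ ⟦ f ⟧ℕ) (cong₂ _*_ (expand e) (expand f))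

  recip : ℕ → ℚ
  recip k = + 1 / suc k

  recip-inverse : ∀ e k → ⟦ e ⟧ℕ ≡ suc k → recip k * ⟦ e ⟧ ≡ 1ℚ
  recip-inverse e k eq = trans (cong (recip k *_) (trans (sym (expand e)) (cong fromℕ eq)))
      (/-cancel (+ 1) (suc k))

  paths-nonZero : ∀ n δ → ℕ.NonZero (paths n δ)
  paths-nonZero zero    δ       = _
  paths-nonZero (suc n) zero    = ℕ.m*n≢0 2 (paths n 1) {{_}} {{paths-nonZero n 1}}
  paths-nonZero (suc n) (suc δ) = ℕ.>-nonZero
      (ℕ.≤-trans (ℕ.>-nonZero⁻¹ _ {{paths-nonZero (suc n) δ}}) (ℕ.m≤m+n _ (paths n (2 ℕ.+ δ))))

  Y : ℕ → ℕ → ℚ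
  Y n δ = (pathsℚ n (suc δ) - 2ℚ * T n δ) * (+ 1 / paths n (suc δ)) {{paths-nonZero n (suc δ)}}

  Y-spec : ∀ n δ → pathsℚ n (suc δ) * Y n δ ≡ pathsℚ n (suc δ) - 2ℚ * T n δ
  Y-spec n δ = lem k (T n δ) _ (/-cancel (+ 1) (paths n (suc δ)) {{paths-nonZero n (suc δ)}})
    where
    k : ℚ
    k = pathsℚ n (suc δ)
    lem : ∀ k t r →
      r * k ≡ 1ℚ →
      k * ((k - 2ℚ * t) * r)
      ≡ k - 2ℚ * t
    lem k t r h₁ =
      modulo (k - 2ℚ * t) h₁ (solve 3 (λ k t r →
          k :* ((k :- con 2ℚ :* t) :* r)
          := k :- con 2ℚ :* t :+ (k :- con 2ℚ :* t) :* (r :* k :- con 1ℚ)) refl k t r)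

  pathsℚ-ratio : ∀ n δ → (fromℕ n + fromℕ δ + 2ℚ) * pathsℚ n (2 ℕ.+ δ) ≡ (2ℚ * fromℕ n + fromℕ δ + 2ℚ) *
      pathsℚ n (suc δ)
  pathsℚ-ratio zero    δ = lem (fromℕ δ)
    where
    lem : ∀ d → (0ℚ + d + 2ℚ) * 1ℚ ≡ (2ℚ * 0ℚ + d + 2ℚ) * 1ℚ
    lem = solve 1 (λ d →
        (con 0ℚ :+ d :+ con 2ℚ) :* con 1ℚ
        := (con 2ℚ :* con 0ℚ :+ d :+ con 2ℚ) :* con 1ℚ) refl
  pathsℚ-ratio (suc m) δ = begin
    (fromℕ (suc m) + d + 2ℚ) * pathsℚ (suc m) (2 ℕ.+ δ)
      ≡⟨ cong₂ (λ ν k → (ν + d + 2ℚ) * k) (fromℕ-suc m) (pathsℚ-pascal (suc m) (suc δ)) ⟩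
    (1ℚ + μ + d + 2ℚ) * (a + b) ≡⟨ lem μ d a b absorption ⟩
    (2ℚ * (1ℚ + μ) + d + 2ℚ) * a ≡⟨ cong (λ ν → (2ℚ * ν + d + 2ℚ) * a) (sym (fromℕ-suc m)) ⟩
    (2ℚ * fromℕ (suc m) + d + 2ℚ) * a ∎
    where
    open ≡-Reasoning
    μ d a b : ℚ
    μ = fromℕ m
    d = fromℕ δ
    a = pathsℚ (suc m) (suc δ)
    b = pathsℚ m (3 ℕ.+ δ)
    absorption : (1ℚ + μ) * a ≡ (2ℚ + μ + (1ℚ + d)) * b
    absorption = subst (λ z → (1ℚ + μ) * a ≡ (2ℚ + μ + z) * b) (fromℕ-suc δ) (pathsℚ-absorption m (suc δ))
    lem : ∀ μ d a b →
      (1ℚ + μ) * a ≡ (2ℚ + μ + (1ℚ + d)) * b →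
      (1ℚ + μ + d + 2ℚ) * (a + b)
      ≡ (2ℚ * (1ℚ + μ) + d + 2ℚ) * a
    lem μ d a b h₁ =
      modulo (- 1ℚ) h₁ (solve 4 (λ μ d a b →
          (con 1ℚ :+ μ :+ d :+ con 2ℚ) :* (a :+ b)
          := (con 2ℚ :* (con 1ℚ :+ μ) :+ d :+ con 2ℚ) :* a
              :+ (:- con 1ℚ) :* ((con 1ℚ :+ μ) :* a :- (con 2ℚ :+ μ :+ (con 1ℚ :+ d)) :* b)) refl μ d a b)

  pathsℚ≢0 : ∀ n δ → pathsℚ n δ ≢ 0ℚ
  pathsℚ≢0 n δ = fromℕ-≢0 (paths n δ) {{paths-nonZero n δ}}

  -- The recursion that defines `T n (suc i)`, divided by the binomial; `pathsℚ-ratio` compares the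
  -- two denominators.
  Y-suc : ∀ n i → (2ℚ * fromℕ n + fromℕ i + 2ℚ) * Y n (suc i)
    ≡ (2ℚ * fromℕ n + fromℕ i + 2ℚ) + 2ℚ * (fromℕ n + fromℕ i + 2ℚ) * Y n i
  Y-suc n i = *-cancelˡ-≢0 (pathsℚ n (2 ℕ.+ i)) (pathsℚ≢0 n (2 ℕ.+ i))
    (lem (fromℕ n) (fromℕ i) (pathsℚ n (2 ℕ.+ i)) (pathsℚ n (suc i)) (T n i) (Y n (suc i)) (Y n i)
        (Y-spec n (suc i)) (pathsℚ-ratio n i) (Y-spec n i))
    where
    lem : ∀ ν d k′ k t y′ y →
      k′ * y′ ≡ (k′ - 2ℚ * (2ℚ * t - k)) →
      (ν + d + 2ℚ) * k′ ≡ (2ℚ * ν + d + 2ℚ) * k →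
      k * y ≡ (k - 2ℚ * t) →
      k′ * ((2ℚ * ν + d + 2ℚ) * y′)
      ≡ k′ * ((2ℚ * ν + d + 2ℚ) + 2ℚ * (ν + d + 2ℚ) * y)
    lem ν d k′ k t y′ y h₁ h₂ h₃ =
      modulo (2ℚ * ν + d + 2ℚ) h₁
          (modulo (- (2ℚ * y)) h₂ (modulo (- (2ℚ * (2ℚ * ν + d + 2ℚ))) h₃ (solve 7 (λ ν d k′ k t y′ y →
          k′ :* ((con 2ℚ :* ν :+ d :+ con 2ℚ) :* y′)
          := k′ :* ((con 2ℚ :* ν :+ d :+ con 2ℚ) :+ con 2ℚ :* (ν :+ d :+ con 2ℚ) :* y)
              :+ (con 2ℚ :* ν :+ d :+ con 2ℚ) :* (k′ :* y′ :- (k′ :- con 2ℚ :* (con 2ℚ :* t :- k)))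
                  :+ (:- (con 2ℚ :* y)) :* ((ν :+ d :+ con 2ℚ) :* k′ :- (con 2ℚ :* ν :+ d :+ con 2ℚ) :* k)
                      :+ (:- (con 2ℚ :* (con 2ℚ :* ν :+ d :+ con 2ℚ))) :* (k :* y :- (k :- con 2ℚ :* t))) refl
                          ν d k′ k t y′ y)))

  Y-0 : ∀ i → Y 0 i ≡ - 1ℚ
  Y-0 i = trans (sym (ℚ.*-identityˡ (Y 0 i))) (trans (Y-spec 0 i) (cong (λ t → 1ℚ - 2ℚ * t) (T-0 i)))

  -- Going up with `T-suc` and back with the definition of `T` gives T (m+1) i = 2 (2 T m i - paths
  -- m (i+1)) + paths (m+1) i, a recursion at fixed `i`.
  Y-column : ∀ m i → let ν = 1ℚ + fromℕ m; d = fromℕ i in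
    (2ℚ * ν + d + 1ℚ) * (2ℚ * ν + d) * Y (suc m) i + (d + 1ℚ) * (2ℚ * ν + d)
    ≡ 4ℚ * ν * (ν + d + 1ℚ) * Y m i
  Y-column m i = *-cancelˡ-≢0 (pathsℚ (suc m) (suc i)) (pathsℚ≢0 (suc m) (suc i))
    (subst (λ k → k * (A * B * Y (suc m) i + (d + 1ℚ) * B) ≡ k * (4ℚ * ν * (ν + d + 1ℚ) * Y m i))
        (sym (pathsℚ-pascal (suc m) i))
    (lem ν d a b κ τ (Y (suc m) i) (Y m i) hY (Y-spec m i) h₁ h₂))
    where
    ν d a b κ τ A B : ℚ
    ν = 1ℚ + fromℕ m
    d = fromℕ i
    a = pathsℚ (suc m) i
    b = pathsℚ m (2 ℕ.+ i)
    κ = pathsℚ m (suc i)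
    τ = T m i
    A = 2ℚ * ν + d + 1ℚ
    B = 2ℚ * ν + d
    t-eq : T (suc m) i ≡ 2ℚ * (2ℚ * τ - κ) + a
    t-eq = trans (l (T (suc m) i) a) (cong (_+ a) (sym (T-suc m i)))
      where
      l : ∀ t a → t ≡ t - a + a
      l = solve 2 (λ t a →
          t
          := t :- a :+ a) refl
    hY : (a + b) * Y (suc m) i ≡ (a + b) - 2ℚ * (2ℚ * (2ℚ * τ - κ) + a)
    hY = subst (λ k → k * Y (suc m) i ≡ k - 2ℚ * (2ℚ * (2ℚ * τ - κ) + a)) (pathsℚ-pascal (suc m) i)
      (trans (Y-spec (suc m) i) (cong (λ t → pathsℚ (suc m) (suc i) - 2ℚ * t) t-eq))
    h₂ : ν * a ≡ (ν + d + 1ℚ) * b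
    h₂ = trans (pathsℚ-absorption m i) (l (fromℕ m) d b)
      where
      l : ∀ μ d b → (2ℚ + μ + d) * b ≡ (1ℚ + μ + d + 1ℚ) * b
      l = solve 3 (λ μ d b →
          (con 2ℚ :+ μ :+ d) :* b
          := (con 1ℚ :+ μ :+ d :+ con 1ℚ) :* b) refl
    h₁ : ν * a ≡ B * κ
    h₁ = trans (pathsℚ-absorption m i) (trans (l (fromℕ m) d b) (trans (pathsℚ-ratio m i) (l′ (fromℕ m) d κ)))
      where
      l : ∀ μ d b → (2ℚ + μ + d) * b ≡ (μ + d + 2ℚ) * b
      l = solve 3 (λ μ d b →
          (con 2ℚ :+ μ :+ d) :* b
          := (μ :+ d :+ con 2ℚ) :* b) refl
      l′ : ∀ μ d κ → (2ℚ * μ + d + 2ℚ) * κ ≡ (2ℚ * (1ℚ + μ) + d) * κ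
      l′ = solve 3 (λ μ d κ →
          (con 2ℚ :* μ :+ d :+ con 2ℚ) :* κ
          := (con 2ℚ :* (con 1ℚ :+ μ) :+ d) :* κ) refl
    lem : ∀ ν d a b κ τ y′ y →
      (a + b) * y′ ≡ ((a + b) - 2ℚ * (2ℚ * (2ℚ * τ - κ) + a)) →
      κ * y ≡ (κ - 2ℚ * τ) →
      ν * a ≡ (2ℚ * ν + d) * κ →
      ν * a ≡ (ν + d + 1ℚ) * b →
      (a + b) * ((2ℚ * ν + d + 1ℚ) * (2ℚ * ν + d) * y′ + (d + 1ℚ) * (2ℚ * ν + d))
      ≡ (a + b) * (4ℚ * ν * (ν + d + 1ℚ) * y)
    lem ν d a b κ τ y′ y h₁ h₂ h₃ h₄ =
      modulo ((2ℚ * ν + d + 1ℚ) * (2ℚ * ν + d)) h₁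
          (modulo (- (4ℚ * (2ℚ * ν + d + 1ℚ) * (2ℚ * ν + d))) h₂
              (modulo (- (4ℚ * y * (2ℚ * ν + d + 1ℚ))) h₃
                  (modulo (4ℚ * y * ν - 2ℚ * (2ℚ * ν + d)) h₄ (solve 8 (λ ν d a b κ τ y′ y →
          (a :+ b) :* ((con 2ℚ :* ν :+ d :+ con 1ℚ) :* (con 2ℚ :* ν :+ d) :* y′
              :+ (d :+ con 1ℚ) :* (con 2ℚ :* ν :+ d))
          := (a :+ b) :* (con 4ℚ :* ν :* (ν :+ d :+ con 1ℚ) :* y)
              :+ ((con 2ℚ :* ν :+ d :+ con 1ℚ) :* (con 2ℚ :* ν :+ d)) :*
                  ((a :+ b) :* y′ :- ((a :+ b) :- con 2ℚ :* (con 2ℚ :* (con 2ℚ :* τ :- κ) :+ a)))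
                      :+ (:- (con 4ℚ :* (con 2ℚ :* ν :+ d :+ con 1ℚ) :* (con 2ℚ :* ν :+ d))) :*
                          (κ :* y :- (κ :- con 2ℚ :* τ))
                              :+ (:- (con 4ℚ :* y :* (con 2ℚ :* ν :+ d :+ con 1ℚ))) :*
                                  (ν :* a :- (con 2ℚ :* ν :+ d) :* κ)
                                      :+ (con 4ℚ :* y :* ν :- con 2ℚ :* (con 2ℚ :* ν :+ d)) :*
                                          (ν :* a :- (ν :+ d :+ con 1ℚ) :* b)) refl ν d a b κ τ y′ y))))

  -- The summands u i (2 λ₂ ∑ v + Y) to which the closed formula reduces for λ₂ = n;
  -- see q-u.
  q : ℕ → ℕ → ℚ
  q zero    i = 0ℚ
  q (suc m) i = 2ℚ * fromℕ (suc m) * Y m i * recip (suc (2 ℕ.* m ℕ.+ i)) * recip (2 ℕ.+ (2 ℕ.* m ℕ.+ i))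

  -- For `n > 0` this is `Y-column` divided by `(2ν + d + 1)(2ν + d)`; for `n = 0` both sides are 0.
  -- It exchanges a single `q` for a `Y` with the same indices.
  q-Y : ∀ n i → 2ℚ * (fromℕ n + fromℕ i + 1ℚ) * q n i ≡ Y n i + (fromℕ i + 1ℚ) * recip (2 ℕ.* n ℕ.+ i)
  q-Y zero i = sym (begin
    Y 0 i + (d + 1ℚ) * recip i ≡⟨ cong (_+ (d + 1ℚ) * recip i) (Y-0 i) ⟩
    - 1ℚ + (d + 1ℚ) * recip i ≡⟨ lem d (recip i) (recip-inverse (⟨ 1 ⟩ ⊕ ⟨ i ⟩) i refl) ⟩
    2ℚ * (0ℚ + d + 1ℚ) * 0ℚ ∎)
    where
    open ≡-Reasoning
    d : ℚ
    d = fromℕ i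
    lem : ∀ d r →
      r * (1ℚ + d) ≡ 1ℚ →
      - 1ℚ + (d + 1ℚ) * r
      ≡ 2ℚ * (0ℚ + d + 1ℚ) * 0ℚ
    lem d r h₁ =
      modulo 1ℚ h₁ (solve 2 (λ d r →
          :- con 1ℚ :+ (d :+ con 1ℚ) :* r
          := con 2ℚ :* (con 0ℚ :+ d :+ con 1ℚ) :* con 0ℚ :+ con 1ℚ :* (r :* (con 1ℚ :+ d) :- con 1ℚ)) refl d r)
  q-Y (suc m) i = begin
    2ℚ * (fromℕ (suc m) + d + 1ℚ) * (2ℚ * fromℕ (suc m) * y * r₁ * r₂)
      ≡⟨ cong (λ ν → 2ℚ * (ν + d + 1ℚ) * (2ℚ * ν * y * r₁ * r₂)) (fromℕ-suc m) ⟩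
    2ℚ * (ν + d + 1ℚ) * (2ℚ * ν * y * r₁ * r₂)
      ≡⟨ lem₁ ν d y y′ r₁ r₂ (Y-column m i) h₂ h₁ ⟩
    y′ + (d + 1ℚ) * r₂ ≡⟨ cong (λ z → y′ + (d + 1ℚ) * z) same ⟩
    y′ + (d + 1ℚ) * recip (2 ℕ.* suc m ℕ.+ i) ∎
    where
    open ≡-Reasoning
    ν d y y′ r₁ r₂ : ℚ
    ν = 1ℚ + fromℕ m
    d = fromℕ i
    y = Y m i
    y′ = Y (suc m) i
    r₁ = recip (suc (2 ℕ.* m ℕ.+ i))
    r₂ = recip (2 ℕ.+ (2 ℕ.* m ℕ.+ i))
    e₁ : ∀ m i → 2 ℕ.* (1 ℕ.+ m) ℕ.+ i ≡ suc (suc (2 ℕ.* m ℕ.+ i))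
    e₁ = ℕS.solve-∀
    e₂ : ∀ m i → 2 ℕ.* (1 ℕ.+ m) ℕ.+ i ℕ.+ 1 ≡ suc (2 ℕ.+ (2 ℕ.* m ℕ.+ i))
    e₂ = ℕS.solve-∀
    same : r₂ ≡ recip (2 ℕ.* suc m ℕ.+ i)
    same = cong recip (sym (e₁ m i))
    h₁ : r₁ * (2ℚ * ν + d) ≡ 1ℚ
    h₁ = recip-inverse (⟨ 2 ⟩ ⊗ (⟨ 1 ⟩ ⊕ ⟨ m ⟩) ⊕ ⟨ i ⟩) _ (e₁ m i)
    h₂ : r₂ * (2ℚ * ν + d + 1ℚ) ≡ 1ℚ
    h₂ = recip-inverse (⟨ 2 ⟩ ⊗ (⟨ 1 ⟩ ⊕ ⟨ m ⟩) ⊕ ⟨ i ⟩ ⊕ ⟨ 1 ⟩) _ (e₂ m i)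
    lem₁ : ∀ ν d y y′ r₁ r₂ →
      (2ℚ * ν + d + 1ℚ) * (2ℚ * ν + d) * y′ + (d + 1ℚ) * (2ℚ * ν + d) ≡ 4ℚ * ν * (ν + d + 1ℚ) * y →
      r₂ * (2ℚ * ν + d + 1ℚ) ≡ 1ℚ →
      r₁ * (2ℚ * ν + d) ≡ 1ℚ →
      2ℚ * (ν + d + 1ℚ) * (2ℚ * ν * y * r₁ * r₂)
      ≡ y′ + (d + 1ℚ) * r₂
    lem₁ ν d y y′ r₁ r₂ h₁ h₂ h₃ =
      modulo (- (r₁ * r₂)) h₁ (modulo (y′ * r₁ * (2ℚ * ν + d)) h₂
          (modulo (y′ + (d + 1ℚ) * r₂) h₃ (solve 6 (λ ν d y y′ r₁ r₂ →
          con 2ℚ :* (ν :+ d :+ con 1ℚ) :* (con 2ℚ :* ν :* y :* r₁ :* r₂)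
          := y′ :+ (d :+ con 1ℚ) :* r₂
              :+ (:- (r₁ :* r₂)) :* ((con 2ℚ :* ν :+ d :+ con 1ℚ) :* (con 2ℚ :* ν :+ d) :* y′
                  :+ (d :+ con 1ℚ) :* (con 2ℚ :* ν :+ d) :- con 4ℚ :* ν :* (ν :+ d :+ con 1ℚ) :* y)
                      :+ (y′ :* r₁ :* (con 2ℚ :* ν :+ d)) :* (r₂ :* (con 2ℚ :* ν :+ d :+ con 1ℚ) :- con 1ℚ)
                          :+ (y′ :+ (d :+ con 1ℚ) :* r₂) :* (r₁ :* (con 2ℚ :* ν :+ d) :- con 1ℚ)) refl ν d y
                              y′ r₁ r₂)))

  qs : ℕ → ℕ → ℚ
  qs n δ = q n 0 + ∑ δ (q n)

  -- The induction step of `qs-difference`, with `Y₋` in the role of `Y n (δ - 1)`. As `Y₋` only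
  -- occurs multiplied by `d`, the case `δ = 0` is included, where any value will do.
  qs-step : ∀ n δ Y₋ e → let ν = fromℕ n; d = fromℕ δ; a = recip (2 ℕ.* n ℕ.+ δ); b = recip (1 ℕ.+ (2 ℕ.* n ℕ.+ δ)); c = recip (2 ℕ.+ (2 ℕ.* n ℕ.+ δ)) in
    d * ((2ℚ * ν + d + 1ℚ) * Y n δ) ≡ d * ((2ℚ * ν + d + 1ℚ) + 2ℚ * (ν + d + 1ℚ) * Y₋) →
    - (d * Y₋ * a * b) + a - e + (q (suc n) δ - q n δ) ≡ - ((d + 1ℚ) * Y n δ * b * c) + b - e
  -- The factor is the one in `q-Y`, which eliminates `q n δ`.
  qs-step n δ Y₋ e hY = *-cancelˡ-≢0 (2ℚ * N) N≢0
      (subst (λ ν′ → 2ℚ * N * (- (d * Y₋ * a * b) + a - e + (2ℚ * ν′ * y * b * c - q n δ)) ≡ 2ℚ * N *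
          (- ((d + 1ℚ) * y * b * c) + b - e)) (sym (fromℕ-suc n))
    (lem ν d y Y₋ (q n δ) a b c e hY (q-Y n δ) ha hb hc))
    where
    ν d a b c y N : ℚ
    ν = fromℕ n
    d = fromℕ δ
    a = recip (2 ℕ.* n ℕ.+ δ)
    b = recip (1 ℕ.+ (2 ℕ.* n ℕ.+ δ))
    c = recip (2 ℕ.+ (2 ℕ.* n ℕ.+ δ))
    y = Y n δ
    N = ν + d + 1ℚ
    N≢0 : 2ℚ * N ≢ 0ℚ
    N≢0 eq = fromℕ-≢0 (2 ℕ.* (n ℕ.+ δ ℕ.+ 1))
        {{ℕ.m*n≢0 2 (n ℕ.+ δ ℕ.+ 1) {{_}} {{ℕ.≢-nonZero λ z → ℕ.1+n≢0 (trans (ℕ.+-comm 1 (n ℕ.+ δ)) z)}}}}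
      (trans (expand (⟨ 2 ⟩ ⊗ (⟨ n ⟩ ⊕ ⟨ δ ⟩ ⊕ ⟨ 1 ⟩))) eq)
    e₁ : ∀ k j → k ℕ.+ j ℕ.+ 1 ≡ suc (k ℕ.+ j)
    e₁ = ℕS.solve-∀
    e₂ : ∀ k j → k ℕ.+ j ℕ.+ 2 ≡ suc (1 ℕ.+ (k ℕ.+ j))
    e₂ = ℕS.solve-∀
    e₃ : ∀ k j → k ℕ.+ j ℕ.+ 3 ≡ suc (2 ℕ.+ (k ℕ.+ j))
    e₃ = ℕS.solve-∀
    ha : a * (2ℚ * ν + d + 1ℚ) ≡ 1ℚ
    ha = recip-inverse (⟨ 2 ⟩ ⊗ ⟨ n ⟩ ⊕ ⟨ δ ⟩ ⊕ ⟨ 1 ⟩) _ (e₁ (2 ℕ.* n) δ)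
    hb : b * (2ℚ * ν + d + 2ℚ) ≡ 1ℚ
    hb = recip-inverse (⟨ 2 ⟩ ⊗ ⟨ n ⟩ ⊕ ⟨ δ ⟩ ⊕ ⟨ 2 ⟩) _ (e₂ (2 ℕ.* n) δ)
    hc : c * (2ℚ * ν + d + 3ℚ) ≡ 1ℚ
    hc = recip-inverse (⟨ 2 ⟩ ⊗ ⟨ n ⟩ ⊕ ⟨ δ ⟩ ⊕ ⟨ 3 ⟩) _ (e₃ (2 ℕ.* n) δ)
    lem : ∀ ν d y y₋ q a b c e →
      d * ((2ℚ * ν + d + 1ℚ) * y) ≡ d * ((2ℚ * ν + d + 1ℚ) + 2ℚ * (ν + d + 1ℚ) * y₋) →
      2ℚ * (ν + d + 1ℚ) * q ≡ (y + (d + 1ℚ) * a) →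
      a * (2ℚ * ν + d + 1ℚ) ≡ 1ℚ →
      b * (2ℚ * ν + d + 2ℚ) ≡ 1ℚ →
      c * (2ℚ * ν + d + 3ℚ) ≡ 1ℚ →
      2ℚ * (ν + d + 1ℚ) * (- (d * y₋ * a * b) + a - e + (2ℚ * (1ℚ + ν) * y * b * c - q))
      ≡ 2ℚ * (ν + d + 1ℚ) * (- ((d + 1ℚ) * y * b * c) + b - e)
    lem ν d y y₋ q a b c e h₁ h₂ h₃ h₄ h₅ =
      modulo (a * b) h₁ (modulo (- 1ℚ) h₂
          (modulo (1ℚ - d * b * (y - 1ℚ)) h₃
              (modulo (y - 1ℚ) h₄ (modulo (2ℚ * (ν + d + 1ℚ) * y * b) h₅ (solve 9 (λ ν d y y₋ q a b c e →
          con 2ℚ :* (ν :+ d :+ con 1ℚ) :*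
              (:- (d :* y₋ :* a :* b) :+ a :- e :+ (con 2ℚ :* (con 1ℚ :+ ν) :* y :* b :* c :- q))
          := con 2ℚ :* (ν :+ d :+ con 1ℚ) :* (:- ((d :+ con 1ℚ) :* y :* b :* c) :+ b :- e)
              :+ (a :* b) :* (d :* ((con 2ℚ :* ν :+ d :+ con 1ℚ) :* y) :- d :*
                  ((con 2ℚ :* ν :+ d :+ con 1ℚ) :+ con 2ℚ :* (ν :+ d :+ con 1ℚ) :* y₋))
                      :+ (:- con 1ℚ) :* (con 2ℚ :* (ν :+ d :+ con 1ℚ) :* q :- (y :+ (d :+ con 1ℚ) :* a))
                          :+ (con 1ℚ :- d :* b :* (y :- con 1ℚ)) :*
                              (a :* (con 2ℚ :* ν :+ d :+ con 1ℚ) :- con 1ℚ)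
                                  :+ (y :- con 1ℚ) :* (b :* (con 2ℚ :* ν :+ d :+ con 2ℚ) :- con 1ℚ)
                                      :+ (con 2ℚ :* (ν :+ d :+ con 1ℚ) :* y :* b) :*
                                          (c :* (con 2ℚ :* ν :+ d :+ con 3ℚ) :- con 1ℚ)) refl ν d y y₋ q a b c
                                              e)))))

  -- A sum of length `δ`, yet its difference in `n` is closed: by `q-Y` and `Y-suc` the summands
  -- `q (suc n) i - q n i` are themselves differences in `i`.
  qs-difference : ∀ n δ → qs (suc n) δ - qs n δ ≡
    - ((fromℕ δ + 1ℚ) * Y n δ * recip (1 ℕ.+ (2 ℕ.* n ℕ.+ δ)) * recip (2 ℕ.+ (2 ℕ.* n ℕ.+ δ)))
    + recip (1 ℕ.+ (2 ℕ.* n ℕ.+ δ)) - recip (2 ℕ.* n)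
  qs-difference n zero = begin
    -- The telescoping starts from 0, written as `a - a`; this initial `a` is the `recip (2 * n)`
    -- that survives in the result.
    (q (suc n) 0 + 0ℚ) - (q n 0 + 0ℚ) ≡⟨ lem (q (suc n) 0) (q n 0) 0ℚ a b ⟩
    - (0ℚ * 0ℚ * a * b) + a - a + (q (suc n) 0 - q n 0)
      ≡⟨ qs-step n 0 0ℚ a (trans (ℚ.*-zeroˡ ((2ℚ * fromℕ n + 0ℚ + 1ℚ) * Y n 0))
          (sym (ℚ.*-zeroˡ ((2ℚ * fromℕ n + 0ℚ + 1ℚ) + 2ℚ * (fromℕ n + 0ℚ + 1ℚ) * 0ℚ)))) ⟩
    - ((0ℚ + 1ℚ) * Y n 0 * b * c) + b - a
        ≡⟨ cong (λ k → - ((0ℚ + 1ℚ) * Y n 0 * b * c) + b - recip k) (ℕ.+-identityʳ (2 ℕ.* n)) ⟩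
    - ((0ℚ + 1ℚ) * Y n 0 * b * c) + b - recip (2 ℕ.* n) ∎
    where
    open ≡-Reasoning
    a b c : ℚ
    a = recip (2 ℕ.* n ℕ.+ 0)
    b = recip (1 ℕ.+ (2 ℕ.* n ℕ.+ 0))
    c = recip (2 ℕ.+ (2 ℕ.* n ℕ.+ 0))
    lem : ∀ x y z a b → (x + 0ℚ) - (y + 0ℚ) ≡ - (0ℚ * z * a * b) + a - a + (x - y)
    lem = solve 5 (λ x y z a b →
        (x :+ con 0ℚ) :- (y :+ con 0ℚ)
        := :- (con 0ℚ :* z :* a :* b) :+ a :- a :+ (x :- y)) refl
  qs-difference n (suc δ) = begin
    (q (suc n) 0 + (∑ δ (q (suc n)) + q (suc n) (suc δ))) - (q n 0 + (∑ δ (q n) + q n (suc δ)))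
      ≡⟨ lem₀ (q (suc n) 0) (∑ δ (q (suc n))) (q (suc n) (suc δ)) (q n 0) (∑ δ (q n)) (q n (suc δ)) ⟩
    (qs (suc n) δ - qs n δ) + (q (suc n) (suc δ) - q n (suc δ))
      ≡⟨ cong (_+ (q (suc n) (suc δ) - q n (suc δ))) (trans (qs-difference n δ) reindex) ⟩
    - (fromℕ (suc δ) * Y n δ * a * b) + a - e + (q (suc n) (suc δ) - q n (suc δ))
        ≡⟨ qs-step n (suc δ) (Y n δ) e hY ⟩
    - ((fromℕ (suc δ) + 1ℚ) * Y n (suc δ) * b * c) + b - e ∎
    where
    open ≡-Reasoning
    a b c e : ℚ
    a = recip (2 ℕ.* n ℕ.+ suc δ)
    b = recip (1 ℕ.+ (2 ℕ.* n ℕ.+ suc δ))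
    c = recip (2 ℕ.+ (2 ℕ.* n ℕ.+ suc δ))
    e = recip (2 ℕ.* n)
    lem₀ : ∀ x s x′ y t y′ → (x + (s + x′)) - (y + (t + y′)) ≡ ((x + s) - (y + t)) + (x′ - y′)
    lem₀ = solve 6 (λ x s x′ y t y′ →
        (x :+ (s :+ x′)) :- (y :+ (t :+ y′))
        := ((x :+ s) :- (y :+ t)) :+ (x′ :- y′)) refl
    reindex : - ((fromℕ δ + 1ℚ) * Y n δ * recip (1 ℕ.+ (2 ℕ.* n ℕ.+ δ)) * recip (2 ℕ.+ (2 ℕ.* n ℕ.+ δ)))
        + recip (1 ℕ.+ (2 ℕ.* n ℕ.+ δ)) - e
      ≡ - (fromℕ (suc δ) * Y n δ * a * b) + a - e
    reindex = cong₂ (λ d k → - (d * Y n δ * recip k * recip (1 ℕ.+ k)) + recip k - e)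
      (trans (ℚ.+-comm (fromℕ δ) 1ℚ) (sym (fromℕ-suc δ))) (sym (ℕ.+-suc (2 ℕ.* n) δ))
    hY : fromℕ (suc δ) * ((2ℚ * fromℕ n + fromℕ (suc δ) + 1ℚ) * Y n (suc δ))
       ≡ fromℕ (suc δ) * ((2ℚ * fromℕ n + fromℕ (suc δ) + 1ℚ) + 2ℚ * (fromℕ n + fromℕ (suc δ) + 1ℚ) * Y n δ)
    hY = subst (λ d → d * ((2ℚ * fromℕ n + d + 1ℚ) * Y n (suc δ)) ≡ d *
        ((2ℚ * fromℕ n + d + 1ℚ) + 2ℚ * (fromℕ n + d + 1ℚ) * Y n δ))
      (sym (fromℕ-suc δ))
      (lem (fromℕ n) (fromℕ δ) (Y n (suc δ)) (Y n δ) (Y-suc n δ))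
      where
      lem : ∀ ν d y′ y →
        (2ℚ * ν + d + 2ℚ) * y′ ≡ ((2ℚ * ν + d + 2ℚ) + 2ℚ * (ν + d + 2ℚ) * y) →
        (1ℚ + d) * ((2ℚ * ν + (1ℚ + d) + 1ℚ) * y′)
        ≡ (1ℚ + d) * ((2ℚ * ν + (1ℚ + d) + 1ℚ) + 2ℚ * (ν + (1ℚ + d) + 1ℚ) * y)
      lem ν d y′ y h₁ =
        modulo (1ℚ + d) h₁ (solve 4 (λ ν d y′ y →
            (con 1ℚ :+ d) :* ((con 2ℚ :* ν :+ (con 1ℚ :+ d) :+ con 1ℚ) :* y′)
            := (con 1ℚ :+ d) :* ((con 2ℚ :* ν :+ (con 1ℚ :+ d) :+ con 1ℚ)
                :+ con 2ℚ :* (ν :+ (con 1ℚ :+ d) :+ con 1ℚ) :* y)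
                    :+ (con 1ℚ :+ d) :* ((con 2ℚ :* ν :+ d :+ con 2ℚ) :* y′ :-
                        ((con 2ℚ :* ν :+ d :+ con 2ℚ) :+ con 2ℚ :* (ν :+ d :+ con 2ℚ) :* y))) refl ν d y′ y)

  Hs : ℕ → ℕ → ℚ
  Hs n δ = H (δ ℕ.+ 2 ℕ.* n) + ½ * H n - H (2 ℕ.* n) - H δ

  -- The increment of `½ * H n` cancels the even one of the two new terms of `H (2 * n)`. The odd
  -- one is left, the same as in `qs-difference`.
  Hs-difference : ∀ n δ → Hs (suc n) δ - Hs n δ ≡
    recip (2 ℕ.* n ℕ.+ δ) + recip (1 ℕ.+ (2 ℕ.* n ℕ.+ δ)) - recip (2 ℕ.* n)
  Hs-difference n δ = begin
    H (δ ℕ.+ 2 ℕ.* suc n) + ½ * (h₁ + r) - H (2 ℕ.* suc n) - h₃ - (h₀ + ½ * h₁ - h₂ - h₃)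
      ≡⟨ cong₂ (λ x y → H x + ½ * (h₁ + r) - H y - h₃ - (h₀ + ½ * h₁ - h₂ - h₃)) (e₁ n δ) (e₂ n) ⟩
    (h₀ + recip (δ ℕ.+ 2 ℕ.* n) + recip (1 ℕ.+ (δ ℕ.+ 2 ℕ.* n)))
        + ½ * (h₁ + r) - (h₂ + recip (2 ℕ.* n) + s) - h₃ - (h₀ + ½ * h₁ - h₂ - h₃)
      ≡⟨ cong₂ (λ k z → (h₀ + recip k + recip (1 ℕ.+ k))
          + ½ * (h₁ + r) - (h₂ + recip (2 ℕ.* n) + z) - h₃ - (h₀ + ½ * h₁ - h₂ - h₃)) (ℕ.+-comm δ (2 ℕ.* n))
              half ⟩
    (h₀ + a + b) + ½ * (h₁ + r) - (h₂ + recip (2 ℕ.* n) + ½ * r) - h₃ - (h₀ + ½ * h₁ - h₂ - h₃)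
      ≡⟨ lem h₀ h₁ h₂ h₃ a b (recip (2 ℕ.* n)) r ⟩
    a + b - recip (2 ℕ.* n) ∎
    where
    open ≡-Reasoning
    h₀ h₁ h₂ h₃ a b r s : ℚ
    h₀ = H (δ ℕ.+ 2 ℕ.* n)
    h₁ = H n
    h₂ = H (2 ℕ.* n)
    h₃ = H δ
    a = recip (2 ℕ.* n ℕ.+ δ)
    b = recip (1 ℕ.+ (2 ℕ.* n ℕ.+ δ))
    r = recip n
    s = recip (1 ℕ.+ 2 ℕ.* n)
    e₁ : ∀ n δ → δ ℕ.+ 2 ℕ.* (1 ℕ.+ n) ≡ 2 ℕ.+ (δ ℕ.+ 2 ℕ.* n)
    e₁ = ℕS.solve-∀
    e₂ : ∀ n → 2 ℕ.* (1 ℕ.+ n) ≡ 2 ℕ.+ 2 ℕ.* n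
    e₂ = ℕS.solve-∀
    half : s ≡ ½ * r
    half = l (fromℕ n) s r (recip-inverse (⟨ 1 ⟩ ⊕ ⟨ n ⟩) n refl)
        (recip-inverse (⟨ 2 ⟩ ⊗ (⟨ 1 ⟩ ⊕ ⟨ n ⟩)) _ (e₂ n))
      where
      l : ∀ ν s r →
        r * (1ℚ + ν) ≡ 1ℚ →
        s * (2ℚ * (1ℚ + ν)) ≡ 1ℚ →
        s
        ≡ ½ * r
      l ν s r h₁ h₂ =
        modulo (- s) h₁ (modulo (½ * r) h₂ (solve 3 (λ ν s r →
            s
            := con ½ :* r :+ (:- s) :* (r :* (con 1ℚ :+ ν) :- con 1ℚ)
                :+ (con ½ :* r) :* (s :* (con 2ℚ :* (con 1ℚ :+ ν)) :- con 1ℚ)) refl ν s r))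
    lem : ∀ h₀ h₁ h₂ h₃ a b e r → (h₀ + a + b)
        + ½ * (h₁ + r) - (h₂ + e + ½ * r) - h₃ - (h₀ + ½ * h₁ - h₂ - h₃) ≡ a + b - e
    lem = solve 8 (λ h₀ h₁ h₂ h₃ a b e r →
        (h₀ :+ a :+ b) :+ con ½ :* (h₁ :+ r) :- (h₂ :+ e :+ con ½ :* r) :- h₃ :- (h₀ :+ con ½ :* h₁ :- h₂ :- h₃)
        := a :+ b :- e) refl

  -- The large bracket of the closed formula, with its sums expressed by `q`.
  B : ℕ → ℕ → ℚ
  B n δ = 2ℚ * (fromℕ n + fromℕ δ + 1ℚ) * q n δ - (fromℕ δ + 1ℚ) * qs n δ + (fromℕ δ + 1ℚ) * Hs n δ

  B-zero : ∀ δ → B 0 δ ≡ 0ℚ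
  B-zero δ = trans (cong₂ (λ s h → 2ℚ * (0ℚ + fromℕ δ + 1ℚ) * 0ℚ - (fromℕ δ + 1ℚ) * (0ℚ + s)
      + (fromℕ δ + 1ℚ) * (H h + ½ * 0ℚ - 0ℚ - H δ)) (∑0 δ) (ℕ.+-identityʳ δ))
    (lem (fromℕ δ) (H δ))
    where
    ∑0 : ∀ δ → ∑ δ (q 0) ≡ 0ℚ
    ∑0 zero    = refl
    ∑0 (suc δ) = cong (_+ 0ℚ) (∑0 δ)
    lem : ∀ d h → 2ℚ * (0ℚ + d + 1ℚ) * 0ℚ - (d + 1ℚ) * (0ℚ + 0ℚ) + (d + 1ℚ) * (h + ½ * 0ℚ - 0ℚ - h) ≡ 0ℚ
    lem = solve 2 (λ d h →
        con 2ℚ :* (con 0ℚ :+ d :+ con 1ℚ) :* con 0ℚ :- (d :+ con 1ℚ) :* (con 0ℚ :+ con 0ℚ)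
            :+ (d :+ con 1ℚ) :* (h :+ con ½ :* con 0ℚ :- con 0ℚ :- h)
        := con 0ℚ) refl

  -- In the differences of `qs` and `Hs` the terms `b` and `e` cancel, and `a` is absorbed by `q-Y`.
  -- The multiples of `y` collapse because 4 (ν+1)(ν+d+2) + (d+1)² = (2ν+d+3)².
  B-suc : ∀ n δ → B (suc n) δ ≡ B n δ + Y n δ * recip (1 ℕ.+ (2 ℕ.* n ℕ.+ δ))
  B-suc n δ = subst (λ ν′ → 2ℚ * (ν′ + d + 1ℚ) * (2ℚ * ν′ * y * b * c) - (d + 1ℚ) * qs (suc n) δ
      + (d + 1ℚ) * Hs (suc n) δ ≡ B n δ + y * b) (sym (fromℕ-suc n))
    (lem ν d y (q n δ) (qs (suc n) δ) (qs n δ) (Hs (suc n) δ) (Hs n δ) a b c e (qs-difference n δ)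
        (Hs-difference n δ) (q-Y n δ) hb hc)
    where
    ν d a b c e y : ℚ
    ν = fromℕ n
    d = fromℕ δ
    a = recip (2 ℕ.* n ℕ.+ δ)
    b = recip (1 ℕ.+ (2 ℕ.* n ℕ.+ δ))
    c = recip (2 ℕ.+ (2 ℕ.* n ℕ.+ δ))
    e = recip (2 ℕ.* n)
    y = Y n δ
    e₂ : ∀ k j → k ℕ.+ j ℕ.+ 2 ≡ suc (1 ℕ.+ (k ℕ.+ j))
    e₂ = ℕS.solve-∀
    e₃ : ∀ k j → k ℕ.+ j ℕ.+ 3 ≡ suc (2 ℕ.+ (k ℕ.+ j))
    e₃ = ℕS.solve-∀
    hb : b * (2ℚ * ν + d + 2ℚ) ≡ 1ℚ
    hb = recip-inverse (⟨ 2 ⟩ ⊗ ⟨ n ⟩ ⊕ ⟨ δ ⟩ ⊕ ⟨ 2 ⟩) _ (e₂ (2 ℕ.* n) δ)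
    hc : c * (2ℚ * ν + d + 3ℚ) ≡ 1ℚ
    hc = recip-inverse (⟨ 2 ⟩ ⊗ ⟨ n ⟩ ⊕ ⟨ δ ⟩ ⊕ ⟨ 3 ⟩) _ (e₃ (2 ℕ.* n) δ)
    lem : ∀ ν d y q s′ s h′ h a b c e →
      s′ - s ≡ (- ((d + 1ℚ) * y * b * c) + b - e) →
      h′ - h ≡ (a + b - e) →
      2ℚ * (ν + d + 1ℚ) * q ≡ (y + (d + 1ℚ) * a) →
      b * (2ℚ * ν + d + 2ℚ) ≡ 1ℚ →
      c * (2ℚ * ν + d + 3ℚ) ≡ 1ℚ →
      2ℚ * ((1ℚ + ν) + d + 1ℚ) * (2ℚ * (1ℚ + ν) * y * b * c) - (d + 1ℚ) * s′ + (d + 1ℚ) * h′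
      ≡ 2ℚ * (ν + d + 1ℚ) * q - (d + 1ℚ) * s + (d + 1ℚ) * h + y * b
    lem ν d y q s′ s h′ h a b c e h₁ h₂ h₃ h₄ h₅ =
      modulo (- (d + 1ℚ)) h₁ (modulo (d + 1ℚ) h₂
          (modulo (- 1ℚ) h₃ (modulo y h₄
              (modulo (y * b * (2ℚ * ν + d + 3ℚ)) h₅ (solve 12 (λ ν d y q s′ s h′ h a b c e →
          con 2ℚ :* ((con 1ℚ :+ ν) :+ d :+ con 1ℚ) :* (con 2ℚ :* (con 1ℚ :+ ν) :* y :* b :* c) :-
              (d :+ con 1ℚ) :* s′ :+ (d :+ con 1ℚ) :* h′
          := con 2ℚ :* (ν :+ d :+ con 1ℚ) :* q :- (d :+ con 1ℚ) :* s :+ (d :+ con 1ℚ) :* h :+ y :* b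
              :+ (:- (d :+ con 1ℚ)) :* (s′ :- s :- (:- ((d :+ con 1ℚ) :* y :* b :* c) :+ b :- e))
                  :+ (d :+ con 1ℚ) :* (h′ :- h :- (a :+ b :- e))
                      :+ (:- con 1ℚ) :* (con 2ℚ :* (ν :+ d :+ con 1ℚ) :* q :- (y :+ (d :+ con 1ℚ) :* a))
                          :+ y :* (b :* (con 2ℚ :* ν :+ d :+ con 2ℚ) :- con 1ℚ)
                              :+ (y :* b :* (con 2ℚ :* ν :+ d :+ con 3ℚ)) :*
                                  (c :* (con 2ℚ :* ν :+ d :+ con 3ℚ) :- con 1ℚ)) refl ν d y q s′ s h′ h a b c
                                      e)))))

  averageCost : ℕ → ℕ → ℚ
  averageCost n δ = let λ₁ = fromℕ n + fromℕ δ in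
    ¼ * (λ₁ * (λ₁ - 1ℚ)) + ¼ * (fromℕ n * (fromℕ n - 3ℚ)) - 2ℚ * B n δ

  -- The mean number of inversions of a permutation of `δ` elements, as it must be for a single row.
  averageCost-zero : ∀ δ → averageCost 0 δ ≡ ¼ * (fromℕ δ * (fromℕ δ - 1ℚ))
  averageCost-zero δ = trans
      (cong (λ b → ¼ * ((0ℚ + fromℕ δ) * ((0ℚ + fromℕ δ) - 1ℚ)) + ¼ * (0ℚ * (0ℚ - 3ℚ)) - 2ℚ * b) (B-zero δ))
          (lem (fromℕ δ))
    where
    lem : ∀ d → ¼ * ((0ℚ + d) * ((0ℚ + d) - 1ℚ)) + ¼ * (0ℚ * (0ℚ - 3ℚ)) - 2ℚ * 0ℚ ≡ ¼ * (d * (d - 1ℚ))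
    lem = solve 1 (λ d →
        con ¼ :* ((con 0ℚ :+ d) :* ((con 0ℚ :+ d) :- con 1ℚ))
            :+ con ¼ :* (con 0ℚ :* (con 0ℚ :- con 3ℚ)) :- con 2ℚ :* con 0ℚ
        := con ¼ :* (d :* (d :- con 1ℚ))) refl

  -- The factor is the number of ballot words times the numbers `2n + δ + 1` and `2n + δ + 2` of
  -- ranks of the two new entries, by `ballots-paths`. The cost `X₁` of the lower entry occurs once
  -- for each rank of the upper one.
  averageCost-suc : ∀ n δ → let ν = fromℕ n; d = fromℕ δ; k = pathsℚ n (suc δ) in
    (d + 1ℚ) * k * (2ℚ * ν + d + 2ℚ) * averageCost (suc n) δ
    ≡ (d + 1ℚ) * k * (2ℚ * ν + d + 2ℚ) * averageCost n δ
      + ((2ℚ * ν + d + 2ℚ) * X₁ ν d (T n δ) k + X₂ ν d (T n δ) k)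
  averageCost-suc n δ = subst₂
      (λ ν′ b′ → C * (¼ * ((ν′ + d) * ((ν′ + d) - 1ℚ)) + ¼ * (ν′ * (ν′ - 3ℚ)) - 2ℚ * b′) ≡ C * averageCost n δ
          + (M * X₁ ν d t k + X₂ ν d t k))
    (sym (fromℕ-suc n)) (sym (B-suc n δ))
    (lem ν d y k t (B n δ) b hb (Y-spec n δ))
    where
    ν d y k t b M C : ℚ
    ν = fromℕ n
    d = fromℕ δ
    y = Y n δ
    k = pathsℚ n (suc δ)
    t = T n δ
    b = recip (1 ℕ.+ (2 ℕ.* n ℕ.+ δ))
    M = 2ℚ * ν + d + 2ℚ
    C = (d + 1ℚ) * k * M
    e₂ : ∀ k j → k ℕ.+ j ℕ.+ 2 ≡ suc (1 ℕ.+ (k ℕ.+ j))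
    e₂ = ℕS.solve-∀
    hb : b * (2ℚ * ν + d + 2ℚ) ≡ 1ℚ
    hb = recip-inverse (⟨ 2 ⟩ ⊗ ⟨ n ⟩ ⊕ ⟨ δ ⟩ ⊕ ⟨ 2 ⟩) _ (e₂ (2 ℕ.* n) δ)
    lem : ∀ ν d y k t B b →
      b * (2ℚ * ν + d + 2ℚ) ≡ 1ℚ →
      k * y ≡ (k - 2ℚ * t) →
      (d + 1ℚ) * k * (2ℚ * ν + d + 2ℚ) *
          (¼ * (((1ℚ + ν) + d) * (((1ℚ + ν) + d) - 1ℚ)) + ¼ * ((1ℚ + ν) * ((1ℚ + ν) - 3ℚ)) - 2ℚ * (B + y * b))
      ≡ (d + 1ℚ) * k * (2ℚ * ν + d + 2ℚ) * (¼ * ((ν + d) * ((ν + d) - 1ℚ)) + ¼ * (ν * (ν - 3ℚ)) - 2ℚ * B)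
          + ((2ℚ * ν + d + 2ℚ) * (½ * (d + 1ℚ) * ((ν + 1ℚ) * k - t))
              + ½ * (d + 1ℚ) * ((2ℚ * ν + d + 10ℚ) * t + (2ℚ * ν * ν + 3ℚ * ν * d - 2ℚ * ν + d * d - 8ℚ) * k))
    lem ν d y k t B b h₁ h₂ =
      modulo (- (2ℚ * (d + 1ℚ) * k * y)) h₁ (modulo (- (2ℚ * (d + 1ℚ))) h₂ (solve 7 (λ ν d y k t B b →
          (d :+ con 1ℚ) :* k :* (con 2ℚ :* ν :+ d :+ con 2ℚ) :*
              (con ¼ :* (((con 1ℚ :+ ν) :+ d) :* (((con 1ℚ :+ ν) :+ d) :- con 1ℚ))
                  :+ con ¼ :* ((con 1ℚ :+ ν) :* ((con 1ℚ :+ ν) :- con 3ℚ)) :- con 2ℚ :* (B :+ y :* b))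
          := (d :+ con 1ℚ) :* k :* (con 2ℚ :* ν :+ d :+ con 2ℚ) :*
              (con ¼ :* ((ν :+ d) :* ((ν :+ d) :- con 1ℚ)) :+ con ¼ :* (ν :* (ν :- con 3ℚ)) :- con 2ℚ :* B)
                  :+ ((con 2ℚ :* ν :+ d :+ con 2ℚ) :* (con ½ :* (d :+ con 1ℚ) :* ((ν :+ con 1ℚ) :* k :- t))
                      :+ con ½ :* (d :+ con 1ℚ) :*
                          ((con 2ℚ :* ν :+ d :+ con 10ℚ) :* t
                              :+ (con 2ℚ :* ν :* ν :+ con 3ℚ :* ν :* d :- con 2ℚ :* ν :+ d :* d :- con 8ℚ) :*
                                  k)) :+ (:- (con 2ℚ :* (d :+ con 1ℚ) :* k :* y)) :*
                                      (b :* (con 2ℚ :* ν :+ d :+ con 2ℚ) :- con 1ℚ)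
                                          :+ (:- (con 2ℚ :* (d :+ con 1ℚ))) :* (k :* y :- (k :- con 2ℚ :* t)))
                                              refl ν d y k t B b))

-- Identification of the closed formula with `averageCost`.

module ClosedFormula where

  open import Defs using (fromℕ; ∑; H; C-nonZero; module ClosedForm)
  open BallotWords
  open RationalArithmetic
  open BallotCounts
  open CostSums
  open ColumnRecurrence
  open import Data.Nat as ℕ using (ℕ; zero; suc; NonZero)
  import Data.Nat.Properties as ℕ
  open import Data.Nat.Combinatorics using (_C_; nCk+nC[k+1]≡[n+1]C[k+1]; k>n⇒nCk≡0; nC1≡n; nCk≡nC[n∸k])
  import Data.Nat.Tactic.RingSolver as ℕS
  open import Data.Integer as ℤ using (+_)
  open import Data.Rational as ℚ using (ℚ; 0ℚ; 1ℚ; ½; _/_; _+_; _*_; _-_; -_)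
  import Data.Rational.Properties as ℚ
  open import Data.Rational.Solver
  open import Relation.Binary.PropositionalEquality
  open +-*-Solver using (solve; con; _:+_; _:*_; _:-_; :-_; _:=_)

  C-absorption : ∀ n k → suc k ℕ.* (suc n C suc k) ≡ suc n ℕ.* (n C k)
  C-absorption zero    zero    = refl
  C-absorption zero    (suc k) = begin
    (2 ℕ.+ k) ℕ.* (1 C (2 ℕ.+ k)) ≡⟨ cong ((2 ℕ.+ k) ℕ.*_) (k>n⇒nCk≡0 {1} {2 ℕ.+ k} (ℕ.s≤s (ℕ.s≤s ℕ.z≤n))) ⟩
    (2 ℕ.+ k) ℕ.* 0 ≡⟨ ℕ.*-zeroʳ (2 ℕ.+ k) ⟩
    1 ℕ.* 0 ∎
    where open ≡-Reasoning
  C-absorption (suc n) zero    = trans (ℕ.*-identityˡ (suc (suc n) C 1))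
      (trans (nC1≡n (2 ℕ.+ n)) (sym (ℕ.*-identityʳ (2 ℕ.+ n))))
  C-absorption (suc n) (suc k) = begin
    (2 ℕ.+ k) ℕ.* ((2 ℕ.+ n) C (2 ℕ.+ k))
        ≡⟨ cong ((2 ℕ.+ k) ℕ.*_) (sym (nCk+nC[k+1]≡[n+1]C[k+1] (suc n) (suc k))) ⟩
    (2 ℕ.+ k) ℕ.* (x ℕ.+ y) ≡⟨ l₁ k x y ⟩
    suc k ℕ.* x ℕ.+ x ℕ.+ (2 ℕ.+ k) ℕ.* y
        ≡⟨ cong₂ (λ a b → a ℕ.+ x ℕ.+ b) (C-absorption n k) (C-absorption n (suc k)) ⟩
    suc n ℕ.* (n C k) ℕ.+ x ℕ.+ suc n ℕ.* (n C suc k) ≡⟨ l₂ n (n C k) x (n C suc k) ⟩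
    suc n ℕ.* (n C k ℕ.+ n C suc k) ℕ.+ x ≡⟨ cong (λ z → suc n ℕ.* z ℕ.+ x) (nCk+nC[k+1]≡[n+1]C[k+1] n k) ⟩
    suc n ℕ.* x ℕ.+ x ≡⟨ ℕ.+-comm (suc n ℕ.* x) x ⟩
    (2 ℕ.+ n) ℕ.* x ∎
    where
    open ≡-Reasoning
    x y : ℕ
    x = suc n C suc k
    y = suc n C (2 ℕ.+ k)
    l₁ : ∀ k x y → (2 ℕ.+ k) ℕ.* (x ℕ.+ y) ≡ suc k ℕ.* x ℕ.+ x ℕ.+ (2 ℕ.+ k) ℕ.* y
    l₁ = ℕS.solve-∀
    l₂ : ∀ n a x b → suc n ℕ.* a ℕ.+ x ℕ.+ suc n ℕ.* b ≡ suc n ℕ.* (a ℕ.+ b) ℕ.+ x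
    l₂ = ℕS.solve-∀

  paths≡C : ∀ n δ → paths n δ ≡ (δ ℕ.+ 2 ℕ.* n) C n
  paths≡C zero    δ       = refl
  paths≡C (suc n) zero    = begin
    2 ℕ.* paths n 1 ≡⟨ cong (paths n 1 ℕ.+_) (ℕ.+-identityʳ (paths n 1)) ⟩
    paths n 1 ℕ.+ paths n 1 ≡⟨ cong₂ ℕ._+_ (paths≡C n 1) (trans (paths≡C n 1) mirror) ⟩
    (1 ℕ.+ 2 ℕ.* n) C n ℕ.+ (1 ℕ.+ 2 ℕ.* n) C suc n ≡⟨ nCk+nC[k+1]≡[n+1]C[k+1] (1 ℕ.+ 2 ℕ.* n) n ⟩
    (2 ℕ.+ 2 ℕ.* n) C suc n ≡⟨ cong (_C suc n) (sym (l₁ n)) ⟩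
    (2 ℕ.* (1 ℕ.+ n)) C suc n ∎
    where
    open ≡-Reasoning
    l₁ : ∀ n → 2 ℕ.* (1 ℕ.+ n) ≡ 2 ℕ.+ 2 ℕ.* n
    l₁ = ℕS.solve-∀
    l₂ : ∀ n → 1 ℕ.+ 2 ℕ.* n ≡ n ℕ.+ (1 ℕ.+ n)
    l₂ = ℕS.solve-∀
    mirror : (1 ℕ.+ 2 ℕ.* n) C n ≡ (1 ℕ.+ 2 ℕ.* n) C suc n
    mirror = trans (nCk≡nC[n∸k] (subst (n ℕ.≤_) (sym (l₂ n)) (ℕ.m≤m+n n _)))
      (cong ((1 ℕ.+ 2 ℕ.* n) C_) (trans (cong (ℕ._∸ n) (l₂ n)) (ℕ.m+n∸m≡n n (suc n))))
  paths≡C (suc n) (suc δ) = begin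
    paths (suc n) δ ℕ.+ paths n (2 ℕ.+ δ)
        ≡⟨ cong₂ ℕ._+_ (trans (paths≡C (suc n) δ) (cong (_C suc n) (l₁ n δ))) (paths≡C n (2 ℕ.+ δ)) ⟩
    (2 ℕ.+ δ ℕ.+ 2 ℕ.* n) C suc n ℕ.+ (2 ℕ.+ δ ℕ.+ 2 ℕ.* n) C n ≡⟨ ℕ.+-comm ((2 ℕ.+ δ ℕ.+ 2 ℕ.* n) C suc n) _ ⟩
    (2 ℕ.+ δ ℕ.+ 2 ℕ.* n) C n ℕ.+ (2 ℕ.+ δ ℕ.+ 2 ℕ.* n) C suc n
        ≡⟨ nCk+nC[k+1]≡[n+1]C[k+1] (2 ℕ.+ δ ℕ.+ 2 ℕ.* n) n ⟩
    (3 ℕ.+ δ ℕ.+ 2 ℕ.* n) C suc n ≡⟨ cong (_C suc n) (sym (cong suc (l₁ n δ))) ⟩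
    (suc δ ℕ.+ 2 ℕ.* suc n) C suc n ∎
    where
    open ≡-Reasoning
    l₁ : ∀ n δ → δ ℕ.+ 2 ℕ.* (1 ℕ.+ n) ≡ 2 ℕ.+ δ ℕ.+ 2 ℕ.* n
    l₁ = ℕS.solve-∀

  *-≢0 : ∀ {x y} → x ≢ 0ℚ → y ≢ 0ℚ → x * y ≢ 0ℚ
  *-≢0 {x} {y} x≢0 y≢0 eq = y≢0 (*-cancelˡ-≢0 x x≢0 (trans eq (sym (ℚ.*-zeroʳ x))))

  module _ (m : ℕ) where
    private
      l : ℕ
      l = suc m
      λ′ : ℚ
      λ′ = fromℕ l

    -- The summands at parameter 0 are definitionally those at every `δ`.
    u v : ℕ → ℚ
    u = ClosedForm.u l 0
    v = ClosedForm.v l 0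

    A F : ℕ → ℚ
    A i  = fromℕ ((i ℕ.+ l) C i)
    F i = fromℕ ((i ℕ.+ 2 ℕ.* l) C i)

    A≢0 : ∀ i → A i ≢ 0ℚ
    A≢0 i = fromℕ-≢0 _ {{C-nonZero i l}}
    F≢0 : ∀ i → F i ≢ 0ℚ
    F≢0 i = fromℕ-≢0 _ {{C-nonZero i (2 ℕ.* l)}}

    A-suc : ∀ i → (1ℚ + fromℕ i) * A (suc i) ≡ (1ℚ + fromℕ i + λ′) * A i
    A-suc i = trans (sym (expand ((⟨ 1 ⟩ ⊕ ⟨ i ⟩) ⊗ ⟨ (suc i ℕ.+ l) C suc i ⟩)))
      (trans (cong fromℕ (C-absorption (i ℕ.+ l) i)) (expand ((⟨ 1 ⟩ ⊕ ⟨ i ⟩ ⊕ ⟨ l ⟩) ⊗ ⟨ (i ℕ.+ l) C i ⟩)))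

    F-suc : ∀ i → (1ℚ + fromℕ i) * F (suc i) ≡ (1ℚ + fromℕ i + 2ℚ * λ′) * F i
    F-suc i = trans (sym (expand ((⟨ 1 ⟩ ⊕ ⟨ i ⟩) ⊗ ⟨ (suc i ℕ.+ 2 ℕ.* l) C suc i ⟩)))
      (trans (cong fromℕ (C-absorption (i ℕ.+ 2 ℕ.* l) i))
          (expand ((⟨ 1 ⟩ ⊕ ⟨ i ⟩ ⊕ ⟨ 2 ⟩ ⊗ ⟨ l ⟩) ⊗ ⟨ (i ℕ.+ 2 ℕ.* l) C i ⟩)))

    2^ : ℕ → ℚ
    2^ i = fromℕ (2 ℕ.^ i)

    2^≢0 : ∀ i → 2^ i ≢ 0ℚ
    2^≢0 i = fromℕ-≢0 _ {{ℕ.m^n≢0 2 i}}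

    u-spec : ∀ i → u i * (F i * (1ℚ + fromℕ i + 2ℚ * λ′)) ≡ 2^ i * A i
    u-spec i = trans (cong (u i *_) (sym (expand (⟨ (i ℕ.+ 2 ℕ.* l) C i ⟩ ⊗ (⟨ 1 ⟩ ⊕ ⟨ i ⟩ ⊕ ⟨ 2 ⟩ ⊗ ⟨ l ⟩)))))
      (trans (/-cancel (+ (2 ℕ.^ i ℕ.* ((i ℕ.+ l) C i))) (((i ℕ.+ 2 ℕ.* l) C i) ℕ.* (1 ℕ.+ i ℕ.+ 2 ℕ.* l))
          {{ℕ.m*n≢0 _ (1 ℕ.+ i ℕ.+ 2 ℕ.* l) {{C-nonZero i (2 ℕ.* l)}}}})
        (expand (⟨ 2 ℕ.^ i ⟩ ⊗ ⟨ (i ℕ.+ l) C i ⟩)))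

    i+2l≢0 : ∀ i → NonZero (i ℕ.+ 2 ℕ.* l)
    i+2l≢0 i = ℕ.≢-nonZero λ eq → ℕ.1+n≢0 (ℕ.m+n≡0⇒n≡0 i eq)

    v-spec : ∀ i → v i * (2^ i * A i * (fromℕ i + 2ℚ * λ′)) ≡ F i
    v-spec i = trans (cong (v i *_) (sym (expand (⟨ 2 ℕ.^ i ⟩ ⊗ ⟨ (i ℕ.+ l) C i ⟩ ⊗ (⟨ i ⟩ ⊕ ⟨ 2 ⟩ ⊗ ⟨ l ⟩)))))
      (/-cancel (+ ((i ℕ.+ 2 ℕ.* l) C i)) _
          {{ℕ.m*n≢0 _ (i ℕ.+ 2 ℕ.* l) {{ℕ.m*n≢0 (2 ℕ.^ i) _ {{ℕ.m^n≢0 2 i}} {{C-nonZero i l}}}} {{i+2l≢0 i}}}})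

    -- The ratio of consecutive `v` is inverse to the coefficient of `Y m i` in `Y-suc`: `v` is the
    -- summation factor of that recursion.
    v-suc : ∀ i → 2ℚ * (fromℕ i + 1ℚ + λ′) * v (suc i) ≡ (fromℕ i + 2ℚ * λ′) * v i
    v-suc i = *-cancelˡ-≢0 (2^ i * A i * (1ℚ + d + 2ℚ * λ′))
      (*-≢0 (*-≢0 (2^≢0 i) (A≢0 i))
          (λ eq → fromℕ-≢0 (1 ℕ.+ i ℕ.+ 2 ℕ.* l) (trans (expand (⟨ 1 ⟩ ⊕ ⟨ i ⟩ ⊕ ⟨ 2 ⟩ ⊗ ⟨ l ⟩)) eq)))
      (lem d λ′ (2^ i) (A i) (A (suc i)) (F i) (F (suc i)) (v i) (v (suc i)) v-spec′ (v-spec i) (F-suc i)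
          (A-suc i))
      where
      d : ℚ
      d = fromℕ i
      v-spec′ : v (suc i) * (2ℚ * 2^ i * A (suc i) * (1ℚ + d + 2ℚ * λ′)) ≡ F (suc i)
      v-spec′ = trans (cong₂ (λ a b → v (suc i) * (a * A (suc i) * (b + 2ℚ * λ′)))
          (sym (expand (⟨ 2 ⟩ ⊗ ⟨ 2 ℕ.^ i ⟩))) (sym (fromℕ-suc i))) (v-spec (suc i))
      lem : ∀ d l t a a′ b b′ v v′ →
        v′ * (2ℚ * t * a′ * (1ℚ + d + 2ℚ * l)) ≡ b′ →
        v * (t * a * (d + 2ℚ * l)) ≡ b →
        (1ℚ + d) * b′ ≡ (1ℚ + d + 2ℚ * l) * b →
        (1ℚ + d) * a′ ≡ (1ℚ + d + l) * a →
        t * a * (1ℚ + d + 2ℚ * l) * (2ℚ * (d + 1ℚ + l) * v′)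
        ≡ t * a * (1ℚ + d + 2ℚ * l) * ((d + 2ℚ * l) * v)
      lem d l t a a′ b b′ v v′ h₁ h₂ h₃ h₄ =
        modulo (1ℚ + d) h₁ (modulo (- (1ℚ + d + 2ℚ * l)) h₂
            (modulo 1ℚ h₃ (modulo (- (2ℚ * t * v′ * (1ℚ + d + 2ℚ * l))) h₄ (solve 9 (λ d l t a a′ b b′ v v′ →
            t :* a :* (con 1ℚ :+ d :+ con 2ℚ :* l) :* (con 2ℚ :* (d :+ con 1ℚ :+ l) :* v′)
            := t :* a :* (con 1ℚ :+ d :+ con 2ℚ :* l) :* ((d :+ con 2ℚ :* l) :* v)
                :+ (con 1ℚ :+ d) :* (v′ :* (con 2ℚ :* t :* a′ :* (con 1ℚ :+ d :+ con 2ℚ :* l)) :- b′)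
                    :+ (:- (con 1ℚ :+ d :+ con 2ℚ :* l)) :* (v :* (t :* a :* (d :+ con 2ℚ :* l)) :- b)
                        :+ con 1ℚ :* ((con 1ℚ :+ d) :* b′ :- (con 1ℚ :+ d :+ con 2ℚ :* l) :* b)
                            :+ (:- (con 2ℚ :* t :* v′ :* (con 1ℚ :+ d :+ con 2ℚ :* l))) :*
                                ((con 1ℚ :+ d) :* a′ :- (con 1ℚ :+ d :+ l) :* a)) refl d l t a a′ b b′ v v′))))

    v-0 : 2ℚ * λ′ * v 0 ≡ 1ℚ
    v-0 = trans (lem λ′ (v 0)) (v-spec 0)
      where
      lem : ∀ l v → 2ℚ * l * v ≡ v * (1ℚ * 1ℚ * (0ℚ + 2ℚ * l))
      lem = solve 2 (λ l v →
          con 2ℚ :* l :* v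
          := v :* (con 1ℚ :* con 1ℚ :* (con 0ℚ :+ con 2ℚ :* l))) refl

    -- By Y-suc and v-suc, v i * Y m i grows by v (suc i) when i does.
    vY : ∀ i → 2ℚ * λ′ * (v i * Y m i) ≡ 2ℚ * λ′ * ∑ i v + Y m 0
    vY zero = lem λ′ (v 0) (Y m 0) v-0
      where
      lem : ∀ l v y →
        2ℚ * l * v ≡ 1ℚ →
        2ℚ * l * (v * y)
        ≡ 2ℚ * l * 0ℚ + y
      lem l v y h₁ =
        modulo y h₁ (solve 3 (λ l v y →
            con 2ℚ :* l :* (v :* y)
            := con 2ℚ :* l :* con 0ℚ :+ y :+ y :* (con 2ℚ :* l :* v :- con 1ℚ)) refl l v y)
    vY (suc i) = *-cancelˡ-≢0 κ κ≢0
        (lem (fromℕ i) λ′ (v i) (v (suc i)) (Y m i) (Y m (suc i)) (∑ i v) (Y m 0) Y-suc′ (v-suc i) (vY i))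
      where
      κ : ℚ
      κ = fromℕ i + 2ℚ * λ′
      κ≢0 : κ ≢ 0ℚ
      κ≢0 eq = fromℕ-≢0 (i ℕ.+ 2 ℕ.* l) {{i+2l≢0 i}} (trans (expand (⟨ i ⟩ ⊕ ⟨ 2 ⟩ ⊗ ⟨ l ⟩)) eq)
      Y-suc′ : (fromℕ i + 2ℚ * λ′) * Y m (suc i) ≡ (fromℕ i + 2ℚ * λ′) + 2ℚ * (fromℕ i + 1ℚ + λ′) * Y m i
      Y-suc′ = subst (λ l → (fromℕ i + 2ℚ * l) * Y m (suc i) ≡ (fromℕ i + 2ℚ * l)
          + 2ℚ * (fromℕ i + 1ℚ + l) * Y m i) (sym (fromℕ-suc m))
        (lem₁ (fromℕ m) (fromℕ i) (Y m (suc i)) (Y m i) (Y-suc m i))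
        where
        lem₁ : ∀ μ d y′ y →
          (2ℚ * μ + d + 2ℚ) * y′ ≡ ((2ℚ * μ + d + 2ℚ) + 2ℚ * (μ + d + 2ℚ) * y) →
          (d + 2ℚ * (1ℚ + μ)) * y′
          ≡ (d + 2ℚ * (1ℚ + μ)) + 2ℚ * (d + 1ℚ + (1ℚ + μ)) * y
        lem₁ μ d y′ y h₁ =
          modulo 1ℚ h₁ (solve 4 (λ μ d y′ y →
              (d :+ con 2ℚ :* (con 1ℚ :+ μ)) :* y′
              := (d :+ con 2ℚ :* (con 1ℚ :+ μ)) :+ con 2ℚ :* (d :+ con 1ℚ :+ (con 1ℚ :+ μ)) :* y
                  :+ con 1ℚ :* ((con 2ℚ :* μ :+ d :+ con 2ℚ) :* y′ :-
                      ((con 2ℚ :* μ :+ d :+ con 2ℚ) :+ con 2ℚ :* (μ :+ d :+ con 2ℚ) :* y))) refl μ d y′ y)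
      lem : ∀ d l v v′ y y′ s y₀ →
        (d + 2ℚ * l) * y′ ≡ ((d + 2ℚ * l) + 2ℚ * (d + 1ℚ + l) * y) →
        2ℚ * (d + 1ℚ + l) * v′ ≡ (d + 2ℚ * l) * v →
        2ℚ * l * (v * y) ≡ (2ℚ * l * s + y₀) →
        (d + 2ℚ * l) * (2ℚ * l * (v′ * y′))
        ≡ (d + 2ℚ * l) * (2ℚ * l * (s + v′) + y₀)
      lem d l v v′ y y′ s y₀ h₁ h₂ h₃ =
        modulo (2ℚ * l * v′) h₁ (modulo (2ℚ * l * y) h₂ (modulo (d + 2ℚ * l) h₃ (solve 8 (λ d l v v′ y y′ s y₀ →
            (d :+ con 2ℚ :* l) :* (con 2ℚ :* l :* (v′ :* y′))
            := (d :+ con 2ℚ :* l) :* (con 2ℚ :* l :* (s :+ v′) :+ y₀)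
                :+ (con 2ℚ :* l :* v′) :*
                    ((d :+ con 2ℚ :* l) :* y′ :- ((d :+ con 2ℚ :* l) :+ con 2ℚ :* (d :+ con 1ℚ :+ l) :* y))
                        :+ (con 2ℚ :* l :* y) :*
                            (con 2ℚ :* (d :+ con 1ℚ :+ l) :* v′ :- (d :+ con 2ℚ :* l) :* v)
                                :+ (d :+ con 2ℚ :* l) :*
                                    (con 2ℚ :* l :* (v :* y) :- (con 2ℚ :* l :* s :+ y₀))) refl d l v v′ y y′
                                        s y₀)))

    -- Powers of 2 and binomials cancel. Thus `u i` times `v i * Y m i` is a rational multiple of
    -- `Y m i`, the one from which `q` is made.
    u*v : ∀ i → u i * v i ≡ recip (suc (2 ℕ.* m ℕ.+ i)) * recip (2 ℕ.+ (2 ℕ.* m ℕ.+ i))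
    u*v i = *-cancelˡ-≢0 (2^ i * A i * F i) (*-≢0 (*-≢0 (2^≢0 i) (A≢0 i)) (F≢0 i))
      (lem d λ′ (2^ i) (A i) (F i) (u i) (v i) r₁ r₂ h₂ h₁ (v-spec i) (u-spec i))
      where
      d r₁ r₂ : ℚ
      d = fromℕ i
      r₁ = recip (suc (2 ℕ.* m ℕ.+ i))
      r₂ = recip (2 ℕ.+ (2 ℕ.* m ℕ.+ i))
      e₁ : ∀ m i → i ℕ.+ 2 ℕ.* (1 ℕ.+ m) ≡ suc (suc (2 ℕ.* m ℕ.+ i))
      e₁ = ℕS.solve-∀
      h₁ : r₁ * (d + 2ℚ * λ′) ≡ 1ℚ
      h₁ = recip-inverse (⟨ i ⟩ ⊕ ⟨ 2 ⟩ ⊗ ⟨ l ⟩) _ (e₁ m i)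
      h₂ : r₂ * (1ℚ + d + 2ℚ * λ′) ≡ 1ℚ
      h₂ = recip-inverse (⟨ 1 ⟩ ⊕ ⟨ i ⟩ ⊕ ⟨ 2 ⟩ ⊗ ⟨ l ⟩) _ (cong suc (e₁ m i))
      lem : ∀ d l t a b u v r₁ r₂ →
        r₂ * (1ℚ + d + 2ℚ * l) ≡ 1ℚ →
        r₁ * (d + 2ℚ * l) ≡ 1ℚ →
        v * (t * a * (d + 2ℚ * l)) ≡ b →
        u * (b * (1ℚ + d + 2ℚ * l)) ≡ t * a →
        t * a * b * (u * v)
        ≡ t * a * b * (r₁ * r₂)
      lem d l t a b u v r₁ r₂ h₁ h₂ h₃ h₄ =
        modulo (- (u * v * t * a * b * r₁ * (d + 2ℚ * l))) h₁
            (modulo (- (u * v * t * a * b)) h₂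
                (modulo (u * b * (1ℚ + d + 2ℚ * l) * r₁ * r₂) h₃
                    (modulo (b * r₁ * r₂) h₄ (solve 9 (λ d l t a b u v r₁ r₂ →
            t :* a :* b :* (u :* v)
            := t :* a :* b :* (r₁ :* r₂)
                :+ (:- (u :* v :* t :* a :* b :* r₁ :* (d :+ con 2ℚ :* l))) :*
                    (r₂ :* (con 1ℚ :+ d :+ con 2ℚ :* l) :- con 1ℚ)
                        :+ (:- (u :* v :* t :* a :* b)) :* (r₁ :* (d :+ con 2ℚ :* l) :- con 1ℚ)
                            :+ (u :* b :* (con 1ℚ :+ d :+ con 2ℚ :* l) :* r₁ :* r₂) :*
                                (v :* (t :* a :* (d :+ con 2ℚ :* l)) :- b)
                                    :+ (b :* r₁ :* r₂) :* (u :* (b :* (con 1ℚ :+ d :+ con 2ℚ :* l)) :- t :*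
                                        a)) refl d l t a b u v r₁ r₂))))

    q-u : ∀ i → q l i ≡ u i * (2ℚ * λ′ * ∑ i v + Y m 0)
    q-u i = trans (ℚ.*-assoc (2ℚ * λ′ * Y m i) _ _)
      (lem λ′ (u i) (v i) (Y m i) (∑ i v) (Y m 0)
          (recip (suc (2 ℕ.* m ℕ.+ i)) * recip (2 ℕ.+ (2 ℕ.* m ℕ.+ i))) (u*v i) (vY i))
      where
      lem : ∀ l u v y s y₀ r →
        u * v ≡ r →
        2ℚ * l * (v * y) ≡ (2ℚ * l * s + y₀) →
        2ℚ * l * y * r
        ≡ u * (2ℚ * l * s + y₀)
      lem l u v y s y₀ r h₁ h₂ =
        modulo (- (2ℚ * l * y)) h₁ (modulo u h₂ (solve 7 (λ l u v y s y₀ r →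
            con 2ℚ :* l :* y :* r
            := u :* (con 2ℚ :* l :* s :+ y₀) :+ (:- (con 2ℚ :* l :* y)) :* (u :* v :- r)
                :+ u :* (con 2ℚ :* l :* (v :* y) :- (con 2ℚ :* l :* s :+ y₀))) refl l u v y s y₀ r))

    -- The origin of the double sum: each `q l i` contains the inner sum of `v` up to `i`.
    ∑q : ∀ δ → ∑ δ (q l) ≡ 2ℚ * λ′ * ∑ δ (λ i → u i * ∑ i v) + Y m 0 * ∑ δ u
    ∑q zero    = lem λ′ (Y m 0)
      where
      lem : ∀ l y → 0ℚ ≡ 2ℚ * l * 0ℚ + y * 0ℚ
      lem = solve 2 (λ l y →
          con 0ℚ
          := con 2ℚ :* l :* con 0ℚ :+ y :* con 0ℚ) refl
    ∑q (suc δ) = lem λ′ (Y m 0) (∑ δ (q l)) (q l (suc δ)) (∑ δ (λ i → u i * ∑ i v)) (∑ δ u) (u (suc δ))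
        (∑ (suc δ) v) (∑q δ) (q-u (suc δ))
      where
      lem : ∀ l y s q w x u v →
        s ≡ (2ℚ * l * w + y * x) →
        q ≡ u * (2ℚ * l * v + y) →
        s + q
        ≡ 2ℚ * l * (w + u * v) + y * (x + u)
      lem l y s q w x u v h₁ h₂ =
        modulo 1ℚ h₁ (modulo 1ℚ h₂ (solve 8 (λ l y s q w x u v →
            s :+ q
            := con 2ℚ :* l :* (w :+ u :* v) :+ y :* (x :+ u) :+ con 1ℚ :* (s :- (con 2ℚ :* l :* w :+ y :* x))
                :+ con 1ℚ :* (q :- u :* (con 2ℚ :* l :* v :+ y))) refl l y s q w x u v))

    quarter : ∀ i → i / 4 ≡ ¼ * fromℤ i
    quarter i = *-cancelˡ-≢0 4ℚ (fromℕ-≢0 4) (lem (i / 4) (fromℤ i) (/-cancel i 4))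
      where
      lem : ∀ x z →
        x * 4ℚ ≡ z →
        4ℚ * x
        ≡ 4ℚ * (¼ * z)
      lem x z h₁ =
        modulo 1ℚ h₁ (solve 2 (λ x z →
            con 4ℚ :* x
            := con 4ℚ :* (con ¼ :* z) :+ con 1ℚ :* (x :* con 4ℚ :- z)) refl x z)

    quadratic : ∀ a b → (+ a ℤ.* (+ a ℤ.- + b)) / 4 ≡ ¼ * (fromℕ a * (fromℕ a + fromℤ (ℤ.- + b)))
    quadratic a b = trans (quarter (+ a ℤ.* (+ a ℤ.- + b))) (cong (¼ *_)
      (trans (fromℤ-* (+ a) (+ a ℤ.- + b)) (cong (fromℕ a *_) (fromℤ-+ (+ a) (ℤ.- + b)))))

    -- With `y₀ = Y m 0`, the terms `c * S` and `gG` are multiples of `u δ` and combine to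
    -- `2 (λ₂ + δ + 1) q l δ`. The terms with `X` and `W` together with `G₁ - g₃` combine to
    -- `- (δ + 1) qs l δ`. What remains are the harmonic numbers of `Hs` and the quadratic terms.
    closedForm≡averageCost : ∀ δ → ClosedForm.closedForm l δ ≡ averageCost l δ
    closedForm≡averageCost δ =
      lem z₁ z₂ λ₁ λ′ d E X c S k W G₁ gG g₃ D₁ h₀ h₁ h₂ h₃ y₀ (u δ) (u 0) (q l δ) (qs l δ)
          (quadratic (l ℕ.+ δ) 1) (quadratic l 3) (fromℕ-+ l δ) hE hc hk hG hg hg₃ (expand (⟨ δ ⟩ ⊕ ⟨ 1 ⟩))
              (q-u δ) hs
      where
      instance
        nz₁ : NonZero ((2 ℕ.* l) C l)
        nz₁ = C-nonZero l (l ℕ.+ 0)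
        nz₂ : NonZero (((δ ℕ.+ 2 ℕ.* l) C δ) ℕ.* (1 ℕ.+ δ ℕ.+ 2 ℕ.* l))
        nz₂ = ℕ.m*n≢0 _ (1 ℕ.+ δ ℕ.+ 2 ℕ.* l) {{C-nonZero δ (2 ℕ.* l)}}
        nz₃ : NonZero (((2 ℕ.* l) C l) ℕ.* (1 ℕ.+ 2 ℕ.* l))
        nz₃ = ℕ.m*n≢0 _ (1 ℕ.+ 2 ℕ.* l)
        nz₄ : NonZero (((δ ℕ.+ 2 ℕ.* l) C δ) ℕ.* ((2 ℕ.* l) C l) ℕ.* (1 ℕ.+ δ ℕ.+ 2 ℕ.* l))
        nz₄ = ℕ.m*n≢0 _ (1 ℕ.+ δ ℕ.+ 2 ℕ.* l) {{ℕ.m*n≢0 _ _ {{C-nonZero δ (2 ℕ.* l)}}}}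
      d λ₁ z₁ z₂ C₀ G X S W E c k G₁ g gG g₃ D₁ h₀ h₁ h₂ h₃ y₀ : ℚ
      d = fromℕ δ
      λ₁ = fromℕ (l ℕ.+ δ)
      z₁ = (+ (l ℕ.+ δ) ℤ.* (+ (l ℕ.+ δ) ℤ.- + 1)) / 4
      z₂ = (+ l ℤ.* (+ l ℤ.- + 3)) / 4
      C₀ = fromℕ ((2 ℕ.* l) C l)
      G = fromℕ (2 ℕ.^ (2 ℕ.* l))
      X = ∑ δ u
      S = ∑ δ v
      W = ∑ δ (λ i → u i * ∑ i v)
      E = + ((δ ℕ.+ 1) ℕ.* 2 ℕ.^ (2 ℕ.* l)) / ((2 ℕ.* l) C l)
      c = + (2 ℕ.^ (δ ℕ.+ 2) ℕ.* l ℕ.* (1 ℕ.+ δ ℕ.+ l) ℕ.* ((δ ℕ.+ l) C δ)) /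
          (((δ ℕ.+ 2 ℕ.* l) C δ) ℕ.* (1 ℕ.+ δ ℕ.+ 2 ℕ.* l))
      k = fromℕ (2 ℕ.* (δ ℕ.+ 1) ℕ.* l)
      G₁ = + (2 ℕ.^ (2 ℕ.* l) ℕ.* (δ ℕ.+ 1)) / (((2 ℕ.* l) C l) ℕ.* (1 ℕ.+ 2 ℕ.* l))
      g = + (2 ℕ.^ (δ ℕ.+ 1) ℕ.* (1 ℕ.+ δ ℕ.+ l) ℕ.* ((δ ℕ.+ l) C δ)) /
          (((δ ℕ.+ 2 ℕ.* l) C δ) ℕ.* ((2 ℕ.* l) C l) ℕ.* (1 ℕ.+ δ ℕ.+ 2 ℕ.* l))
      gG = g * (- G + C₀)
      g₃ = + (δ ℕ.+ 1) / (1 ℕ.+ 2 ℕ.* l)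
      D₁ = fromℕ (δ ℕ.+ 1)
      h₀ = H (δ ℕ.+ 2 ℕ.* l)
      h₁ = H l
      h₂ = H (2 ℕ.* l)
      h₃ = H δ
      y₀ = Y m 0
      C₀≢0 : C₀ ≢ 0ℚ
      C₀≢0 = fromℕ-≢0 ((2 ℕ.* l) C l)
      M≢0 : 1ℚ + d + 2ℚ * λ′ ≢ 0ℚ
      M≢0 eq = fromℕ-≢0 (1 ℕ.+ δ ℕ.+ 2 ℕ.* l) (trans (expand (⟨ 1 ⟩ ⊕ ⟨ δ ⟩ ⊕ ⟨ 2 ⟩ ⊗ ⟨ l ⟩)) eq)
      L≢0 : 1ℚ + 2ℚ * λ′ ≢ 0ℚ
      L≢0 eq = fromℕ-≢0 (1 ℕ.+ 2 ℕ.* l) (trans (expand (⟨ 1 ⟩ ⊕ ⟨ 2 ⟩ ⊗ ⟨ l ⟩)) eq)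
      -- This is `Y-spec m 0` doubled, since C(2l, l) = 2 C(2m+1, m) and 2^(2l) = 4 · 4^m for l = m
      -- + 1.
      hy : C₀ * y₀ ≡ C₀ - G
      hy = subst₂ (λ c g → c * y₀ ≡ c - g) C-eq G-eq (l₁ (pathsℚ m 1) (T m 0) y₀ (Y-spec m 0))
        where
        C-eq : 2ℚ * pathsℚ m 1 ≡ C₀
        C-eq = trans (sym (fromℕ-* 2 (paths m 1))) (cong fromℕ (paths≡C (suc m) 0))
        G-eq : 4ℚ * T m 0 ≡ G
        G-eq = trans (sym (fromℕ-* 4 (4 ℕ.^ m))) (cong fromℕ (ℕ.^-*-assoc 2 2 l))
        l₁ : ∀ k t y →
          k * y ≡ (k - 2ℚ * t) →
          2ℚ * k * y
          ≡ 2ℚ * k - 4ℚ * t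
        l₁ k t y h₁ =
          modulo 2ℚ h₁ (solve 3 (λ k t y →
              con 2ℚ :* k :* y
              := con 2ℚ :* k :- con 4ℚ :* t :+ con 2ℚ :* (k :* y :- (k :- con 2ℚ :* t))) refl k t y)
      2^-+ : ∀ j → fromℕ (2 ℕ.^ (δ ℕ.+ j)) ≡ 2^ δ * 2^ j
      2^-+ j = trans (cong fromℕ (ℕ.^-distribˡ-+-* 2 δ j)) (fromℕ-* (2 ℕ.^ δ) (2 ℕ.^ j))
      E-spec : E * C₀ ≡ (d + 1ℚ) * G
      E-spec = trans (/-cancel (+ ((δ ℕ.+ 1) ℕ.* 2 ℕ.^ (2 ℕ.* l))) _)
          (expand ((⟨ δ ⟩ ⊕ ⟨ 1 ⟩) ⊗ ⟨ 2 ℕ.^ (2 ℕ.* l) ⟩))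
      hE : E ≡ (d + 1ℚ) * (1ℚ - y₀)
      hE = *-cancelˡ-≢0 C₀ C₀≢0 (l₁ d C₀ G E y₀ E-spec hy)
        where
        l₁ : ∀ d c g e y →
          e * c ≡ (d + 1ℚ) * g →
          c * y ≡ (c - g) →
          c * e
          ≡ c * ((d + 1ℚ) * (1ℚ - y))
        l₁ d c g e y h₁ h₂ =
          modulo 1ℚ h₁ (modulo (d + 1ℚ) h₂ (solve 5 (λ d c g e y →
              c :* e
              := c :* ((d :+ con 1ℚ) :* (con 1ℚ :- y)) :+ con 1ℚ :* (e :* c :- (d :+ con 1ℚ) :* g)
                  :+ (d :+ con 1ℚ) :* (c :* y :- (c :- g))) refl d c g e y))
      c-spec : c * (F δ * (1ℚ + d + 2ℚ * λ′)) ≡ 2^ δ * 4ℚ * λ′ * (1ℚ + d + λ′) * A δ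
      c-spec = trans (cong (c *_) (sym (expand (⟨ (δ ℕ.+ 2 ℕ.* l) C δ ⟩ ⊗ (⟨ 1 ⟩ ⊕ ⟨ δ ⟩ ⊕ ⟨ 2 ⟩ ⊗ ⟨ l ⟩)))))
        (trans (/-cancel (+ (2 ℕ.^ (δ ℕ.+ 2) ℕ.* l ℕ.* (1 ℕ.+ δ ℕ.+ l) ℕ.* ((δ ℕ.+ l) C δ))) _)
        (trans (expand (⟨ 2 ℕ.^ (δ ℕ.+ 2) ⟩ ⊗ ⟨ l ⟩ ⊗ (⟨ 1 ⟩ ⊕ ⟨ δ ⟩ ⊕ ⟨ l ⟩) ⊗ ⟨ (δ ℕ.+ l) C δ ⟩))
          (cong (λ t → t * λ′ * (1ℚ + d + λ′) * A δ) (2^-+ 2))))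
      hc : c ≡ 4ℚ * λ′ * (1ℚ + d + λ′) * u δ
      hc = *-cancelˡ-≢0 (F δ * (1ℚ + d + 2ℚ * λ′)) (*-≢0 (F≢0 δ) M≢0)
        (l₁ d λ′ (2^ δ) (A δ) (F δ) c (u δ) c-spec (u-spec δ))
        where
        l₁ : ∀ d l t a b c u →
          c * (b * (1ℚ + d + 2ℚ * l)) ≡ t * 4ℚ * l * (1ℚ + d + l) * a →
          u * (b * (1ℚ + d + 2ℚ * l)) ≡ t * a →
          b * (1ℚ + d + 2ℚ * l) * c
          ≡ b * (1ℚ + d + 2ℚ * l) * (4ℚ * l * (1ℚ + d + l) * u)
        l₁ d l t a b c u h₁ h₂ =
          modulo 1ℚ h₁ (modulo (- (4ℚ * l * (1ℚ + d + l))) h₂ (solve 7 (λ d l t a b c u →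
              b :* (con 1ℚ :+ d :+ con 2ℚ :* l) :* c
              := b :* (con 1ℚ :+ d :+ con 2ℚ :* l) :* (con 4ℚ :* l :* (con 1ℚ :+ d :+ l) :* u)
                  :+ con 1ℚ :* (c :* (b :* (con 1ℚ :+ d :+ con 2ℚ :* l)) :- t :* con 4ℚ :* l :*
                      (con 1ℚ :+ d :+ l) :* a)
                          :+ (:- (con 4ℚ :* l :* (con 1ℚ :+ d :+ l))) :*
                              (u :* (b :* (con 1ℚ :+ d :+ con 2ℚ :* l)) :- t :* a)) refl d l t a b c u))
      hk : k ≡ 2ℚ * (d + 1ℚ) * λ′
      hk = expand (⟨ 2 ⟩ ⊗ (⟨ δ ⟩ ⊕ ⟨ 1 ⟩) ⊗ ⟨ l ⟩)
      g₃-spec : g₃ * (1ℚ + 2ℚ * λ′) ≡ d + 1ℚ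
      g₃-spec = trans (cong (g₃ *_) (sym (expand (⟨ 1 ⟩ ⊕ ⟨ 2 ⟩ ⊗ ⟨ l ⟩))))
          (trans (/-cancel (+ (δ ℕ.+ 1)) _) (expand (⟨ δ ⟩ ⊕ ⟨ 1 ⟩)))
      G₁-spec : G₁ * (C₀ * (1ℚ + 2ℚ * λ′)) ≡ G * (d + 1ℚ)
      G₁-spec = trans (cong (G₁ *_) (sym (expand (⟨ (2 ℕ.* l) C l ⟩ ⊗ (⟨ 1 ⟩ ⊕ ⟨ 2 ⟩ ⊗ ⟨ l ⟩)))))
        (trans (/-cancel (+ (2 ℕ.^ (2 ℕ.* l) ℕ.* (δ ℕ.+ 1))) _)
            (expand (⟨ 2 ℕ.^ (2 ℕ.* l) ⟩ ⊗ (⟨ δ ⟩ ⊕ ⟨ 1 ⟩))))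
      hG : G₁ ≡ g₃ * (1ℚ - y₀)
      hG = *-cancelˡ-≢0 (C₀ * (1ℚ + 2ℚ * λ′)) (*-≢0 C₀≢0 L≢0)
        (l₁ d λ′ C₀ G G₁ g₃ y₀ G₁-spec g₃-spec hy)
        where
        l₁ : ∀ d l c g G₁ g₃ y →
          G₁ * (c * (1ℚ + 2ℚ * l)) ≡ g * (d + 1ℚ) →
          g₃ * (1ℚ + 2ℚ * l) ≡ (d + 1ℚ) →
          c * y ≡ (c - g) →
          c * (1ℚ + 2ℚ * l) * G₁
          ≡ c * (1ℚ + 2ℚ * l) * (g₃ * (1ℚ - y))
        l₁ d l c g G₁ g₃ y h₁ h₂ h₃ =
          modulo 1ℚ h₁ (modulo (- g) h₂ (modulo (g₃ * (1ℚ + 2ℚ * l)) h₃ (solve 7 (λ d l c g G₁ g₃ y →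
              c :* (con 1ℚ :+ con 2ℚ :* l) :* G₁
              := c :* (con 1ℚ :+ con 2ℚ :* l) :* (g₃ :* (con 1ℚ :- y))
                  :+ con 1ℚ :* (G₁ :* (c :* (con 1ℚ :+ con 2ℚ :* l)) :- g :* (d :+ con 1ℚ))
                      :+ (:- g) :* (g₃ :* (con 1ℚ :+ con 2ℚ :* l) :- (d :+ con 1ℚ))
                          :+ (g₃ :* (con 1ℚ :+ con 2ℚ :* l)) :* (c :* y :- (c :- g))) refl d l c g G₁ g₃ y)))
      g-spec : g * (F δ * C₀ * (1ℚ + d + 2ℚ * λ′)) ≡ 2^ δ * 2ℚ * (1ℚ + d + λ′) * A δ
      g-spec = trans (cong (g *_)
          (sym (expand (⟨ (δ ℕ.+ 2 ℕ.* l) C δ ⟩ ⊗ ⟨ (2 ℕ.* l) C l ⟩ ⊗ (⟨ 1 ⟩ ⊕ ⟨ δ ⟩ ⊕ ⟨ 2 ⟩ ⊗ ⟨ l ⟩)))))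
        (trans (/-cancel (+ (2 ℕ.^ (δ ℕ.+ 1) ℕ.* (1 ℕ.+ δ ℕ.+ l) ℕ.* ((δ ℕ.+ l) C δ))) _)
        (trans (expand (⟨ 2 ℕ.^ (δ ℕ.+ 1) ⟩ ⊗ (⟨ 1 ⟩ ⊕ ⟨ δ ⟩ ⊕ ⟨ l ⟩) ⊗ ⟨ (δ ℕ.+ l) C δ ⟩))
          (cong (λ t → t * (1ℚ + d + λ′) * A δ) (2^-+ 1))))
      hg : gG ≡ 2ℚ * (1ℚ + d + λ′) * u δ * y₀
      hg = *-cancelˡ-≢0 (F δ * (1ℚ + d + 2ℚ * λ′)) (*-≢0 (F≢0 δ) M≢0)
        (l₁ d λ′ (2^ δ) (A δ) (F δ) C₀ G g (u δ) y₀ g-spec hy (u-spec δ))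
        where
        l₁ : ∀ d l t a b c G g u y →
          g * (b * c * (1ℚ + d + 2ℚ * l)) ≡ t * 2ℚ * (1ℚ + d + l) * a →
          c * y ≡ (c - G) →
          u * (b * (1ℚ + d + 2ℚ * l)) ≡ t * a →
          b * (1ℚ + d + 2ℚ * l) * (g * (- G + c))
          ≡ b * (1ℚ + d + 2ℚ * l) * (2ℚ * (1ℚ + d + l) * u * y)
        l₁ d l t a b c G g u y h₁ h₂ h₃ =
          modulo y h₁ (modulo (- (g * b * (1ℚ + d + 2ℚ * l))) h₂
              (modulo (- (2ℚ * (1ℚ + d + l) * y)) h₃ (solve 10 (λ d l t a b c G g u y →
              b :* (con 1ℚ :+ d :+ con 2ℚ :* l) :* (g :* (:- G :+ c))
              := b :* (con 1ℚ :+ d :+ con 2ℚ :* l) :* (con 2ℚ :* (con 1ℚ :+ d :+ l) :* u :* y)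
                  :+ y :* (g :* (b :* c :* (con 1ℚ :+ d :+ con 2ℚ :* l)) :- t :* con 2ℚ :* (con 1ℚ :+ d :+ l)
                      :* a) :+ (:- (g :* b :* (con 1ℚ :+ d :+ con 2ℚ :* l))) :* (c :* y :- (c :- G))
                          :+ (:- (con 2ℚ :* (con 1ℚ :+ d :+ l) :* y)) :*
                              (u :* (b :* (con 1ℚ :+ d :+ con 2ℚ :* l)) :- t :* a)) refl d l t a b c G g u y)))
      hg₃ : g₃ ≡ (d + 1ℚ) * u 0
      hg₃ = *-cancelˡ-≢0 (1ℚ + 2ℚ * λ′) L≢0 (l₁ d λ′ g₃ (u 0) g₃-spec (u-spec 0))
        where
        l₁ : ∀ d l g u →
          g * (1ℚ + 2ℚ * l) ≡ (d + 1ℚ) →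
          u * (1ℚ * (1ℚ + 0ℚ + 2ℚ * l)) ≡ 1ℚ * 1ℚ →
          (1ℚ + 2ℚ * l) * g
          ≡ (1ℚ + 2ℚ * l) * ((d + 1ℚ) * u)
        l₁ d l g u h₁ h₂ =
          modulo 1ℚ h₁ (modulo (- (d + 1ℚ)) h₂ (solve 4 (λ d l g u →
              (con 1ℚ :+ con 2ℚ :* l) :* g
              := (con 1ℚ :+ con 2ℚ :* l) :* ((d :+ con 1ℚ) :* u)
                  :+ con 1ℚ :* (g :* (con 1ℚ :+ con 2ℚ :* l) :- (d :+ con 1ℚ))
                      :+ (:- (d :+ con 1ℚ)) :*
                          (u :* (con 1ℚ :* (con 1ℚ :+ con 0ℚ :+ con 2ℚ :* l)) :- con 1ℚ :* con 1ℚ)) refl d l g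
                              u))
      hs : qs l δ ≡ u 0 * y₀ + (2ℚ * λ′ * W + y₀ * X)
      hs = cong₂ _+_ (trans (q-u 0) (l₁ λ′ (u 0) y₀)) (∑q δ)
        where
        l₁ : ∀ l u y → u * (2ℚ * l * 0ℚ + y) ≡ u * y
        l₁ = solve 3 (λ l u y →
            u :* (con 2ℚ :* l :* con 0ℚ :+ y)
            := u :* y) refl
      lem : ∀ z₁ z₂ λ₁ l d E X c S k W G₁ gG g₃ D₁ h₀ h₁ h₂ h₃ y₀ u u₀ q qs →
        z₁ ≡ ¼ * (λ₁ * (λ₁ + (- 1ℚ))) →
        z₂ ≡ ¼ * (l * (l + (- 3ℚ))) →
        λ₁ ≡ (l + d) →
        E ≡ (d + 1ℚ) * (1ℚ - y₀) →
        c ≡ 4ℚ * l * (1ℚ + d + l) * u →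
        k ≡ 2ℚ * (d + 1ℚ) * l →
        G₁ ≡ g₃ * (1ℚ - y₀) →
        gG ≡ 2ℚ * (1ℚ + d + l) * u * y₀ →
        g₃ ≡ (d + 1ℚ) * u₀ →
        D₁ ≡ (d + 1ℚ) →
        q ≡ u * (2ℚ * l * S + y₀) →
        qs ≡ (u₀ * y₀ + (2ℚ * l * W + y₀ * X)) →
        z₁ + z₂ - 2ℚ * ((- 1ℚ - d + E) * X + c * S - k * W + G₁ + gG - g₃ + D₁ * h₀
            + ½ * D₁ * h₁ - D₁ * h₂ - D₁ * h₃)
        ≡ ¼ * ((l + d) * ((l + d) - 1ℚ))
            + ¼ * (l * (l - 3ℚ)) - 2ℚ *
                (2ℚ * (l + d + 1ℚ) * q - (d + 1ℚ) * qs + (d + 1ℚ) * (h₀ + ½ * h₁ - h₂ - h₃))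
      lem z₁ z₂ λ₁ l d E X c S k W G₁ gG g₃ D₁ h₀ h₁ h₂ h₃ y₀ u u₀ q qs e₁ e₂ e₃ e₄ e₅ e₆ e₇ e₈ e₉ e₁₀ e₁₁ e₁₂ =
        modulo 1ℚ e₁ (modulo 1ℚ e₂
            -- `λ₁` enters quadratically, so its cofactor contains `λ₁` again.
            (modulo (2ℚ * ¼ * (l + d) + ¼ * (λ₁ - (l + d)) - ¼) e₃
                (modulo (- (2ℚ * X)) e₄ (modulo (- (2ℚ * S)) e₅
                    (modulo (2ℚ * W) e₆ (modulo (- 2ℚ) e₇
                        (modulo (- 2ℚ) e₈ (modulo (2ℚ * y₀) e₉
                            (modulo (- (2ℚ * (h₀ + ½ * h₁ - h₂ - h₃))) e₁₀
                                (modulo (4ℚ * (l + d + 1ℚ)) e₁₁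
                                    (modulo (- (2ℚ * (d + 1ℚ))) e₁₂
                                        (solve 24 (λ z₁ z₂ λ₁ l d E X c S k W G₁ gG g₃ D₁ h₀ h₁ h₂ h₃ y₀ u u₀
                                            q qs →
            z₁ :+ z₂ :- con 2ℚ :* ((:- con 1ℚ :- d :+ E) :* X :+ c :* S :- k :* W :+ G₁ :+ gG :- g₃
                :+ D₁ :* h₀ :+ con ½ :* D₁ :* h₁ :- D₁ :* h₂ :- D₁ :* h₃)
            := con ¼ :* ((l :+ d) :* ((l :+ d) :- con 1ℚ))
                :+ con ¼ :* (l :* (l :- con 3ℚ)) :- con 2ℚ :*
                    (con 2ℚ :* (l :+ d :+ con 1ℚ) :* q :- (d :+ con 1ℚ) :* qs
                        :+ (d :+ con 1ℚ) :* (h₀ :+ con ½ :* h₁ :- h₂ :- h₃))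
                            :+ con 1ℚ :* (z₁ :- con ¼ :* (λ₁ :* (λ₁ :+ (:- con 1ℚ))))
                                :+ con 1ℚ :* (z₂ :- con ¼ :* (l :* (l :+ (:- con 3ℚ))))
                                    :+ (con 2ℚ :* con ¼ :* (l :+ d) :+ con ¼ :* (λ₁ :- (l :+ d)) :- con ¼) :*
                                        (λ₁ :- (l :+ d)) :+ (:- (con 2ℚ :* X)) :*
                                            (E :- (d :+ con 1ℚ) :* (con 1ℚ :- y₀))
                                                :+ (:- (con 2ℚ :* S)) :*
                                                    (c :- con 4ℚ :* l :* (con 1ℚ :+ d :+ l) :* u)
                                                        :+ (con 2ℚ :* W) :* (k :- con 2ℚ :* (d :+ con 1ℚ) :*
                                                            l) :+ (:- con 2ℚ) :* (G₁ :- g₃ :* (con 1ℚ :- y₀))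
                                                                :+ (:- con 2ℚ) :* (gG :- con 2ℚ :*
                                                                    (con 1ℚ :+ d :+ l) :* u :* y₀)
                                                                        :+ (con 2ℚ :* y₀) :* (g₃ :-
                                                                            (d :+ con 1ℚ) :* u₀) :+ (:-
                                                                                (con 2ℚ :* (h₀ :+ con ½ :* h₁
                                                                                    :- h₂ :- h₃))) :* (D₁ :-
                                                                                        (d :+ con 1ℚ)) :+ (con 4ℚ :* (l :+ d :+ con 1ℚ)) :* (q :- u :* (con 2ℚ :* l :* S :+ y₀)) :+ (:- (con 2ℚ :* (d :+ con 1ℚ))) :* (qs :- (u₀ :* y₀ :+ (con 2ℚ :* l :* W :+ y₀ :* X)))) refl z₁ z₂ λ₁ l d E X c S k W G₁ gG g₃ D₁ h₀ h₁ h₂ h₃ y₀ u u₀ q qs))))))))))))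

-- The sliding procedure on two lists, and its effect on words.

module Insertion where

  open BallotWords
  open BallotCounts using (closeCost)
  open import Data.Bool using (Bool; true; false; if_then_else_)
  open import Data.Nat
  open import Data.Nat.Properties
  open import Data.List using (List; []; _∷_; length; _++_; _ʳ++_; _∷ʳ_; map; reverse)
  open import Data.List.Properties using (++-assoc; reverse-involutive; length-reverse; map-∘; length-++)
  open import Data.List.Relation.Unary.All as All using (All; []; _∷_)
  import Data.List.Relation.Unary.All.Properties as All
  open import Data.Maybe using (Maybe; just; nothing)
  import Data.Maybe as Maybe
  open import Data.Product as × using (_×_; _,_; proj₁; proj₂; map₁; map₂)
  open import Function using (_∘_)
  open import Relation.Binary.PropositionalEquality
  open import Relation.Nullary

  Rows : Set
  Rows = List ℕ × List ℕ

  insertRow : ℕ → List ℕ → List ℕ × ℕ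
  insertRow k []       = k ∷ [] , 0
  insertRow k (x ∷ xs) with x <? k
  ... | yes _ = map₁ (x ∷_) (map₂ suc (insertRow k xs))
  ... | no  _ = k ∷ x ∷ xs , 0

  -- The entry `k` sits to the left of `xs` and above the head of `ys`, so `xs` starts one column
  -- further right than `ys`. A move to the right brings `x` one column to the left and leaves `y`
  -- in place; a move down lifts `y`, and from then on only the lower row is concerned.
  insertTop : ℕ → List ℕ → List ℕ → Rows × ℕ
  insertTop k []       []       = (k ∷ [] , []) , 0
  insertTop k (x ∷ xs) []       with x <? k
  ... | yes _ = map₁ (map₁ (x ∷_)) (map₂ suc (insertTop k xs []))
  ... | no  _ = (k ∷ x ∷ xs , []) , 0
  insertTop k []       (y ∷ ys) with y <? k
  ... | yes _ = map₁ (y ∷ [] ,_) (map₂ suc (insertRow k ys))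
  ... | no  _ = (k ∷ [] , y ∷ ys) , 0
  insertTop k (x ∷ xs) (y ∷ ys) with x <? y | x <? k | y <? k
  ... | yes _ | yes _ | _     = map₁ (×.map (x ∷_) (y ∷_)) (map₂ suc (insertTop k xs ys))
  ... | yes _ | no  _ | _     = (k ∷ x ∷ xs , y ∷ ys) , 0
  ... | no  _ | _     | yes _ = map₁ (y ∷ x ∷ xs ,_) (map₂ suc (insertRow k ys))
  ... | no  _ | _     | no  _ = (k ∷ x ∷ xs , y ∷ ys) , 0

  -- The rows of a block whose entries are `g 0`, `g 1`, ... in increasing order, the word being
  -- read from the smallest entry on.
  tops bottoms : (ℕ → ℕ) → Word → List ℕ
  tops g []      = []
  tops g (U ∷ w) = g 0 ∷ tops (g ∘ suc) w
  tops g (D ∷ w) = tops (g ∘ suc) w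
  bottoms g []      = []
  bottoms g (U ∷ w) = bottoms (g ∘ suc) w
  bottoms g (D ∷ w) = g 0 ∷ bottoms (g ∘ suc) w

  insD→ : ℕ → Word → Word
  insD→ zero    w       = D ∷ w
  insD→ (suc k) []      = D ∷ []
  insD→ (suc k) (x ∷ w) = x ∷ insD→ k w

  costD→ : ℕ → Word → ℕ
  costD→ zero    w       = 0
  costD→ (suc k) []      = 0
  costD→ (suc k) (U ∷ w) = costD→ k w
  costD→ (suc k) (D ∷ w) = suc (costD→ k w)

  -- Here words are read from the smallest entry on, and h is the height reached so far.
  insU→ : ℕ → ℕ → Word → Word
  insU→ h       zero    w       = U ∷ w
  insU→ h       (suc k) []      = U ∷ []
  insU→ h       (suc k) (U ∷ w) = U ∷ insU→ (suc h) k w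
  insU→ (suc h) (suc k) (D ∷ w) = D ∷ insU→ h k w
  insU→ zero    (suc k) (D ∷ w) = U ∷ insD→ k w

  -- Every upper entry passed costs one exchange. At positive height a lower entry is free: its
  -- column is passed by exchanging with an upper entry already counted. At height 0 it is smaller
  -- than all upper entries to come, so the new entry is exchanged with it and continues in the
  -- lower row.
  costU→ : ℕ → ℕ → Word → ℕ
  costU→ h       zero    w       = 0
  costU→ h       (suc k) []      = 0
  costU→ h       (suc k) (U ∷ w) = suc (costU→ (suc h) k w)
  costU→ (suc h) (suc k) (D ∷ w) = costU→ h k w
  costU→ zero    (suc k) (D ∷ w) = suc (costD→ k w)

  -- The increasing enumeration of all numbers except `i`, so `g ∘ punch k` enumerates the entries
  -- other than the new one, `g k`.
  punch : ℕ → ℕ → ℕ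
  punch zero    j       = suc j
  punch (suc i) zero    = zero
  punch (suc i) (suc j) = suc (punch i j)

  Increasing : (ℕ → ℕ) → Set
  Increasing g = ∀ {i j} → i < j → g i < g j

  punch-increasing : ∀ i → Increasing (punch i)
  punch-increasing zero    lt = s≤s lt
  punch-increasing (suc i) {zero}  {suc j} lt = z<s
  punch-increasing (suc i) {suc _} {suc _} (s≤s lt) = s≤s (punch-increasing i lt)

  ∘-increasing : ∀ {g f} → Increasing g → Increasing f → Increasing (g ∘ f)
  ∘-increasing g↑ f↑ lt = g↑ (f↑ lt)

  suc-increasing : ∀ {g} → Increasing g → Increasing (g ∘ suc)
  suc-increasing g↑ lt = g↑ (s≤s lt)

  tops-above : ∀ {g k} w → (∀ j → k < g j) → All (k <_) (tops g w)
  tops-above []      gt = []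
  tops-above (U ∷ w) gt = gt 0 ∷ tops-above w (gt ∘ suc)
  tops-above (D ∷ w) gt = tops-above w (gt ∘ suc)

  bottoms-above : ∀ {g k} w → (∀ j → k < g j) → All (k <_) (bottoms g w)
  bottoms-above []      gt = []
  bottoms-above (U ∷ w) gt = bottoms-above w (gt ∘ suc)
  bottoms-above (D ∷ w) gt = gt 0 ∷ bottoms-above w (gt ∘ suc)

  insertRow-front : ∀ {k xs} → All (k <_) xs → insertRow k xs ≡ (k ∷ xs , 0)
  insertRow-front []             = refl
  insertRow-front {k} {x ∷ xs} (k<x ∷ _) with x <? k
  ... | yes x<k = contradiction x<k (<-asym k<x)
  ... | no  _   = refl

  insertRow-bottoms : ∀ {g} → Increasing g → ∀ k w → k ≤ length w →
    insertRow (g k) (bottoms (g ∘ punch k) w) ≡ (bottoms g (insD→ k w) , costD→ k w)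
  insertRow-bottoms g↑ zero    w       le = insertRow-front (bottoms-above w λ j → g↑ z<s)
  insertRow-bottoms g↑ (suc k) (U ∷ w) (s≤s le) = insertRow-bottoms (suc-increasing g↑) k w le
  insertRow-bottoms {g} g↑ (suc k) (D ∷ w) (s≤s le) with g 0 <? g (suc k)
  ... | yes _ = cong (λ { (r , c) → g 0 ∷ r , suc c }) (insertRow-bottoms (suc-increasing g↑) k w le)
  ... | no ≮  = contradiction (g↑ z<s) ≮

  tops-insD : ∀ g k w → k ≤ length w → tops g (insD→ k w) ≡ tops (g ∘ punch k) w
  tops-insD g zero    w       le       = refl
  tops-insD g (suc k) (U ∷ w) (s≤s le) = cong (g 0 ∷_) (tops-insD (g ∘ suc) k w le)
  tops-insD g (suc k) (D ∷ w) (s≤s le) = tops-insD (g ∘ suc) k w le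

  insertTop-stop : ∀ {k xs ys} → All (k <_) xs → All (k <_) ys → insertTop k xs ys ≡ ((k ∷ xs , ys) , 0)
  insertTop-stop [] [] = refl
  insertTop-stop {k} {x ∷ xs} (k<x ∷ _) [] with x <? k
  ... | yes x<k = contradiction x<k (<-asym k<x)
  ... | no  _   = refl
  insertTop-stop {k} {[]} {y ∷ ys} [] (k<y ∷ _) with y <? k
  ... | yes y<k = contradiction y<k (<-asym k<y)
  ... | no  _   = refl
  insertTop-stop {k} {x ∷ xs} {y ∷ ys} (k<x ∷ _) (k<y ∷ _) with x <? y | x <? k | y <? k
  ... | yes _ | yes x<k | _       = contradiction x<k (<-asym k<x)
  ... | yes _ | no  _   | _       = refl
  ... | no  _ | _       | yes y<k = contradiction y<k (<-asym k<y)
  ... | no  _ | _       | no  _   = refl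

  insertTop-pass : ∀ {k x xs y ys} → x < y → x < k →
    insertTop k (x ∷ xs) (y ∷ ys) ≡ map₁ (×.map (x ∷_) (y ∷_)) (map₂ suc (insertTop k xs ys))
  insertTop-pass {k} {x} {y = y} x<y x<k with x <? y | x <? k | y <? k
  ... | yes _ | yes _ | _ = refl
  ... | yes _ | no ≮  | _ = contradiction x<k ≮
  ... | no ≮  | _     | _ = contradiction x<y ≮

  insertTop-descend : ∀ {k xs y ys} → All (y <_) xs → y < k →
    insertTop k xs (y ∷ ys) ≡ map₁ (y ∷ xs ,_) (map₂ suc (insertRow k ys))
  insertTop-descend {k} {[]} {y} [] y<k with y <? k
  ... | yes _ = refl
  ... | no ≮  = contradiction y<k ≮
  insertTop-descend {k} {x ∷ xs} {y} (y<x ∷ _) y<k with x <? y | x <? k | y <? k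
  ... | yes x<y | _ | _     = contradiction x<y (<-asym y<x)
  ... | no  _   | _ | yes _ = refl
  ... | no  _   | _ | no ≮  = contradiction y<k ≮

  -- All entries beyond the queue exceed `k`, in particular those of the lower row, so the entry
  -- moves right past exactly the queue.
  insertTop-queue : ∀ {k} q {xs ys} → All (_< k) q → All (k <_) xs → All (k <_) ys →
    insertTop k (q ++ xs) ys ≡ ((q ++ k ∷ xs , ys) , length q)
  insertTop-queue []      _           k<xs k<ys = insertTop-stop k<xs k<ys
  insertTop-queue {k} (x ∷ q) (x<k ∷ q<k) k<xs [] with x <? k
  ... | yes _ = cong (λ { ((r , s) , c) → (x ∷ r , s) , suc c }) (insertTop-queue q q<k k<xs [])
  ... | no ≮  = contradiction x<k ≮
  insertTop-queue {k} (x ∷ q) (x<k ∷ q<k) k<xs (k<y ∷ k<ys) = trans (insertTop-pass (<-trans x<k k<y) x<k)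
    (cong (λ { ((r , s) , c) → (x ∷ r , _ ∷ s) , suc c }) (insertTop-queue q q<k k<xs k<ys))

  ∷ʳ-++ : ∀ (q : List ℕ) x xs → q ++ x ∷ xs ≡ (q ∷ʳ x) ++ xs
  ∷ʳ-++ q x xs = sym (++-assoc q (x ∷ []) xs)

  -- The queue q consists of the passed entries of the upper row whose columns have
  -- not yet been passed in the lower row.
  insertTop-tops : ∀ {g} → Increasing g → ∀ q → All (_< g 0) q → ∀ k w → k ≤ length w →
    insertTop (g k) (q ++ tops (g ∘ punch k) w) (bottoms (g ∘ punch k) w)
    ≡ ((q ++ tops g (insU→ (length q) k w) , bottoms g (insU→ (length q) k w)) , length q
        + costU→ (length q) k w)
  insertTop-tops {g} g↑ q q< zero w le = trans
    (insertTop-queue q q< (tops-above w λ j → g↑ z<s) (bottoms-above w λ j → g↑ z<s))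
    (cong ((q ++ g 0 ∷ tops (g ∘ suc) w , bottoms (g ∘ suc) w) ,_) (sym (+-identityʳ (length q))))
  insertTop-tops {g} g↑ q q< (suc k) (U ∷ w) (s≤s le) = begin
    insertTop (g (suc k)) (q ++ g 0 ∷ t) b ≡⟨ cong (λ xs → insertTop (g (suc k)) xs b) (∷ʳ-++ q (g 0) t) ⟩
    insertTop (g (suc k)) ((q ∷ʳ g 0) ++ t) b
      ≡⟨ insertTop-tops (suc-increasing g↑) (q ∷ʳ g 0)
          (All.∷ʳ⁺ (All.map (λ lt → <-trans lt (g↑ z<s)) q<) (g↑ z<s)) k w le ⟩
    (((q ∷ʳ g 0) ++ tops (g ∘ suc) (insU→ (length (q ∷ʳ g 0)) k w) , bottoms (g ∘ suc)
        (insU→ (length (q ∷ʳ g 0)) k w))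
      , length (q ∷ʳ g 0) + costU→ (length (q ∷ʳ g 0)) k w)
      ≡⟨ cong (λ n → (((q ∷ʳ g 0) ++ tops (g ∘ suc) (insU→ n k w) , bottoms (g ∘ suc) (insU→ n k w)) , n
          + costU→ n k w))
           (trans (length-++ q) (+-comm (length q) 1)) ⟩
    (((q ∷ʳ g 0) ++ tops (g ∘ suc) (insU→ (suc (length q)) k w) , bottoms (g ∘ suc)
        (insU→ (suc (length q)) k w))
      , suc (length q) + costU→ (suc (length q)) k w)
      ≡⟨ cong₂ (λ xs c → (xs , bottoms (g ∘ suc) (insU→ (suc (length q)) k w)) , c) (sym (∷ʳ-++ q (g 0) _))
          (sym (+-suc (length q) _)) ⟩
    ((q ++ g 0 ∷ tops (g ∘ suc) (insU→ (suc (length q)) k w) , bottoms (g ∘ suc) (insU→ (suc (length q)) k w))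
      , length q + suc (costU→ (suc (length q)) k w)) ∎
    where
    open ≡-Reasoning
    t b : List ℕ
    t = tops (g ∘ suc ∘ punch k) w
    b = bottoms (g ∘ suc ∘ punch k) w
  insertTop-tops {g} g↑ (x ∷ q) (x< ∷ q<) (suc k) (D ∷ w) (s≤s le) = trans
      (insertTop-pass x< (<-trans x< (g↑ z<s)))
    (cong (λ { ((r , s) , c) → (x ∷ r , g 0 ∷ s) , suc c })
      (insertTop-tops (suc-increasing g↑) q (All.map (λ lt → <-trans lt (g↑ z<s)) q<) k w le))
  insertTop-tops {g} g↑ [] [] (suc k) (D ∷ w) (s≤s le) = trans
    (insertTop-descend (tops-above w λ j → g↑ z<s) (g↑ z<s))
    (trans (cong (λ { (r , c) → (g 0 ∷ tops (g ∘ suc ∘ punch k) w , r) , suc c })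
        (insertRow-bottoms (suc-increasing g↑) k w le))
      (cong (λ t → (g 0 ∷ t , bottoms (g ∘ suc) (insD→ k w)) , suc (costD→ k w))
          (sym (tops-insD (g ∘ suc) k w le))))

  -- Position k means above the k smallest entries.
  insAt : (Word → Word) → ℕ → Word → Word
  insAt f k []      = f []
  insAt f k (x ∷ r) = if k ≤ᵇ length r then x ∷ insAt f k r else f (x ∷ r)

  costAt : (Word → ℕ) → ℕ → Word → ℕ
  costAt c k []      = c []
  costAt c k (x ∷ r) = if k ≤ᵇ length r then costAt c k r else c (x ∷ r)

  ≤ᵇ-true : ∀ {m n} → m ≤ n → (m ≤ᵇ n) ≡ true
  ≤ᵇ-true {m} {n} le with m ≤ᵇ n | ≤⇒≤ᵇ le
  ... | true | _ = refl

  ≤ᵇ-false : ∀ n → (suc n ≤ᵇ n) ≡ false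
  ≤ᵇ-false n with suc n ≤ᵇ n in eq
  ... | false = refl
  ... | true  = contradiction (≤ᵇ⇒≤ (suc n) n (subst Data.Bool.T (sym eq) _)) 1+n≰n

  insAt-below : ∀ f k x r → k ≤ length r → insAt f k (x ∷ r) ≡ x ∷ insAt f k r
  insAt-below f k x r le rewrite ≤ᵇ-true le = refl

  costAt-below : ∀ c k x r → k ≤ length r → costAt c k (x ∷ r) ≡ costAt c k r
  costAt-below c k x r le rewrite ≤ᵇ-true le = refl

  insAt-top : ∀ f r → insAt f (length r) r ≡ f r
  insAt-top f []      = refl
  insAt-top f (x ∷ r) rewrite ≤ᵇ-false (length r) = refl

  costAt-top : ∀ c r → costAt c (length r) r ≡ c r
  costAt-top c []      = refl
  costAt-top c (x ∷ r) rewrite ≤ᵇ-false (length r) = refl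

  insAt-ʳ++ : ∀ f k w r → k ≤ length r → insAt f k (w ʳ++ r) ≡ w ʳ++ insAt f k r
  insAt-ʳ++ f k []      r le = refl
  insAt-ʳ++ f k (x ∷ w) r le = trans (insAt-ʳ++ f k w (x ∷ r) (m≤n⇒m≤1+n le))
      (cong (w ʳ++_) (insAt-below f k x r le))

  costAt-ʳ++ : ∀ c k w r → k ≤ length r → costAt c k (w ʳ++ r) ≡ costAt c k r
  costAt-ʳ++ c k []      r le = refl
  costAt-ʳ++ c k (x ∷ w) r le = trans (costAt-ʳ++ c k w (x ∷ r) (m≤n⇒m≤1+n le)) (costAt-below c k x r le)

  insAt-prefix : ∀ f w r → insAt f (length r) (w ʳ++ r) ≡ w ʳ++ f r
  insAt-prefix f w r = trans (insAt-ʳ++ f (length r) w r ≤-refl) (cong (w ʳ++_) (insAt-top f r))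

  costAt-prefix : ∀ c w r → costAt c (length r) (w ʳ++ r) ≡ c r
  costAt-prefix c w r = trans (costAt-ʳ++ c (length r) w r ≤-refl) (costAt-top c r)

  -- The word is cut in two: `r` is the part already read, largest entry first, and `w` the rest,
  -- smallest entry first. This mediates between the two reading directions.
  insD-reversed : ∀ k w r → k ≤ length w → insAt (D ∷_) (length r + k) (w ʳ++ r) ≡ insD→ k w ʳ++ r
  insD-reversed zero    w       r le = trans (cong (λ k → insAt (D ∷_) k (w ʳ++ r)) (+-identityʳ (length r)))
      (insAt-prefix (D ∷_) w r)
  insD-reversed (suc k) (x ∷ w) r (s≤s le) = trans
      (cong (λ k → insAt (D ∷_) k (w ʳ++ (x ∷ r))) (+-suc (length r) k)) (insD-reversed k w (x ∷ r) le)

  costD-reversed : ∀ k w r → k ≤ length w → costAt #D (length r + k) (w ʳ++ r) ≡ #D r + costD→ k w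
  costD-reversed zero    w       r le = trans (cong (λ k → costAt #D k (w ʳ++ r)) (+-identityʳ (length r)))
    (trans (costAt-prefix #D w r) (sym (+-identityʳ (#D r))))
  costD-reversed (suc k) (U ∷ w) r (s≤s le) = trans
      (cong (λ k → costAt #D k (w ʳ++ (U ∷ r))) (+-suc (length r) k)) (costD-reversed k w (U ∷ r) le)
  costD-reversed (suc k) (D ∷ w) r (s≤s le) = trans
      (cong (λ k → costAt #D k (w ʳ++ (D ∷ r))) (+-suc (length r) k))
    (trans (costD-reversed k w (D ∷ r) le) (sym (+-suc (#D r) _)))

  height-invalid : ∀ x r → height r ≡ nothing → height (x ∷ r) ≡ nothing
  height-invalid U r e = cong (Maybe.map suc) e
  height-invalid D r e = cong descend e

  close-invalid : ∀ r → height r ≡ nothing → close r ≡ D ∷ flip r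
  close-invalid r e with height r
  close-invalid r refl | nothing = refl

  flip-invalid : ∀ x r → height r ≡ nothing → flip (x ∷ r) ≡ x ∷ flip r
  flip-invalid x r e with height r
  flip-invalid x r refl | nothing = refl

  closeCost-invalid : ∀ r → height r ≡ nothing → closeCost r ≡ #D r
  closeCost-invalid r e with height r
  closeCost-invalid r refl | nothing = refl

  closeCost-valid : ∀ r {h} → height r ≡ just h → closeCost r ≡ #U r
  closeCost-valid r e with height r
  closeCost-valid r refl | just _ = refl

  close-valid : ∀ r {h} → height r ≡ just h → close r ≡ U ∷ r
  close-valid r e with height r
  close-valid r refl | just _ = refl

  flip-valid : ∀ x r {h} → height r ≡ just h → flip (x ∷ r) ≡ U ∷ r
  flip-valid x r e with height r
  flip-valid x r refl | just _ = refl

  -- The situation after the path has reached -1: `flip` acts inside `r`, and the new entry behaves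
  -- like a `D` inserted into `w`.
  closed-reversed : ∀ k w r → k ≤ length w → height r ≡ nothing →
    insAt close (length r + k) (w ʳ++ r) ≡ insD→ k w ʳ++ flip r
    × costAt closeCost (length r + k) (w ʳ++ r) ≡ #D r + costD→ k w
  closed-reversed zero w r le e =
      trans (cong (λ k → insAt close k (w ʳ++ r)) (+-identityʳ (length r)))
          (trans (insAt-prefix close w r) (cong (w ʳ++_) (close-invalid r e)))
    , trans (cong (λ k → costAt closeCost k (w ʳ++ r)) (+-identityʳ (length r)))
        (trans (costAt-prefix closeCost w r) (trans (closeCost-invalid r e) (sym (+-identityʳ (#D r)))))
  closed-reversed (suc k) (x ∷ w) r (s≤s le) e = let i , c = closed-reversed k w (x ∷ r) le (height-invalid x r e) in
      trans (cong (λ k → insAt close k (w ʳ++ (x ∷ r))) (+-suc (length r) k))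
          (trans i (cong (insD→ k w ʳ++_) (flip-invalid x r e)))
    , trans (cong (λ k → costAt closeCost k (w ʳ++ (x ∷ r))) (+-suc (length r) k)) (trans c (cost x))
    where
    cost : ∀ x → #D (x ∷ r) + costD→ k w ≡ #D r + costD→ (suc k) (x ∷ w)
    cost U = refl
    cost D = sym (+-suc (#D r) _)

  -- The situation before the path reaches -1. At the first step below 0 the cost changes from
  -- counting `U` to counting `D`; both counts agree there, because `#U r ≡ #D r + h` with `h = 0`.
  open-reversed : ∀ k w r h → k ≤ length w → height r ≡ just h → #U r ≡ #D r + h →
    insAt close (length r + k) (w ʳ++ r) ≡ insU→ h k w ʳ++ r
    × costAt closeCost (length r + k) (w ʳ++ r) ≡ #U r + costU→ h k w
  open-reversed zero w r h le e b =
      trans (cong (λ k → insAt close k (w ʳ++ r)) (+-identityʳ (length r)))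
          (trans (insAt-prefix close w r) (cong (w ʳ++_) (close-valid r e)))
    , trans (cong (λ k → costAt closeCost k (w ʳ++ r)) (+-identityʳ (length r)))
        (trans (costAt-prefix closeCost w r) (trans (closeCost-valid r e) (sym (+-identityʳ (#U r)))))
  open-reversed (suc k) (U ∷ w) r h (s≤s le) e b =
    let i , c = open-reversed k w (U ∷ r) (suc h) le (cong (Maybe.map suc) e) (trans (cong suc b) (sym (+-suc (#D r) h))) in
      trans (cong (λ k → insAt close k (w ʳ++ (U ∷ r))) (+-suc (length r) k)) i
    , trans (cong (λ k → costAt closeCost k (w ʳ++ (U ∷ r))) (+-suc (length r) k))
        (trans c (sym (+-suc (#U r) _)))
  open-reversed (suc k) (D ∷ w) r (suc h) (s≤s le) e b =
    let i , c = open-reversed k w (D ∷ r) h le (cong descend e) (trans b (+-suc (#D r) h)) in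
      trans (cong (λ k → insAt close k (w ʳ++ (D ∷ r))) (+-suc (length r) k)) i
    , trans (cong (λ k → costAt closeCost k (w ʳ++ (D ∷ r))) (+-suc (length r) k)) c
  open-reversed (suc k) (D ∷ w) r zero (s≤s le) e b =
    let i , c = closed-reversed k w (D ∷ r) le (cong descend e) in
      trans (cong (λ k → insAt close k (w ʳ++ (D ∷ r))) (+-suc (length r) k))
          (trans i (cong (insD→ k w ʳ++_) (flip-valid D r e)))
    , trans (cong (λ k → costAt closeCost k (w ʳ++ (D ∷ r))) (+-suc (length r) k))
        (trans c (trans (cong (λ m → suc (m + costD→ k w)) (sym (trans b (+-identityʳ (#D r)))))
            (sym (+-suc (#U r) _))))

  insD-reverse : ∀ k r → k ≤ length r →
    insD→ k (reverse r) ≡ reverse (insAt (D ∷_) k r) × costAt #D k r ≡ costD→ k (reverse r)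
  insD-reverse k r le =
      trans (sym (reverse-involutive _))
          (cong reverse (trans (sym (insD-reversed k (reverse r) [] le′))
              (cong (insAt (D ∷_) k) (reverse-involutive r))))
    , trans (cong (costAt #D k) (sym (reverse-involutive r))) (costD-reversed k (reverse r) [] le′)
    where le′ = subst (k ≤_) (sym (length-reverse r)) le

  insU-reverse : ∀ k r → k ≤ length r →
    insU→ 0 k (reverse r) ≡ reverse (insAt close k r) × costAt closeCost k r ≡ costU→ 0 k (reverse r)
  insU-reverse k r le = let i , c = open-reversed k (reverse r) [] 0 le′ refl refl in
      trans (sym (reverse-involutive _))
          (cong reverse (trans (sym i) (cong (insAt close k) (reverse-involutive r))))
    , trans (cong (costAt closeCost k) (sym (reverse-involutive r))) c
    where le′ = subst (k ≤_) (sym (length-reverse r)) le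

  -- The cell processed last comes first.
  run : List Letter → List ℕ → Rows × ℕ
  run (U ∷ ks) (a ∷ as) = let (xs , ys) , c = run ks as; s , c′ = insertTop a xs ys in s , c′ + c
  run (D ∷ ks) (a ∷ as) = let (xs , ys) , c = run ks as; s , c′ = insertRow a ys in (xs , s) , c′ + c
  run _        _        = ([] , []) , 0

  -- In i ∷ c the number i is the rank of the first entry relative to the others.
  data Code : ℕ → List ℕ → Set where
    []  : Code 0 []
    _∷_ : ∀ {n i c} → i ≤ n → Code n c → Code (suc n) (i ∷ c)

  -- The permutation with this code in one-line notation: the first value is `i`, and the others are
  -- renumbered so as to avoid it.
  decode : List ℕ → List ℕ
  decode []      = []
  decode (i ∷ c) = i ∷ map (punch i) (decode c)

  wordOf : List Letter → List ℕ → Word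
  wordOf (U ∷ ks) (i ∷ c) = insAt close i (wordOf ks c)
  wordOf (D ∷ ks) (i ∷ c) = insAt (D ∷_) i (wordOf ks c)
  wordOf _        _       = []

  costOf : List Letter → List ℕ → ℕ
  costOf (U ∷ ks) (i ∷ c) = costAt closeCost i (wordOf ks c) + costOf ks c
  costOf (D ∷ ks) (i ∷ c) = costAt #D i (wordOf ks c) + costOf ks c
  costOf _        _       = 0

  length-flip : ∀ r → height r ≡ nothing → length (flip r) ≡ length r
  length-flip (x ∷ r) e with height r in e′
  ... | just _  = refl
  ... | nothing = cong suc (length-flip r e′)

  length-close : ∀ r → length (close r) ≡ suc (length r)
  length-close r with height r in e
  ... | just _  = refl
  ... | nothing = cong suc (length-flip r e)

  length-insAt : ∀ f → (∀ r → length (f r) ≡ suc (length r)) → ∀ k r → length (insAt f k r) ≡ suc (length r)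
  length-insAt f lf k []      = lf []
  length-insAt f lf k (x ∷ r) with k ≤ᵇ length r
  ... | true  = cong suc (length-insAt f lf k r)
  ... | false = lf (x ∷ r)

  length-wordOf : ∀ ks {c} → Code (length ks) c → length (wordOf ks c) ≡ length ks
  length-wordOf []       []       = refl
  length-wordOf (U ∷ ks) {i ∷ c} (_ ∷ cd) = trans (length-insAt close length-close i (wordOf ks c))
      (cong suc (length-wordOf ks cd))
  length-wordOf (D ∷ ks) {i ∷ c} (_ ∷ cd) = trans (length-insAt (D ∷_) (λ _ → refl) i (wordOf ks c))
      (cong suc (length-wordOf ks cd))

  -- An arbitrary increasing `g` is needed for the induction: without the first entry the others are
  -- no longer consecutive but values of `g ∘ punch i`.
  run-decode : ∀ ks {c} → Code (length ks) c → ∀ {g} → Increasing g →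
    run ks (map g (decode c)) ≡
        ((tops g (reverse (wordOf ks c)) , bottoms g (reverse (wordOf ks c))) , costOf ks c)
  run-decode [] [] g↑ = refl
  run-decode (U ∷ ks) {i ∷ c} (i≤ ∷ cd) {g} g↑
    rewrite sym (map-∘ {g = g} {f = punch i} (decode c))
          | run-decode ks cd (∘-increasing g↑ (punch-increasing i))
          | insertTop-tops g↑ [] [] i (reverse (wordOf ks c))
              (subst (i ≤_) (sym (trans (length-reverse (wordOf ks c)) (length-wordOf ks cd))) i≤)
          | proj₁ (insU-reverse i (wordOf ks c) (subst (i ≤_) (sym (length-wordOf ks cd)) i≤))
          | proj₂ (insU-reverse i (wordOf ks c) (subst (i ≤_) (sym (length-wordOf ks cd)) i≤)) = refl
  run-decode (D ∷ ks) {i ∷ c} (i≤ ∷ cd) {g} g↑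
    rewrite sym (map-∘ {g = g} {f = punch i} (decode c))
          | run-decode ks cd (∘-increasing g↑ (punch-increasing i))
          | insertRow-bottoms g↑ i (reverse (wordOf ks c))
              (subst (i ≤_) (sym (trans (length-reverse (wordOf ks c)) (length-wordOf ks cd))) i≤)
          | sym (tops-insD g i (reverse (wordOf ks c))
              (subst (i ≤_) (sym (trans (length-reverse (wordOf ks c)) (length-wordOf ks cd))) i≤))
          | proj₁ (insD-reverse i (wordOf ks c) (subst (i ≤_) (sym (length-wordOf ks cd)) i≤))
          | proj₂ (insD-reverse i (wordOf ks c) (subst (i ≤_) (sym (length-wordOf ks cd)) i≤)) = refl

-- Summation over all codes and the recursion of the total cost.

module Codes where

  open import Defs using (fromℕ)
  open BallotWords
  open RationalArithmetic
  open BallotCounts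
  open CostSums
  open ColumnRecurrence
  open Insertion
  open import Data.Bool using (true; false)
  open import Data.Sum using (inj₁; inj₂)
  open import Data.Nat
  open import Data.Nat.Properties
  open import Algebra.Properties.CommutativeSemigroup +-commutativeSemigroup using () renaming (interchange to +-interchange)
  open import Data.Nat.Tactic.RingSolver using (solve-∀)
  open import Data.Integer using () renaming (+_ to pos)
  open import Data.Rational as ℚ using (ℚ; 1ℚ; -_)
  import Data.Rational.Properties as ℚ
  open import Data.List using (List; []; _∷_; length; replicate)
  open import Data.List.Properties using (length-replicate)
  open import Function using (_∘_)
  open import Data.Rational.Solver
  open import Relation.Binary.PropositionalEquality
  open +-*-Solver using (solve; con; _:+_; _:*_; _:-_; :-_; _:=_)

  sumTo : ℕ → (ℕ → ℕ) → ℕ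
  sumTo zero    f = 0
  sumTo (suc n) f = f n + sumTo n f

  sumTo-cong : ∀ n {f g} → (∀ i → i < n → f i ≡ g i) → sumTo n f ≡ sumTo n g
  sumTo-cong zero    eq = refl
  sumTo-cong (suc n) eq = cong₂ _+_ (eq n ≤-refl) (sumTo-cong n λ i i<n → eq i (m≤n⇒m≤1+n i<n))

  sumTo-+ : ∀ n f g → sumTo n (λ i → f i + g i) ≡ sumTo n f + sumTo n g
  sumTo-+ zero    f g = refl
  sumTo-+ (suc n) f g = trans (cong (f n + g n +_) (sumTo-+ n f g)) (+-interchange (f n) _ _ _)

  sumTo-const : ∀ n c → sumTo n (λ _ → c) ≡ n * c
  sumTo-const zero    c = refl
  sumTo-const (suc n) c = cong (c +_) (sumTo-const n c)

  sumTo-triangle : ∀ n → 2 * sumTo (suc n) (λ i → i) ≡ n * suc n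
  sumTo-triangle zero    = refl
  sumTo-triangle (suc n) = trans (*-distribˡ-+ 2 (suc n) (sumTo (suc n) λ i → i))
    (trans (cong (2 * suc n +_) (sumTo-triangle n)) (lem n))
    where
    lem : ∀ n → 2 * suc n + n * suc n ≡ suc n * (2 + n)
    lem = solve-∀

  sumTo-insAt : ∀ f φ x r → sumTo (2 + length r) (λ k → φ (insAt f k (x ∷ r)))
    ≡ φ (f (x ∷ r)) + sumTo (suc (length r)) (λ k → φ (x ∷ insAt f k r))
  sumTo-insAt f φ x r = cong₂ _+_ (cong φ (insAt-top f (x ∷ r)))
    (sumTo-cong (suc (length r)) λ { k (s≤s k≤) → cong φ (insAt-below f k x r k≤) })

  sumTo-∑D : ∀ φ r → sumTo (suc (length r)) (λ k → φ (insAt (D ∷_) k r)) ≡ ∑D φ r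
  sumTo-∑D φ []      = +-identityʳ _
  sumTo-∑D φ (x ∷ r) = trans (sumTo-insAt (D ∷_) φ x r) (cong (φ (D ∷ x ∷ r) +_) (sumTo-∑D (φ ∘ (x ∷_)) r))

  sumTo-∑U : ∀ φ r → sumTo (suc (length r)) (λ k → φ (insAt close k r)) ≡ ∑U φ r
  sumTo-∑U φ []      = +-identityʳ _
  sumTo-∑U φ (x ∷ r) = trans (sumTo-insAt close φ x r) (cong (φ (close (x ∷ r)) +_) (sumTo-∑U (φ ∘ (x ∷_)) r))

  sumTo-∑P : ∀ c r → sumTo (suc (length r)) (λ k → costAt c k r) ≡ ∑P c r
  sumTo-∑P c []      = +-identityʳ _
  sumTo-∑P c (x ∷ r) = cong₂ _+_ (costAt-top c (x ∷ r))
    (trans (sumTo-cong (suc (length r)) λ { k (s≤s k≤) → costAt-below c k x r k≤ }) (sumTo-∑P c r))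

  sumCodes : ℕ → (List ℕ → ℕ) → ℕ
  sumCodes zero    Φ = Φ []
  sumCodes (suc n) Φ = sumCodes n λ c → sumTo (suc n) λ i → Φ (i ∷ c)

  sumCodes-cong : ∀ n {Φ Ψ} → (∀ {c} → Code n c → Φ c ≡ Ψ c) → sumCodes n Φ ≡ sumCodes n Ψ
  sumCodes-cong zero    eq = eq []
  sumCodes-cong (suc n) eq = sumCodes-cong n λ c → sumTo-cong (suc n) λ { i (s≤s i≤n) → eq (i≤n ∷ c) }

  sumCodes-+ : ∀ n Φ Ψ → sumCodes n (λ c → Φ c + Ψ c) ≡ sumCodes n Φ + sumCodes n Ψ
  sumCodes-+ zero    Φ Ψ = refl
  sumCodes-+ (suc n) Φ Ψ = trans
      (sumCodes-cong n λ {c} _ → sumTo-+ (suc n) (λ i → Φ (i ∷ c)) (λ i → Ψ (i ∷ c))) (sumCodes-+ n _ _)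

  sumTo-* : ∀ n a f → sumTo n (λ i → a * f i) ≡ a * sumTo n f
  sumTo-* zero    a f = sym (*-zeroʳ a)
  sumTo-* (suc n) a f = trans (cong (a * f n +_) (sumTo-* n a f)) (sym (*-distribˡ-+ a (f n) _))

  sumCodes-* : ∀ n a Φ → sumCodes n (λ c → a * Φ c) ≡ a * sumCodes n Φ
  sumCodes-* zero    a Φ = refl
  sumCodes-* (suc n) a Φ = trans (sumCodes-cong n λ {c} _ → sumTo-* (suc n) a (λ i → Φ (i ∷ c)))
      (sumCodes-* n a _)

  sumCodes-1 : ∀ n → sumCodes n (λ _ → 1) ≡ n !
  sumCodes-1 zero    = refl
  sumCodes-1 (suc n) = trans (sumCodes-cong n λ _ → sumTo-const (suc n) 1)
      (trans (sumCodes-* n (suc n) (λ _ → 1)) (cong (suc n *_) (sumCodes-1 n)))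

  -- The rows of the cells of the shape `(n + δ, n)` in increasing column-wise order.
  letters : ℕ → ℕ → List Letter
  letters zero    δ = replicate δ U
  letters (suc n) δ = U ∷ D ∷ letters n δ

  -- The product of the hook lengths of the shape `(n + δ, n)`.
  weight : ℕ → ℕ → ℕ
  weight zero    δ = δ !
  weight (suc n) δ = weight n δ * ((2 + n + δ) * suc n)

  height-Us : ∀ δ → Ballot 0 δ (replicate δ U)
  height-Us zero    = ballot refl refl refl
  height-Us (suc δ) = U-ballot (height-Us δ)

  insAt-Us : ∀ δ i → insAt close i (replicate δ U) ≡ replicate (suc δ) U
  insAt-Us zero    i = refl
  insAt-Us (suc δ) i with i ≤ᵇ length (replicate δ U)
  ... | true  = cong (U ∷_) (insAt-Us δ i)
  ... | false = close-ballot (height-Us (suc δ))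

  wordOf-Us : ∀ δ {c} → Code δ c → wordOf (replicate δ U) c ≡ replicate δ U
  wordOf-Us zero    []      = refl
  wordOf-Us (suc δ) {i ∷ c} (_ ∷ cd) = trans (cong (insAt close i) (wordOf-Us δ cd)) (insAt-Us δ i)

  V-Us : ∀ δ φ → V 0 δ φ ≡ φ (replicate δ U)
  V-Us zero    φ = refl
  V-Us (suc δ) φ = V-Us δ (φ ∘ (U ∷_))

  cells : ℕ → ℕ → ℕ
  cells n δ = length (letters n δ)

  -- A code for one more column adds two independent ranks, which amounts to `∑D` followed by `∑U`;
  -- then `column-insertions` applies.
  equidistribution : ∀ n δ φ → sumCodes (cells n δ) (φ ∘ wordOf (letters n δ)) ≡ weight n δ * V n δ φ
  equidistribution zero δ φ = begin
    sumCodes (length (replicate δ U)) (φ ∘ wordOf (replicate δ U))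
        ≡⟨ cong (λ k → sumCodes k (φ ∘ wordOf (replicate δ U))) (length-replicate δ) ⟩
    sumCodes δ (φ ∘ wordOf (replicate δ U))
        ≡⟨ sumCodes-cong δ (λ cd → trans (cong φ (wordOf-Us δ cd)) (sym (*-identityʳ _))) ⟩
    sumCodes δ (λ _ → φ (replicate δ U) * 1) ≡⟨ sumCodes-* δ (φ (replicate δ U)) (λ _ → 1) ⟩
    φ (replicate δ U) * sumCodes δ (λ _ → 1) ≡⟨ cong₂ _*_ (sym (V-Us δ φ)) (sumCodes-1 δ) ⟩
    V 0 δ φ * δ ! ≡⟨ *-comm (V 0 δ φ) (δ !) ⟩
    δ ! * V 0 δ φ ∎
    where open ≡-Reasoning
  equidistribution (suc n) δ φ = begin
    sumCodes (cells n δ) (λ c → sumTo (suc (cells n δ)) λ i → sumTo (2 + cells n δ) λ j →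
        φ (insAt close j (insAt (D ∷_) i (w c))))
      ≡⟨ sumCodes-cong (cells n δ) (λ {c} cd → slots c (length-wordOf (letters n δ) cd)) ⟩
    sumCodes (cells n δ) (λ c → ∑D (∑U φ) (w c)) ≡⟨ equidistribution n δ (∑D (∑U φ)) ⟩
    weight n δ * V n δ (∑D (∑U φ)) ≡⟨ cong (weight n δ *_) (column-insertions n δ φ) ⟩
    weight n δ * ((2 + n + δ) * suc n * V (suc n) δ φ) ≡⟨ sym (*-assoc (weight n δ) ((2 + n + δ) * suc n) _) ⟩
    weight (suc n) δ * V (suc n) δ φ ∎
    where
    open ≡-Reasoning
    w = wordOf (letters n δ)
    slots : ∀ c {N} → length (w c) ≡ N →
      sumTo (suc N) (λ i → sumTo (2 + N) λ j → φ (insAt close j (insAt (D ∷_) i (w c)))) ≡ ∑D (∑U φ) (w c)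
    slots c refl = trans
      (sumTo-cong (suc (length (w c))) λ i _ → trans
        (cong (λ k → sumTo (suc k) λ j → φ (insAt close j (insAt (D ∷_) i (w c))))
            (sym (length-insAt (D ∷_) (λ _ → refl) i (w c))))
        (sumTo-∑U φ (insAt (D ∷_) i (w c))))
      (sumTo-∑D (∑U φ) (w c))

  totalCost : ℕ → ℕ → ℕ
  totalCost n δ = sumCodes (cells n δ) (costOf (letters n δ))

  -- The hook length formula: `ballots n δ` is the number of standard tableaux of the shape.
  cells! : ∀ n δ → cells n δ ! ≡ weight n δ * ballots n δ
  cells! n δ = trans (sym (sumCodes-1 (cells n δ))) (equidistribution n δ (λ _ → 1))

  -- With `N` cells processed the lower entry has `N + 1` ranks and then the upper one `N + 2`.
  -- Every cost is repeated for each choice of the ranks that come after it.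
  totalCost-suc : ∀ n δ → totalCost (suc n) δ ≡
    weight n δ * (V n δ (∑D (∑P closeCost)) + (2 + cells n δ) * V n δ (∑P #D))
    + (2 + cells n δ) * (1 + cells n δ) * totalCost n δ
  totalCost-suc n δ = begin
    sumCodes N (λ c → sumTo (suc N) λ i → sumTo (2 + N) λ j →
      costAt closeCost j (insAt (D ∷_) i (w c)) + (costAt #D i (w c) + κ c))
      ≡⟨ sumCodes-cong N (λ {c} cd → slots c (length-wordOf (letters n δ) cd)) ⟩
    sumCodes N (λ c → ψ (w c) + (2 + N) * (1 + N) * κ c) ≡⟨ sumCodes-+ N _ _ ⟩
    sumCodes N (ψ ∘ w) + sumCodes N (λ c → (2 + N) * (1 + N) * κ c)
      ≡⟨ cong₂ _+_ (equidistribution n δ ψ) (sumCodes-* N ((2 + N) * (1 + N)) κ) ⟩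
    weight n δ * V n δ ψ + (2 + N) * (1 + N) * totalCost n δ
      ≡⟨ cong (λ z → weight n δ * z + (2 + N) * (1 + N) * totalCost n δ)
           (trans (V-+ n δ _ _) (cong (V n δ (∑D (∑P closeCost)) +_) (V-* n δ (2 + N) (∑P #D)))) ⟩
    weight n δ * (V n δ (∑D (∑P closeCost)) + (2 + N) * V n δ (∑P #D)) + (2 + N) * (1 + N) * totalCost n δ ∎
    where
    open ≡-Reasoning
    N = cells n δ
    w = wordOf (letters n δ)
    κ = costOf (letters n δ)
    ψ : Word → ℕ
    ψ r = ∑D (∑P closeCost) r + (2 + N) * ∑P #D r
    slots : ∀ c {M} → length (w c) ≡ M →
      sumTo (suc M) (λ i → sumTo (2 + M) λ j → costAt closeCost j (insAt (D ∷_) i (w c))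
          + (costAt #D i (w c) + κ c))
      ≡ (∑D (∑P closeCost) (w c) + (2 + M) * ∑P #D (w c)) + (2 + M) * (1 + M) * κ c
    slots c {M} refl = begin
      sumTo (suc M) (λ i → sumTo (2 + M) λ j → costAt closeCost j (insAt (D ∷_) i (w c))
          + (costAt #D i (w c) + κ c))
        ≡⟨ sumTo-cong (suc M) (λ i _ →
            trans (sumTo-+ (2 + M) (λ j → costAt closeCost j (insAt (D ∷_) i (w c)))
                (λ _ → costAt #D i (w c) + κ c))
                    (cong₂ _+_ (inner i) (sumTo-const (2 + M) (costAt #D i (w c) + κ c)))) ⟩
      sumTo (suc M) (λ i → ∑P closeCost (insAt (D ∷_) i (w c)) + (2 + M) * (costAt #D i (w c) + κ c))
        ≡⟨ sumTo-+ (suc M) (λ i → ∑P closeCost (insAt (D ∷_) i (w c)))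
            (λ i → (2 + M) * (costAt #D i (w c) + κ c)) ⟩
      sumTo (suc M) (λ i → ∑P closeCost (insAt (D ∷_) i (w c)))
          + sumTo (suc M) (λ i → (2 + M) * (costAt #D i (w c) + κ c))
        ≡⟨ cong₂ _+_ (sumTo-∑D (∑P closeCost) (w c))
            (trans (sumTo-* (suc M) (2 + M) (λ i → costAt #D i (w c) + κ c))
             (cong ((2 + M) *_) (trans (sumTo-+ (suc M) (λ i → costAt #D i (w c)) (λ _ → κ c))
                 (cong₂ _+_ (sumTo-∑P #D (w c)) (sumTo-const (suc M) (κ c)))))) ⟩
      ∑D (∑P closeCost) (w c) + (2 + M) * (∑P #D (w c) + suc M * κ c)
          ≡⟨ lem (∑D (∑P closeCost) (w c)) M (∑P #D (w c)) (κ c) ⟩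
      (∑D (∑P closeCost) (w c) + (2 + M) * ∑P #D (w c)) + (2 + M) * (1 + M) * κ c ∎
      where
      inner : ∀ i → sumTo (2 + M) (λ j → costAt closeCost j (insAt (D ∷_) i (w c))) ≡ ∑P closeCost
          (insAt (D ∷_) i (w c))
      inner i = trans (cong (λ k → sumTo (suc k) λ j → costAt closeCost j (insAt (D ∷_) i (w c)))
          (sym (length-insAt (D ∷_) (λ _ → refl) i (w c))))
        (sumTo-∑P closeCost (insAt (D ∷_) i (w c)))
      lem : ∀ a M b c → a + (2 + M) * (b + suc M * c) ≡ (a + (2 + M) * b) + (2 + M) * (1 + M) * c
      lem = solve-∀

  costAt-Us : ∀ δ i → i ≤ δ → costAt closeCost i (replicate δ U) ≡ i
  costAt-Us zero    zero z≤n = refl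
  costAt-Us (suc δ) i i≤ with m≤n⇒m<n∨m≡n i≤
  ... | inj₁ (s≤s i≤δ) = trans
      (costAt-below closeCost i U (replicate δ U) (subst (i ≤_) (sym (length-replicate δ)) i≤δ))
          (costAt-Us δ i i≤δ)
  ... | inj₂ refl = trans (cong (λ k → costAt closeCost k (replicate (suc δ) U))
      (sym (length-replicate (suc δ))))
    (trans (costAt-top closeCost (replicate (suc δ) U)) (closeCost-ballot (height-Us (suc δ))))

  singleCost : ℕ → ℕ
  singleCost δ = sumCodes δ (costOf (replicate δ U))

  -- For one row the algorithm is insertion sort, with δ(δ-1)/4 exchanges on average; the term
  -- `δ ! * δ` on the left avoids a subtraction.
  singleCost-δ : ∀ δ → 4 * singleCost δ + δ ! * δ ≡ δ ! * (δ * δ)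
  singleCost-δ zero    = refl
  singleCost-δ (suc δ) = +-cancelʳ-≡ (suc δ * (δ ! * δ)) _ _ (begin
    4 * singleCost (suc δ) + suc δ ! * suc δ + suc δ * (δ ! * δ)
        ≡⟨ cong (λ z → 4 * z + suc δ ! * suc δ + suc δ * (δ ! * δ)) rec ⟩
    4 * (s * δ ! + suc δ * singleCost δ) + suc δ ! * suc δ + suc δ * (δ ! * δ) ≡⟨ l₁ δ (δ !) s (singleCost δ) ⟩
    2 * δ ! * (2 * s) + suc δ * (4 * singleCost δ + δ ! * δ) + suc δ ! * suc δ
      ≡⟨ cong₂ (λ a b → 2 * δ ! * a + suc δ * b + suc δ ! * suc δ) (sumTo-triangle δ) (singleCost-δ δ) ⟩
    2 * δ ! * (δ * suc δ) + suc δ * (δ ! * (δ * δ)) + suc δ ! * suc δ ≡⟨ l₂ δ (δ !) ⟩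
    suc δ ! * (suc δ * suc δ) + suc δ * (δ ! * δ) ∎)
    where
    open ≡-Reasoning
    s = sumTo (suc δ) (λ i → i)
    rec : singleCost (suc δ) ≡ s * δ ! + suc δ * singleCost δ
    rec = begin
      sumCodes δ (λ c → sumTo (suc δ) λ i → costAt closeCost i (wordOf (replicate δ U) c)
          + costOf (replicate δ U) c)
        ≡⟨ sumCodes-cong δ (λ {c} cd →
            trans (sumTo-+ (suc δ) (λ i → costAt closeCost i (wordOf (replicate δ U) c))
                (λ _ → costOf (replicate δ U) c)) (cong₂ _+_
             (trans (sumTo-cong (suc δ) λ
                 { i (s≤s i≤δ) → trans (cong (costAt closeCost i) (wordOf-Us δ cd)) (costAt-Us δ i i≤δ) })
                     (sym (*-identityʳ s)))
             (sumTo-const (suc δ) (costOf (replicate δ U) c)))) ⟩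
      sumCodes δ (λ c → s * 1 + suc δ * costOf (replicate δ U) c)
        ≡⟨ trans (sumCodes-+ δ _ _)
            (cong₂ _+_ (sumCodes-* δ s (λ _ → 1)) (sumCodes-* δ (suc δ) (costOf (replicate δ U)))) ⟩
      s * sumCodes δ (λ _ → 1) + suc δ * singleCost δ
          ≡⟨ cong (λ z → s * z + suc δ * singleCost δ) (sumCodes-1 δ) ⟩
      s * δ ! + suc δ * singleCost δ ∎
    l₁ : ∀ δ f s c → 4 * (s * f + suc δ * c) + suc δ * f * suc δ + suc δ * (f * δ) ≡ 2 * f * (2 * s)
        + suc δ * (4 * c + f * δ) + suc δ * f * suc δ
    l₁ = solve-∀
    l₂ : ∀ δ f → 2 * f * (δ * suc δ) + suc δ * (f * (δ * δ)) + suc δ * f * suc δ ≡ suc δ * f * (suc δ * suc δ)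
        + suc δ * (f * δ)
    l₂ = solve-∀

  cells≡ : ∀ n δ → cells n δ ≡ 2 * n + δ
  cells≡ zero    δ = length-replicate δ
  cells≡ (suc n) δ = trans (cong (2 +_) (cells≡ n δ)) (lem n δ)
    where
    lem : ∀ n δ → 2 + (2 * n + δ) ≡ 2 * (1 + n) + δ
    lem = solve-∀

  cells!-suc : ∀ n δ → cells (suc n) δ ! ≡ (2 + cells n δ) * (1 + cells n δ) * cells n δ !
  cells!-suc n δ = sym (*-assoc (2 + cells n δ) (1 + cells n δ) (cells n δ !))

  -- The hook length formula in the normalisation of `averageCost-suc`.
  factorial-K : ∀ n δ → (1 + cells n δ) * cells n δ ! ≡ weight n δ * (suc δ * paths n (suc δ))
  factorial-K n δ = begin
    (1 + cells n δ) * cells n δ ! ≡⟨ cong₂ (λ a b → (1 + a) * b) (cells≡ n δ) (cells! n δ) ⟩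
    (1 + (2 * n + δ)) * (weight n δ * ballots n δ) ≡⟨ lem n δ (weight n δ) (ballots n δ) ⟩
    weight n δ * ((1 + 2 * n + δ) * ballots n δ) ≡⟨ cong (weight n δ *_) (ballots-paths n δ) ⟩
    weight n δ * (suc δ * paths n (suc δ)) ∎
    where
    open ≡-Reasoning
    lem : ∀ n δ w c → (1 + (2 * n + δ)) * (w * c) ≡ w * ((1 + 2 * n + δ) * c)
    lem = solve-∀

  -- Multiplied by `weight n δ`, the recursion `averageCost-suc` becomes `totalCost-suc`; the start
  -- `n = 0` is insertion sort.
  totalCost-averageCost : ∀ n δ → fromℕ (totalCost n δ) ≡ fromℕ (cells n δ !) ℚ.* averageCost n δ
  totalCost-averageCost zero δ = begin
    fromℕ (totalCost 0 δ) ≡⟨ cong (λ k → fromℕ (sumCodes k (costOf (replicate δ U)))) (length-replicate δ) ⟩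
    fromℕ (singleCost δ) ≡⟨ *-cancelˡ-≢0 4ℚ (fromℕ-≢0 4)
        (lem (fromℕ (singleCost δ)) (fromℕ (δ !)) (fromℕ δ) spec) ⟩
    fromℕ (δ !) ℚ.* (¼ ℚ.* (fromℕ δ ℚ.* (fromℕ δ ℚ.- 1ℚ)))
        ≡⟨ cong₂ (λ k r → fromℕ (k !) ℚ.* r) (sym (length-replicate δ)) (sym (averageCost-zero δ)) ⟩
    fromℕ (cells 0 δ !) ℚ.* averageCost 0 δ ∎
    where
    open ≡-Reasoning
    spec : 4ℚ ℚ.* fromℕ (singleCost δ) ℚ.+ fromℕ (δ !) ℚ.* fromℕ δ ≡ fromℕ (δ !) ℚ.* (fromℕ δ ℚ.* fromℕ δ)
    spec = trans (sym (expand (⟨ 4 ⟩ ⊗ ⟨ singleCost δ ⟩ ⊕ ⟨ δ ! ⟩ ⊗ ⟨ δ ⟩)))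
        (trans (cong fromℕ (singleCost-δ δ)) (expand (⟨ δ ! ⟩ ⊗ (⟨ δ ⟩ ⊗ ⟨ δ ⟩))))
    lem : ∀ c f d →
      4ℚ ℚ.* c ℚ.+ f ℚ.* d ≡ f ℚ.* (d ℚ.* d) →
      4ℚ ℚ.* c
      ≡ 4ℚ ℚ.* (f ℚ.* (¼ ℚ.* (d ℚ.* (d ℚ.- 1ℚ))))
    lem c f d h₁ =
      modulo 1ℚ h₁ (solve 3 (λ c f d →
          con 4ℚ :* c
          := con 4ℚ :* (f :* (con ¼ :* (d :* (d :- con 1ℚ))))
              :+ con 1ℚ :* (con 4ℚ :* c :+ f :* d :- f :* (d :* d))) refl c f d)
  totalCost-averageCost (suc n) δ = begin
    fromℕ (totalCost (suc n) δ) ≡⟨ cong fromℕ (totalCost-suc n δ) ⟩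
    fromℕ (weight n δ * (V n δ (∑D (∑P closeCost)) + (2 + N) * V n δ (∑P #D))
        + (2 + N) * (1 + N) * totalCost n δ)
      ≡⟨ expand (⟨ weight n δ ⟩
          ⊗ (⟨ V n δ (∑D (∑P closeCost)) ⟩ ⊕ (⟨ 2 ⟩ ⊕ ⟨ N ⟩) ⊗ ⟨ V n δ (∑P #D) ⟩) ⊕ (⟨ 2 ⟩ ⊕ ⟨ N ⟩) ⊗
              (⟨ 1 ⟩ ⊕ ⟨ N ⟩) ⊗ ⟨ totalCost n δ ⟩) ⟩
    W ℚ.* (fromℕ (V n δ (∑D (∑P closeCost))) ℚ.+ (2ℚ ℚ.+ ν) ℚ.* fromℕ (V n δ (∑P #D)))
        ℚ.+ (2ℚ ℚ.+ ν) ℚ.* (1ℚ ℚ.+ ν) ℚ.* fromℕ (totalCost n δ)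
      ≡⟨ cong₂ (λ a b → W ℚ.* a ℚ.+ (2ℚ ℚ.+ ν) ℚ.* (1ℚ ℚ.+ ν) ℚ.* b)
           (cong₂ (λ a b → a ℚ.+ (2ℚ ℚ.+ ν) ℚ.* b) (V-∑D-∑P-closeCost n δ) (V-∑P-#D n δ))
               (totalCost-averageCost n δ) ⟩
    W ℚ.* (x₂ ℚ.+ (2ℚ ℚ.+ ν) ℚ.* x₁) ℚ.+ (2ℚ ℚ.+ ν) ℚ.* (1ℚ ℚ.+ ν) ℚ.* (f ℚ.* averageCost n δ)
      ≡⟨ lem ν W x₁ x₂ f (averageCost n δ) (averageCost (suc n) δ) d k suc-spec K-spec ⟩
    (2ℚ ℚ.+ ν) ℚ.* (1ℚ ℚ.+ ν) ℚ.* f ℚ.* averageCost (suc n) δ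
      ≡⟨ cong (ℚ._* averageCost (suc n) δ)
          (trans (sym (expand ((⟨ 2 ⟩ ⊕ ⟨ N ⟩) ⊗ (⟨ 1 ⟩ ⊕ ⟨ N ⟩) ⊗ ⟨ N ! ⟩)))
              (cong fromℕ (sym (cells!-suc n δ)))) ⟩
    fromℕ (cells (suc n) δ !) ℚ.* averageCost (suc n) δ ∎
    where
    open ≡-Reasoning
    N = cells n δ
    -- Here `ν` is the number `2n + δ` of cells, in contrast to its use for `n` before.
    ν W d k x₁ x₂ f : ℚ
    ν = fromℕ N
    W = fromℕ (weight n δ)
    d = fromℕ δ
    k = pathsℚ n (suc δ)
    x₁ = X₁ (fromℕ n) d (T n δ) k
    x₂ = X₂ (fromℕ n) d (T n δ) k
    f = fromℕ (N !)
    ν-eq : 2ℚ ℚ.* fromℕ n ℚ.+ d ≡ ν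
    ν-eq = trans (sym (expand (⟨ 2 ⟩ ⊗ ⟨ n ⟩ ⊕ ⟨ δ ⟩))) (cong fromℕ (sym (cells≡ n δ)))
    suc-spec : (d ℚ.+ 1ℚ) ℚ.* k ℚ.* (ν ℚ.+ 2ℚ) ℚ.* averageCost (suc n) δ ≡ (d ℚ.+ 1ℚ) ℚ.* k ℚ.* (ν ℚ.+ 2ℚ) ℚ.*
        averageCost n δ ℚ.+ ((ν ℚ.+ 2ℚ) ℚ.* x₁ ℚ.+ x₂)
    suc-spec = subst (λ z → (d ℚ.+ 1ℚ) ℚ.* k ℚ.* (z ℚ.+ 2ℚ) ℚ.* averageCost (suc n) δ ≡ (d ℚ.+ 1ℚ) ℚ.* k ℚ.*
        (z ℚ.+ 2ℚ) ℚ.* averageCost n δ ℚ.+ ((z ℚ.+ 2ℚ) ℚ.* x₁ ℚ.+ x₂))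
      ν-eq (averageCost-suc n δ)
    K-spec : (1ℚ ℚ.+ ν) ℚ.* f ≡ W ℚ.* ((1ℚ ℚ.+ d) ℚ.* k)
    K-spec = trans (sym (expand ((⟨ 1 ⟩ ⊕ ⟨ N ⟩) ⊗ ⟨ N ! ⟩)))
        (trans (cong fromℕ (factorial-K n δ))
            (expand (⟨ weight n δ ⟩ ⊗ ((⟨ 1 ⟩ ⊕ ⟨ δ ⟩) ⊗ ⟨ paths n (suc δ) ⟩))))
    lem : ∀ ν W x₁ x₂ f r r′ d k →
      (d ℚ.+ 1ℚ) ℚ.* k ℚ.* (ν ℚ.+ 2ℚ) ℚ.* r′ ≡
          ((d ℚ.+ 1ℚ) ℚ.* k ℚ.* (ν ℚ.+ 2ℚ) ℚ.* r ℚ.+ ((ν ℚ.+ 2ℚ) ℚ.* x₁ ℚ.+ x₂)) →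
      (1ℚ ℚ.+ ν) ℚ.* f ≡ W ℚ.* ((1ℚ ℚ.+ d) ℚ.* k) →
      W ℚ.* (x₂ ℚ.+ (2ℚ ℚ.+ ν) ℚ.* x₁) ℚ.+ (2ℚ ℚ.+ ν) ℚ.* (1ℚ ℚ.+ ν) ℚ.* (f ℚ.* r)
      ≡ (2ℚ ℚ.+ ν) ℚ.* (1ℚ ℚ.+ ν) ℚ.* f ℚ.* r′
    lem ν W x₁ x₂ f r r′ d k h₁ h₂ =
      modulo (- W) h₁ (modulo (2ℚ ℚ.* r ℚ.+ ν ℚ.* r ℚ.- (2ℚ ℚ.+ ν) ℚ.* r′) h₂ (solve 9 (λ ν W x₁ x₂ f r r′ d k →
          W :* (x₂ :+ (con 2ℚ :+ ν) :* x₁) :+ (con 2ℚ :+ ν) :* (con 1ℚ :+ ν) :* (f :* r)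
          := (con 2ℚ :+ ν) :* (con 1ℚ :+ ν) :* f :* r′
              :+ (:- W) :* ((d :+ con 1ℚ) :* k :* (ν :+ con 2ℚ) :* r′ :-
                  ((d :+ con 1ℚ) :* k :* (ν :+ con 2ℚ) :* r :+ ((ν :+ con 2ℚ) :* x₁ :+ x₂)))
                      :+ (con 2ℚ :* r :+ ν :* r :- (con 2ℚ :+ ν) :* r′) :*
                          ((con 1ℚ :+ ν) :* f :- W :* ((con 1ℚ :+ d) :* k))) refl ν W x₁ x₂ f r r′ d k))

-- From the list of tableaux to codes.

module Enumeration where

  open import Defs
  open Insertion using ([]; _∷_; decode; punch)
  open Codes using (sumTo; sumCodes; sumCodes-+; sumCodes-cong)
  open import Data.Fin as Fin using (Fin; zero; suc; toℕ; punchIn)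
  import Data.Fin.Properties as Fin
  open import Data.Fin.Permutation as Perm using (Permutation′; _⟨$⟩ʳ_; insert; ↔⇒≡)
  open import Data.List using (List; []; _∷_; map; length; lookup; allFin; tabulate; concatMap)
  open import Data.List.Properties using (map-∘; map-cong; map-tabulate; tabulate-cong; tabulate-lookup; map-++; ∷-injectiveˡ; ∷-injectiveʳ)
  open import Data.List.Membership.Propositional using (_∈_)
  open import Data.List.Membership.Propositional.Properties using (∈-allFin; ∈-lookup; ∈-map⁻)
  open import Data.List.Membership.Propositional.Properties.WithK using (unique∧set⇒bag)
  open import Data.List.Relation.Binary.BagAndSetEquality using (∼bag⇒↭)
  import Data.List.Relation.Binary.Permutation.Propositional.Properties as ↭
  open import Data.List.Relation.Unary.All as All using (All; []; _∷_)
  open import Data.List.Relation.Unary.AllPairs as AllPairs using (AllPairs; []; _∷_)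
  import Data.List.Relation.Unary.AllPairs.Properties as AllPairs
  open import Data.List.Relation.Unary.Any as Any using (Any; here; there; index)
  import Data.List.Relation.Unary.Any.Properties as Any
  open import Data.List.Relation.Unary.Unique.Propositional using (Unique)
  open import Data.Nat using (ℕ; zero; suc; _+_)
  import Data.Nat.Properties as ℕ
  open import Data.Nat.ListAction using (sum)
  open import Data.Nat.ListAction.Properties using (sum-++; sum-↭)
  open import Data.Product using (_,_)
  open import Data.Sum using (inj₁; inj₂)
  open import Function using (_∘_; id; _↔_; Inverse; mk↔ₛ′; mk⇔)
  open import Function.Construct.Composition using (_↔-∘_)
  open import Function.Construct.Symmetry using (↔-sym)
  open import Relation.Binary.PropositionalEquality
  open import Relation.Nullary using (¬_; contradiction)

  lookup-injective : ∀ {A : Set} {xs : List A} → Unique xs → ∀ i j → lookup xs i ≡ lookup xs j → i ≡ j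
  lookup-injective (x∉ ∷ u) zero    zero    eq = refl
  lookup-injective {xs = x ∷ xs} (x∉ ∷ u) zero (suc j) eq = contradiction eq
      (All.lookup x∉ (∈-lookup {xs = xs} j))
  lookup-injective {xs = x ∷ xs} (x∉ ∷ u) (suc i) zero eq = contradiction (sym eq)
      (All.lookup x∉ (∈-lookup {xs = xs} i))
  lookup-injective (x∉ ∷ u) (suc i) (suc j) eq = cong suc (lookup-injective u i j eq)

  module _ {A : Set} (xs : List A) (complete : ∀ a → a ∈ xs) (unique : Unique xs) where

    index-lookup : ∀ i → index (complete (lookup xs i)) ≡ i
    index-lookup i = lookup-injective unique _ i (sym (Any.lookup-index (complete (lookup xs i))))

    position : A ↔ Fin (length xs)
    position = mk↔ₛ′ (index ∘ complete) (lookup xs) index-lookup (λ a → sym (Any.lookup-index (complete a)))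

    map-position : ∀ {n} (eq : length xs ≡ n) →
      map (Inverse.to (subst (λ n → A ↔ Fin n) eq position)) xs ≡ allFin n
    map-position refl = trans (cong (map (index ∘ complete)) (sym (tabulate-lookup xs)))
      (trans (map-tabulate (lookup xs) (index ∘ complete)) (tabulate-cong index-lookup))

  map-≡⇒≗ : ∀ {A B : Set} {f g : A → B} {xs} → map f xs ≡ map g xs → ∀ {x} → x ∈ xs → f x ≡ g x
  map-≡⇒≗ {xs = x ∷ xs} eq (here refl) = ∷-injectiveˡ eq
  map-≡⇒≗ {xs = x ∷ xs} eq (there x∈)  = map-≡⇒≗ (∷-injectiveʳ eq) x∈

  toℕ-punchIn : ∀ {n} (i : Fin (suc n)) j → toℕ (punchIn i j) ≡ punch (toℕ i) (toℕ j)
  toℕ-punchIn zero    j       = refl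
  toℕ-punchIn (suc i) zero    = refl
  toℕ-punchIn (suc i) (suc j) = cong suc (toℕ-punchIn i j)

  oneLine : ∀ {n} → Permutation′ n → List ℕ
  oneLine π = map (toℕ ∘ (π ⟨$⟩ʳ_)) (allFin _)

  -- One step of the enumeration `permutations` is one step of `decode`.
  oneLine-insert : ∀ {n} i (π : Permutation′ n) →
      oneLine (insert zero i π) ≡ toℕ i ∷ map (punch (toℕ i)) (oneLine π)
  oneLine-insert {n} i π = cong (toℕ i ∷_) (begin
    map (toℕ ∘ (insert zero i π ⟨$⟩ʳ_)) (tabulate suc) ≡⟨ map-tabulate suc (toℕ ∘ (insert zero i π ⟨$⟩ʳ_)) ⟩
    tabulate (λ k → toℕ (insert zero i π ⟨$⟩ʳ suc k)) ≡⟨ tabulate-cong (λ k → toℕ-punchIn i (π ⟨$⟩ʳ k)) ⟩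
    tabulate (punch (toℕ i) ∘ toℕ ∘ (π ⟨$⟩ʳ_)) ≡⟨ sym (map-tabulate id (punch (toℕ i) ∘ toℕ ∘ (π ⟨$⟩ʳ_))) ⟩
    map (punch (toℕ i) ∘ toℕ ∘ (π ⟨$⟩ʳ_)) (allFin n) ≡⟨ map-∘ (allFin n) ⟩
    map (punch (toℕ i)) (oneLine π) ∎)
    where open ≡-Reasoning

  sum-concatMap : ∀ {A B : Set} (Φ : B → ℕ) (h : A → List B) xs →
    sum (map Φ (concatMap h xs)) ≡ sum (map (λ x → sum (map Φ (h x))) xs)
  sum-concatMap Φ h []       = refl
  sum-concatMap Φ h (x ∷ xs) = trans (cong sum (map-++ Φ (h x) (concatMap h xs)))
    (trans (sum-++ (map Φ (h x)) _) (cong (sum (map Φ (h x)) +_) (sum-concatMap Φ h xs)))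

  sumTo-front : ∀ n f → sumTo (suc n) f ≡ f 0 + sumTo n (f ∘ suc)
  sumTo-front zero    f = refl
  sumTo-front (suc n) f = trans (cong (f (suc n) +_) (sumTo-front n f)) (lem (f (suc n)) (f 0) _)
    where
    open import Data.Nat.Tactic.RingSolver using (solve-∀)
    lem : ∀ a b c → a + (b + c) ≡ b + (a + c)
    lem = solve-∀

  sum-allFin : ∀ n f → sum (map (f ∘ toℕ) (allFin n)) ≡ sumTo n f
  sum-allFin zero    f = refl
  sum-allFin (suc n) f = trans
      (cong (λ xs → f 0 + sum xs)
          (trans (map-tabulate {n = n} suc (f ∘ toℕ)) (sym (map-tabulate {n = n} id (f ∘ suc ∘ toℕ)))))
    (trans (cong (f 0 +_) (sum-allFin n (f ∘ suc))) (sym (sumTo-front n f)))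

  sumTo-sumCodes : ∀ m n (Φ : ℕ → List ℕ → ℕ) →
      sumTo m (λ i → sumCodes n (Φ i)) ≡ sumCodes n (λ c → sumTo m λ i → Φ i c)
  sumTo-sumCodes zero    n Φ = sym (zeros n)
    where
    zeros : ∀ n → sumCodes n (λ _ → 0) ≡ 0
    zeros zero    = refl
    zeros (suc n) = trans (sumCodes-cong n λ _ → Codes.sumTo-* (suc n) 0 (λ _ → 0)) (zeros n)
  sumTo-sumCodes (suc m) n Φ = trans (cong (sumCodes n (Φ m) +_) (sumTo-sumCodes m n Φ))
      (sym (sumCodes-+ n (Φ m) _))

  -- In `permutations` the first value is chosen in the outer sum, in `sumCodes` in the inner one;
  -- `sumTo-sumCodes` exchanges the two.
  sum-permutations : ∀ n (G : List ℕ → ℕ) → sum (map (G ∘ oneLine) (permutations n)) ≡ sumCodes n (G ∘ decode)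
  sum-permutations zero    G = ℕ.+-identityʳ (G [])
  sum-permutations (suc n) G = begin
    sum (map (G ∘ oneLine) (concatMap (λ i → map (insert zero i) (permutations n)) (allFin (suc n))))
      ≡⟨ sum-concatMap (G ∘ oneLine) (λ i → map (insert zero i) (permutations n)) (allFin (suc n)) ⟩
    sum (map (λ i → sum (map (G ∘ oneLine) (map (insert zero i) (permutations n)))) (allFin (suc n)))
      ≡⟨ cong sum (map-cong (λ i →
          trans (cong sum (trans (sym (map-∘ (permutations n)))
              (map-cong (λ π → cong G (oneLine-insert i π)) (permutations n))))
           (sum-permutations n (λ p → G (toℕ i ∷ map (punch (toℕ i)) p)))) (allFin (suc n))) ⟩
    sum (map ((λ i → sumCodes n (λ c → G (decode (i ∷ c)))) ∘ toℕ) (allFin (suc n))) ≡⟨ sum-allFin (suc n) _ ⟩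
    sumTo (suc n) (λ i → sumCodes n (λ c → G (decode (i ∷ c))))
        ≡⟨ sumTo-sumCodes (suc n) n (λ i c → G (decode (i ∷ c))) ⟩
    sumCodes (suc n) (G ∘ decode) ∎
    where open ≡-Reasoning

  module _ (μ : Partition) where

    columnReading : Tableau μ → List ℕ
    columnReading T = map (toℕ ∘ Inverse.to T) (columnwise μ)

    columnwise-unique : Unique (columnwise μ)
    columnwise-unique = AllPairs.map (λ { lt refl → ≺-irrefl lt }) (columnwise-increasing μ)
      where
      ≺-irrefl : ∀ {p} → ¬ (p ≺ p)
      ≺-irrefl (inj₁ lt)       = ℕ.<-irrefl refl lt
      ≺-irrefl (inj₂ (_ , lt)) = ℕ.<-irrefl refl lt

    cellPosition : Cell μ ↔ Fin (length (columnwise μ))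
    cellPosition = position (columnwise μ) (columnwise-complete μ) columnwise-unique

    -- No counting of columns: the row-wise and the column-wise numbering of the cells give a
    -- bijection between the two `Fin` types.
    length-columnwise : length (columnwise μ) ≡ size μ
    length-columnwise = ↔⇒≡ (rowTableau μ ↔-∘ ↔-sym cellPosition)

    columnTableau : Tableau μ
    columnTableau = subst (λ n → Cell μ ↔ Fin n) length-columnwise cellPosition

    columnReading-∘ : ∀ π → columnReading (π ↔-∘ columnTableau) ≡ oneLine π
    columnReading-∘ π = trans (map-∘ (columnwise μ))
      (cong (map (toℕ ∘ (π ⟨$⟩ʳ_)))
          (map-position (columnwise μ) (columnwise-complete μ) columnwise-unique length-columnwise))

    columnReading-injective : ∀ T T′ → columnReading T ≡ columnReading T′ → _≈ₜ_ μ T T′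
    columnReading-injective T T′ eq c = Fin.toℕ-injective (map-≡⇒≗ eq (columnwise-complete μ c))

    columnReading-cong : ∀ T T′ → _≈ₜ_ μ T T′ → columnReading T ≡ columnReading T′
    columnReading-cong T T′ eq = map-cong (cong toℕ ∘ eq) (columnwise μ)

    oneLine-injective : ∀ {n} (π ρ : Permutation′ n) → oneLine π ≡ oneLine ρ → π Perm.≈ ρ
    oneLine-injective π ρ eq i = Fin.toℕ-injective (map-≡⇒≗ eq (∈-allFin i))

    -- `tableaux` is built along the rows, but the algorithm reads columns. The column readings of
    -- all tableaux and the one-line forms of all permutations are lists without repetitions and
    -- with the same members, so they differ only in order and have the same sums.
    sum-tableaux : ∀ (G : List ℕ → ℕ) →
        sum (map (G ∘ columnReading) (tableaux μ)) ≡ sumCodes (size μ) (G ∘ decode)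
    sum-tableaux G = begin
      sum (map (G ∘ columnReading) (tableaux μ)) ≡⟨ cong sum (map-∘ (tableaux μ)) ⟩
      sum (map G (map columnReading (tableaux μ)))
          ≡⟨ sum-↭ (↭.map⁺ G (∼bag⇒↭ (unique∧set⇒bag unique₁ unique₂ (mk⇔ forth back)))) ⟩
      sum (map G (map oneLine (permutations (size μ)))) ≡⟨ cong sum (sym (map-∘ (permutations (size μ)))) ⟩
      sum (map (G ∘ oneLine) (permutations (size μ))) ≡⟨ sum-permutations (size μ) G ⟩
      sumCodes (size μ) (G ∘ decode) ∎
      where
      open ≡-Reasoning
      unique₁ : Unique (map columnReading (tableaux μ))
      unique₁ = AllPairs.map⁺ (AllPairs.map (λ {T} {T′} T≉ eq → T≉ (columnReading-injective T T′ eq))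
          (tableaux-unique μ))
      unique₂ : Unique (map oneLine (permutations (size μ)))
      unique₂ = AllPairs.map⁺ (AllPairs.map (λ {π} {ρ} π≉ eq → π≉ (oneLine-injective π ρ eq))
          (permutations-unique (size μ)))
      forth : ∀ {xs} → xs ∈ map columnReading (tableaux μ) → xs ∈ map oneLine (permutations (size μ))
      forth xs∈ with ∈-map⁻ columnReading xs∈
      ... | T , _ , refl = Any.map⁺ (Any.map (λ {π} eq → trans
        (columnReading-cong T (π ↔-∘ columnTableau) λ c →
            trans (cong (Inverse.to T) (sym (Inverse.strictlyInverseʳ columnTableau c)))
                (eq (Inverse.to columnTableau c)))
        (columnReading-∘ π)) (permutations-complete (size μ) (T ↔-∘ ↔-sym columnTableau)))
      back : ∀ {xs} → xs ∈ map oneLine (permutations (size μ)) → xs ∈ map columnReading (tableaux μ)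
      back xs∈ with ∈-map⁻ oneLine xs∈
      ... | π , _ , refl = Any.map⁺
          (Any.map (λ {T} eq → trans (sym (columnReading-∘ π)) (columnReading-cong (π ↔-∘ columnTableau) T eq))
        (tableaux-complete μ (π ↔-∘ columnTableau)))

-- The exchange loop on a tableau agrees with insertion into lists.

module Sliding where

  open import Defs hiding (size)
  import Defs
  open Insertion using (Rows; insertRow; insertTop)
  open import Data.Fin as Fin using (Fin; zero; suc; toℕ)
  import Data.Fin.Properties as Fin
  open import Data.Fin.Permutation as Perm using (transpose)
  open import Data.List using (List; []; _∷_; map; mapMaybe; length)
  import Data.List.Extrema
  open import Data.List.Relation.Unary.All as All using (All; []; _∷_)
  open import Data.List.Relation.Unary.Any using (Any; here)
  open import Data.Maybe using (Maybe; just; nothing)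
  open import Data.Nat as ℕ using (ℕ; zero; suc; _+_; _≤_; _<_; z≤n; s≤s; _<?_)
  import Data.Nat.Properties as ℕ
  open import Data.Product as × using (_×_; _,_; proj₁; proj₂; map₁; map₂)
  open import Data.Sum using (_⊎_; inj₁; inj₂)
  open import Function using (Inverse; id)
  open import Relation.Binary.PropositionalEquality
  open import Relation.Nullary using (¬_; yes; no; contradiction)

  module Ext {n} = Data.List.Extrema (Fin.≤-totalOrder n)

  -- In the applications `a` is the entry below and `b` the one to the right, the order in which
  -- `neighbours` lists them.
  min-first : ∀ {n} {a b : Fin n} → a Fin.≤ b → Ext.min a (b ∷ []) ≡ a
  min-first {a = a} {b} a≤b with Ext.argmin-sel id a (b ∷ [])
  ... | inj₁ eq        = eq
  ... | inj₂ (here eq) = Fin.≤-antisym (Ext.min≤⊤ a (b ∷ [])) (subst (a Fin.≤_) (sym eq) a≤b)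

  min-second : ∀ {n} {a b : Fin n} → b Fin.≤ a → Ext.min a (b ∷ []) ≡ b
  min-second b≤a = Ext.min≈v⁺ (here refl) (ℕ.≤-refl ∷ []) b≤a

  transpose-maps-ˡ : ∀ {n} (a b : Fin n) → transpose a b Perm.⟨$⟩ʳ a ≡ b
  transpose-maps-ˡ a b with a Fin.≟ a
  ... | yes _ = refl
  ... | no ≢  = contradiction refl ≢

  transpose-maps-ʳ : ∀ {n} (a b : Fin n) → transpose a b Perm.⟨$⟩ʳ b ≡ a
  transpose-maps-ʳ a b with b Fin.≟ a
  ... | yes b≡a = b≡a
  ... | no _ with b Fin.≟ b
  ...   | yes _ = refl
  ...   | no ≢  = contradiction refl ≢

  transpose-other : ∀ {n} (a b c : Fin n) → c ≢ a → c ≢ b → transpose a b Perm.⟨$⟩ʳ c ≡ c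
  transpose-other a b c c≢a c≢b with c Fin.≟ a
  ... | yes eq = contradiction eq c≢a
  ... | no _ with c Fin.≟ b
  ...   | yes eq = contradiction eq c≢b
  ...   | no _   = refl

  module _ (μ : Partition) where

    to : Tableau μ → Cell μ → Fin (Defs.size μ)
    to T = Inverse.to T

    at : ∀ {c p} → coords μ c ≡ p → cellAt μ p ≡ just c
    at {c} refl = cellAt-complete μ c

    to-injective : ∀ T {c c′} → to T c ≡ to T c′ → c ≡ c′
    to-injective T {c} {c′} eq = trans (sym (Inverse.strictlyInverseʳ T c))
        (trans (cong (Inverse.from T) eq) (Inverse.strictlyInverseʳ T c′))

    -- Row `i` of `T`, read from column `j` to its end. The end is recorded by the absence of all
    -- further cells, which tells whether a neighbour exists.
    data Row (T : Tableau μ) (i : ℕ) : ℕ → List ℕ → Set where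
      end  : ∀ {j} → (∀ j′ → j ≤ j′ → cellAt μ (i , j′) ≡ nothing) → Row T i j []
      cell : ∀ {j x xs} c → coords μ c ≡ (i , j) → toℕ (to T c) ≡ x → Row T i (suc j) xs → Row T i j (x ∷ xs)

    row-cong : ∀ {T T′ i j xs} → (∀ c → proj₁ (coords μ c) ≡ i → j ≤ proj₂ (coords μ c) → to T′ c ≡ to T c) →
        Row T i j xs → Row T′ i j xs
    row-cong same (end e)        = end e
    row-cong same (cell c p v r) = cell c p
        (trans (cong toℕ (same c (cong proj₁ p) (ℕ.≤-reflexive (sym (cong proj₂ p))))) v)
      (row-cong (λ c′ i j → same c′ i (ℕ.<⇒≤ j)) r)

    row-length : ∀ {T i j xs} b → (∀ c → proj₂ (coords μ c) < b) → j ≤ b → Row T i j xs → j + length xs ≤ b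
    row-length b bound le (end _) = subst (_≤ b) (sym (ℕ.+-identityʳ _)) le
    row-length {j = j} b bound le (cell c p v r) = subst (_≤ b) (sym (ℕ.+-suc j _))
      (row-length b bound (subst (_< b) (cong proj₂ p) (bound c)) r)

    row-head : ∀ {T i j xs} → Row T i j xs → Maybe (Cell μ)
    row-head (end _)        = nothing
    row-head (cell c _ _ _) = just c

    row-head-at : ∀ {T i j xs} (r : Row T i j xs) → cellAt μ (i , j) ≡ row-head r
    row-head-at (end e)        = e _ ℕ.≤-refl
    row-head-at (cell c p _ _) = at p

    fromMaybes : Maybe (Cell μ) → Maybe (Cell μ) → List (Cell μ)
    fromMaybes a b = mapMaybe id (a ∷ b ∷ [])

    neighbours-of : ∀ {T i j c xs ys} → coords μ c ≡ (i , j) →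
        (x : Row T i (suc j) xs) (y : Row T (suc i) j ys) →
      neighbours μ c ≡ fromMaybes (row-head y) (row-head x)
    neighbours-of refl x y rewrite row-head-at x | row-head-at y = refl

    row-[]-suc : ∀ {T T′ i j} → Row T i j [] → Row T′ i (suc j) []
    row-[]-suc (end e) = end λ j′ le → e j′ (ℕ.<⇒≤ le)

    row-[]-irrelevant : ∀ {T T′ i j} → Row T i j [] → Row T′ i j []
    row-[]-irrelevant (end e) = end e

    module _ {T : Tableau μ} {c : Cell μ} {k : Fin (Defs.size μ)} (Tc≡k : to T c ≡ k) where

      step-corner : map (to T) (neighbours μ c) ≡ [] → step μ k T ≡ nothing
      step-corner eq rewrite sym Tc≡k | Inverse.strictlyInverseʳ T c | eq = refl

      step-go : ∀ {e es m} → map (to T) (neighbours μ c) ≡ e ∷ es → Ext.min e es ≡ m → toℕ m < toℕ k →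
        step μ k T ≡ just (exchange μ m k T)
      step-go {e} {es} eq refl lt rewrite sym Tc≡k | Inverse.strictlyInverseʳ T c | eq with Ext.min e es
          Fin.<? to T c
      ... | yes _ = refl
      ... | no ≮  = contradiction lt ≮

      step-stop : ∀ {e es m} → map (to T) (neighbours μ c) ≡ e ∷ es → Ext.min e es ≡ m → ¬ (toℕ m < toℕ k) →
        step μ k T ≡ nothing
      step-stop {e} {es} eq refl ≮ rewrite sym Tc≡k | Inverse.strictlyInverseʳ T c | eq with Ext.min e es
          Fin.<? to T c
      ... | yes lt = contradiction lt ≮
      ... | no _   = refl

      module _ (c₁ : Cell μ) where
        private
          T₁ : Tableau μ
          T₁ = exchange μ (to T c₁) k T

        exchange-source : to T₁ c ≡ to T c₁
        exchange-source rewrite Tc≡k = transpose-maps-ʳ (to T c₁) k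

        exchange-target : to T₁ c₁ ≡ k
        exchange-target = transpose-maps-ˡ (to T c₁) k

        exchange-other : ∀ c′ → coords μ c′ ≢ coords μ c₁ → coords μ c′ ≢ coords μ c → to T₁ c′ ≡ to T c′
        exchange-other c′ ≢₁ ≢₀ = transpose-other (to T c₁) k (to T c′)
          (λ eq → ≢₁ (cong (coords μ) (to-injective T eq)))
          (λ eq → ≢₀ (cong (coords μ) (to-injective T (trans eq (sym Tc≡k)))))

    slide-stop : ∀ fuel {k T} → step μ k T ≡ nothing → slide μ fuel k T ≡ (T , 0)
    slide-stop zero       eq = refl
    slide-stop (suc fuel) {k} {T} eq with step μ k T | eq
    ... | nothing | _ = refl

    slide-go : ∀ fuel {k T T₁} → step μ k T ≡ just T₁ → slide μ (suc fuel) k T ≡ map₂ suc (slide μ fuel k T₁)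
    slide-go fuel {k} {T} eq with step μ k T | eq
    ... | just _ | refl = refl

    record RowSlid (T : Tableau μ) (i j : ℕ) (result : Tableau μ × ℕ) (expected : List ℕ × ℕ) : Set where
      constructor rowSlid
      field
        row    : Row (proj₁ result) i j (proj₁ expected)
        cost   : proj₂ result ≡ proj₂ expected
        others : ∀ c → proj₁ (coords μ c) ≢ i ⊎ proj₂ (coords μ c) < j → to (proj₁ result) c ≡ to T c

    row-slid-stop : ∀ {T i j c k xs} fuel → to T c ≡ k → coords μ c ≡ (i , j) → Row T i (suc j) xs →
        step μ k T ≡ nothing →
      RowSlid T i j (slide μ fuel k T) (toℕ k ∷ xs , 0)
    row-slid-stop {c = c} fuel Tc p r eq rewrite slide-stop fuel eq = rowSlid (cell c p (cong toℕ Tc) r) refl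
        (λ _ _ → refl)

    -- There is no cell beneath, so the right neighbour is the only one and each round is a clause
    -- of `insertRow`. Every exchange shortens `xs`, so `length xs` rounds are enough.
    slideRow : ∀ fuel {k T i j c xs} → to T c ≡ k → coords μ c ≡ (i , j) → Row T i (suc j) xs →
        Row T (suc i) j [] → length xs ≤ fuel →
      RowSlid T i j (slide μ fuel k T) (insertRow (toℕ k) xs)
    slideRow fuel {T = T} {c = c} Tc p r@(end _) b@(end _) _ =
      row-slid-stop fuel Tc p r (step-corner {T} {c} Tc (cong (map (to T)) (neighbours-of p r b)))
    slideRow (suc fuel) {k} {T} {i} {j} {c} Tc p r@(cell c₁ p₁ refl rs) b@(end _) (s≤s le) with toℕ (to T c₁)
        <? toℕ k
    ... | no ≮ = row-slid-stop (suc fuel) Tc p r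
        (step-stop {T} {c} Tc (cong (map (to T)) (neighbours-of p r b)) refl ≮)
    ... | yes lt rewrite slide-go fuel (step-go {T} {c} Tc (cong (map (to T)) (neighbours-of p r b)) refl lt) =
      rowSlid (cell c p (cong toℕ
          (trans (others c (inj₂ (subst (_< suc j) (sym (cong proj₂ p)) ℕ.≤-refl)))
              (exchange-source {T} {c} Tc c₁))) row)
              (cong suc cost)
              (λ c′ out → trans (others c′ (wider out))
                  (exchange-other {T} {c} Tc c₁ c′ (outside₁ c′ out) (outside₀ c′ out)))
      where
      T₁ : Tableau μ
      T₁ = exchange μ (to T c₁) k T
      r₁ : Row T₁ i (suc (suc j)) _
      r₁ = row-cong (λ c′ _ le → exchange-other {T} {c} Tc c₁ c′
        (λ eq → ℕ.<⇒≢ le (sym (cong proj₂ (trans eq p₁))))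
        (λ eq → ℕ.<⇒≢ (ℕ.<-trans ℕ.≤-refl le) (sym (cong proj₂ (trans eq p))))) rs
      open RowSlid (slideRow fuel (exchange-target {T} {c} Tc c₁) p₁ r₁ (row-[]-suc b) le)
      wider : ∀ {c′} → proj₁ (coords μ c′) ≢ i ⊎ proj₂ (coords μ c′) < j →
          proj₁ (coords μ c′) ≢ i ⊎ proj₂ (coords μ c′) < suc j
      wider (inj₁ ≢)  = inj₁ ≢
      wider (inj₂ lt) = inj₂ (ℕ.m≤n⇒m≤1+n lt)
      outside₁ : ∀ c′ → proj₁ (coords μ c′) ≢ i ⊎ proj₂ (coords μ c′) < j → coords μ c′ ≢ coords μ c₁
      outside₁ c′ (inj₁ ≢)  eq = ≢ (cong proj₁ (trans eq p₁))
      outside₁ c′ (inj₂ lt) eq = ℕ.<⇒≢ (ℕ.m≤n⇒m≤1+n lt) (cong proj₂ (trans eq p₁))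
      outside₀ : ∀ c′ → proj₁ (coords μ c′) ≢ i ⊎ proj₂ (coords μ c′) < j → coords μ c′ ≢ coords μ c
      outside₀ c′ (inj₁ ≢)  eq = ≢ (cong proj₁ (trans eq p))
      outside₀ c′ (inj₂ lt) eq = ℕ.<⇒≢ lt (cong proj₂ (trans eq p))

    record RowsSlid (T : Tableau μ) (i j : ℕ) (result : Tableau μ × ℕ) (expected : Rows × ℕ) : Set where
      constructor rowsSlid
      field
        upper  : Row (proj₁ result) i j (proj₁ (proj₁ expected))
        lower  : Row (proj₁ result) (suc i) j (proj₂ (proj₁ expected))
        cost   : proj₂ result ≡ proj₂ expected
        others : ∀ c → proj₂ (coords μ c) < j → to (proj₁ result) c ≡ to T c

    rows-slid-stop : ∀ {T i j c k xs ys} fuel → to T c ≡ k → coords μ c ≡ (i , j) → Row T i (suc j) xs →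
        Row T (suc i) j ys → step μ k T ≡ nothing →
      RowsSlid T i j (slide μ fuel k T) ((toℕ k ∷ xs , ys) , 0)
    rows-slid-stop {c = c} fuel Tc p r s eq rewrite slide-stop fuel eq = rowsSlid (cell c p (cong toℕ Tc) r) s
        refl (λ _ _ → refl)

    insertTop-[] : ∀ k xs → proj₂ (proj₁ (insertTop k xs [])) ≡ []
    insertTop-[] k []       = refl
    insertTop-[] k (x ∷ xs) with x <? k
    ... | yes _ = insertTop-[] k xs
    ... | no  _ = refl

    -- The exchange with the entry below, common to the two clauses of `insertTop` that move down:
    -- the entry has left row `i` for good.
    slide-down : ∀ fuel {k T i j c xs ys} → to T c ≡ k → coords μ c ≡ (i , j) → Row T i (suc j) xs →
      ∀ d → coords μ d ≡ (suc i , j) → Row T (suc i) (suc j) ys → Row T (2 + i) j [] → length ys ≤ fuel →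
      RowsSlid T i j (map₂ suc (slide μ fuel k (exchange μ (to T d) k T)))
        (map₁ (toℕ (to T d) ∷ xs ,_) (map₂ suc (insertRow (toℕ k) ys)))
    slide-down fuel {k} {T} {i} {j} {c} {xs} {ys} Tc p r d q ss b le =
      rowsSlid (cell c p (cong toℕ
          (trans (others c (inj₁ λ eq → ℕ.1+n≢n (trans (sym eq) (cong proj₁ p))))
              (exchange-source {T} {c} Tc d)))
                 (row-cong (λ c′ i≡ le → trans (others c′ (inj₁ λ eq → ℕ.1+n≢n (trans (sym eq) i≡)))
                     (exchange-other {T} {c} Tc d c′
                   (λ eq → ℕ.1+n≢n (trans (sym (cong proj₁ q)) (trans (sym (cong proj₁ eq)) i≡)))
                   (λ eq → ℕ.<⇒≢ le (sym (cong proj₂ (trans eq p)))))) r))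
               row
               (cong suc cost)
               (λ c′ lt → trans (others c′ (inj₂ lt)) (exchange-other {T} {c} Tc d c′
                 (λ eq → ℕ.<⇒≢ lt (cong proj₂ (trans eq q))) (λ eq → ℕ.<⇒≢ lt (cong proj₂ (trans eq p)))))
      where
      T₁ : Tableau μ
      T₁ = exchange μ (to T d) k T
      s₁ : Row T₁ (suc i) (suc j) ys
      s₁ = row-cong (λ c′ i≡ le → exchange-other {T} {c} Tc d c′
        (λ eq → ℕ.<⇒≢ le (sym (cong proj₂ (trans eq q))))
        (λ eq → ℕ.1+n≢n (trans (sym i≡) (cong proj₁ (trans eq p))))) ss
      open RowSlid (slideRow fuel (exchange-target {T} {c} Tc d) q s₁ (row-[]-irrelevant b) le)

    -- The case distinctions are those of `insertTop`; after a move to the right the same situation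
    -- recurs one column further.
    slideTop : ∀ fuel {k T i j c xs ys} → to T c ≡ k → coords μ c ≡ (i , j) →
      Row T i (suc j) xs → Row T (suc i) j ys → Row T (2 + i) j [] → length xs ≤ fuel → length ys ≤ fuel →
      RowsSlid T i j (slide μ fuel k T) (insertTop (toℕ k) xs ys)
    slideTop fuel {T = T} {c = c} Tc p r@(end _) s@(end _) b _ _ =
      rows-slid-stop fuel Tc p r s (step-corner {T} {c} Tc (cong (map (to T)) (neighbours-of p r s)))
    slideTop (suc fuel) {k} {T} {i} {j} {c} {_ ∷ xs} Tc p r@(cell c₁ p₁ refl rs) s@(end _) b (s≤s le) _ with
        toℕ (to T c₁) <? toℕ k
    ... | no ≮ = rows-slid-stop (suc fuel) Tc p r s
        (step-stop {T} {c} Tc (cong (map (to T)) (neighbours-of p r s)) refl ≮)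
    ... | yes lt rewrite slide-go fuel (step-go {T} {c} Tc (cong (map (to T)) (neighbours-of p r s)) refl lt) =
      rowsSlid (cell c p (cong toℕ
          (trans (others c (subst (_< suc j) (sym (cong proj₂ p)) ℕ.≤-refl)) (exchange-source {T} {c} Tc c₁)))
              upper)
               (subst (Row _ (suc i) j) (sym (insertTop-[] (toℕ k) xs)) (row-[]-irrelevant s))
               (cong suc cost)
               (λ c′ lt → trans (others c′ (ℕ.m≤n⇒m≤1+n lt)) (exchange-other {T} {c} Tc c₁ c′
                 (λ eq → ℕ.<⇒≢ (ℕ.m≤n⇒m≤1+n lt) (cong proj₂ (trans eq p₁)))
                     (λ eq → ℕ.<⇒≢ lt (cong proj₂ (trans eq p)))))
      where
      T₁ : Tableau μ
      T₁ = exchange μ (to T c₁) k T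
      r₁ : Row T₁ i (suc (suc j)) xs
      r₁ = row-cong (λ c′ _ le → exchange-other {T} {c} Tc c₁ c′
        (λ eq → ℕ.<⇒≢ le (sym (cong proj₂ (trans eq p₁))))
        (λ eq → ℕ.<⇒≢ (ℕ.<-trans ℕ.≤-refl le) (sym (cong proj₂ (trans eq p))))) rs
      open RowsSlid (slideTop fuel (exchange-target {T} {c} Tc c₁) p₁ r₁ (row-[]-suc s) (row-[]-suc b) le z≤n)
    slideTop (suc fuel) {k} {T} {i} {j} {c} {xs} {_ ∷ ys} Tc p r@(end _) s@(cell d q refl ss) b _ (s≤s le)
        with toℕ (to T d) <? toℕ k
    ... | no ≮ = rows-slid-stop (suc fuel) Tc p r s
        (step-stop {T} {c} Tc (cong (map (to T)) (neighbours-of p r s)) refl ≮)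
    ... | yes lt rewrite slide-go fuel (step-go {T} {c} Tc (cong (map (to T)) (neighbours-of p r s)) refl lt) =
      slide-down fuel Tc p r d q ss b le
    slideTop (suc fuel) {k} {T} {i} {j} {c} {_ ∷ xs} {_ ∷ ys} Tc p r@(cell c₁ p₁ refl rs) s@(cell d q refl ss)
        b (s≤s le₁) (s≤s le₂)
      with toℕ (to T c₁) <? toℕ (to T d) | toℕ (to T c₁) <? toℕ k | toℕ (to T d) <? toℕ k
    ... | yes x<y | no ≮ | _ = rows-slid-stop (suc fuel) Tc p r s
        (step-stop {T} {c} Tc (cong (map (to T)) (neighbours-of p r s)) (min-second (ℕ.<⇒≤ x<y)) ≮)
    ... | no x≮y | _ | no ≮ = rows-slid-stop (suc fuel) Tc p r s
        (step-stop {T} {c} Tc (cong (map (to T)) (neighbours-of p r s)) (min-first (ℕ.≮⇒≥ x≮y)) ≮)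
    ... | no x≮y | _ | yes lt rewrite slide-go fuel
        (step-go {T} {c} Tc (cong (map (to T)) (neighbours-of p r s)) (min-first (ℕ.≮⇒≥ x≮y)) lt) =
      slide-down fuel Tc p r d q ss b le₂
    ... | yes x<y | yes lt | _ rewrite slide-go fuel
        (step-go {T} {c} Tc (cong (map (to T)) (neighbours-of p r s)) (min-second (ℕ.<⇒≤ x<y)) lt) =
      rowsSlid (cell c p (cong toℕ
          (trans (others c (subst (_< suc j) (sym (cong proj₂ p)) ℕ.≤-refl)) (exchange-source {T} {c} Tc c₁)))
              upper)
               (cell d q (cong toℕ (trans (others d (subst (_< suc j) (sym (cong proj₂ q)) ℕ.≤-refl))
                   (exchange-other {T} {c} Tc c₁ d
                  (λ eq → ℕ.1+n≢n (cong proj₁ (trans (sym q) (trans eq p₁))))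
                      (λ eq → ℕ.1+n≢n (cong proj₁ (trans (sym q) (trans eq p))))))) lower)
               (cong suc cost)
               (λ c′ lt → trans (others c′ (ℕ.m≤n⇒m≤1+n lt)) (exchange-other {T} {c} Tc c₁ c′
                 (λ eq → ℕ.<⇒≢ (ℕ.m≤n⇒m≤1+n lt) (cong proj₂ (trans eq p₁)))
                     (λ eq → ℕ.<⇒≢ lt (cong proj₂ (trans eq p)))))
      where
      T₁ : Tableau μ
      T₁ = exchange μ (to T c₁) k T
      r₁ : Row T₁ i (suc (suc j)) xs
      r₁ = row-cong (λ c′ _ le → exchange-other {T} {c} Tc c₁ c′
        (λ eq → ℕ.<⇒≢ le (sym (cong proj₂ (trans eq p₁))))
        (λ eq → ℕ.<⇒≢ (ℕ.<-trans ℕ.≤-refl le) (sym (cong proj₂ (trans eq p))))) rs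
      s₁ : Row T₁ (suc i) (suc j) ys
      s₁ = row-cong (λ c′ i≡ _ → exchange-other {T} {c} Tc c₁ c′
        (λ eq → ℕ.1+n≢n (trans (sym i≡) (cong proj₁ (trans eq p₁))))
        (λ eq → ℕ.1+n≢n (trans (sym i≡) (cong proj₁ (trans eq p))))) ss
      open RowsSlid (slideTop fuel (exchange-target {T} {c} Tc c₁) p₁ r₁ s₁ (row-[]-suc b) le₁ le₂)

-- The whole algorithm on a two-rowed shape.

module Columns where

  open import Defs hiding (size)
  import Defs
  open BallotWords using (U; D; Letter)
  open Insertion using (Rows; run)
  open Codes using (letters)
  open Sliding
  open Enumeration using (columnReading)
  open import Data.Fin as Fin using (Fin; zero; suc; toℕ; fromℕ<)
  import Data.Fin.Properties as Fin
  open import Data.List using (List; []; _∷_; map; mapMaybe; concatMap; length; _++_; reverse; applyUpTo; upTo; _∷ʳ_; replicate)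
  open import Data.List.Properties using (map-++; unfold-reverse; mapMaybe-++)
  open import Data.Maybe using (Maybe; nothing)
  open import Data.Nat as ℕ using (ℕ; zero; suc; _+_; _≤_; _<_; _⊔_; _<?_; NonZero; >-nonZero⁻¹)
  import Data.Nat.Properties as ℕ
  open import Data.Product as × using (_×_; _,_; proj₁; proj₂)
  open import Data.Sum using (inj₁; inj₂)
  open import Function using (_∘_; id)
  open import Relation.Binary.PropositionalEquality
  open import Relation.Nullary using (yes; no; contradiction)

  module _ (μ : Partition) where

    private
      N = Defs.size μ

    processed : List (Fin N) → Tableau μ → Tableau μ
    processed []       T = T
    processed (k ∷ ks) T = processed ks (proj₁ (slide μ N k T))

    process-∷ : ∀ k ks T → process μ (k ∷ ks) T ≡ proj₂ (slide μ N k T) + process μ ks (proj₁ (slide μ N k T))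
    process-∷ k ks T with slide μ N k T
    ... | _ , _ = refl

    processed-∷ʳ : ∀ ks k T → processed (ks ∷ʳ k) T ≡ proj₁ (slide μ N k (processed ks T))
    processed-∷ʳ []        k T = refl
    processed-∷ʳ (k′ ∷ ks) k T = processed-∷ʳ ks k _

    -- `process` takes off the entry processed first, `run` the one processed last; this turns the
    -- recursion around.
    process-∷ʳ : ∀ ks k T → process μ (ks ∷ʳ k) T ≡ proj₂ (slide μ N k (processed ks T)) + process μ ks T
    process-∷ʳ []        k T = process-∷ k [] T
    process-∷ʳ (k′ ∷ ks) k T = begin
      process μ (k′ ∷ (ks ∷ʳ k)) T ≡⟨ process-∷ k′ (ks ∷ʳ k) T ⟩
      e + process μ (ks ∷ʳ k) T′ ≡⟨ cong (e +_) (process-∷ʳ ks k T′) ⟩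
      e + (e′ + process μ ks T′) ≡⟨ lem e e′ (process μ ks T′) ⟩
      e′ + (e + process μ ks T′) ≡⟨ cong (e′ +_) (sym (process-∷ k′ ks T)) ⟩
      e′ + process μ (k′ ∷ ks) T ∎
      where
      open ≡-Reasoning
      open import Data.Nat.Tactic.RingSolver using (solve-∀)
      T′ = proj₁ (slide μ N k′ T)
      e  = proj₂ (slide μ N k′ T)
      e′ = proj₂ (slide μ N k (processed ks T′))
      lem : ∀ a b c → a + (b + c) ≡ b + (a + c)
      lem = solve-∀

    module _ (T₀ : Tableau μ) where

      entries : List (Cell μ) → List (Fin N)
      entries cs = map (to μ T₀) (reverse cs)

      entries-∷ : ∀ c cs → entries (c ∷ cs) ≡ entries cs ∷ʳ to μ T₀ c
      entries-∷ c cs = trans (cong (map (to μ T₀)) (unfold-reverse c cs))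
          (map-++ (to μ T₀) (reverse cs) (c ∷ []))

      processed-entries : ∀ c cs →
          processed (entries (c ∷ cs)) T₀ ≡ proj₁ (slide μ N (to μ T₀ c) (processed (entries cs) T₀))
      processed-entries c cs = trans (cong (λ es → processed es T₀) (entries-∷ c cs))
          (processed-∷ʳ (entries cs) (to μ T₀ c) T₀)

      process-entries : ∀ c cs → process μ (entries (c ∷ cs)) T₀ ≡
        proj₂ (slide μ N (to μ T₀ c) (processed (entries cs) T₀)) + process μ (entries cs) T₀
      process-entries c cs = trans (cong (λ es → process μ es T₀) (entries-∷ c cs))
          (process-∷ʳ (entries cs) (to μ T₀ c) T₀)

      expected : List Letter → List (Cell μ) → Rows × ℕ
      expected ks cs = run ks (map (toℕ ∘ to μ T₀) cs)

      -- The invariant after the cells `cs` in the columns from `j` on. Since the entries are read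
      -- off the initial tableau, `untouched` is what guarantees that the next one still sits in its
      -- cell.
      record Processed (j : ℕ) (cs : List (Cell μ)) (ks : List Letter) : Set where
        constructor mkProcessed
        field
          upper     : Row μ (processed (entries cs) T₀) 0 j (proj₁ (proj₁ (expected ks cs)))
          lower     : Row μ (processed (entries cs) T₀) 1 j (proj₂ (proj₁ (expected ks cs)))
          cost      : process μ (entries cs) T₀ ≡ proj₂ (expected ks cs)
          untouched : ∀ c → proj₂ (coords μ c) < j → to μ (processed (entries cs) T₀) c ≡ to μ T₀ c

      module _ (twoRowed : ∀ j → cellAt μ (2 , j) ≡ nothing) (bound : ∀ c → proj₂ (coords μ c) < N) where

        -- The cut-off `N` of the loop exceeds every row length, so it never interferes.
        row-≤ : ∀ {T i j xs} c → proj₂ (coords μ c) ≡ j → Row μ T i (suc j) xs → length xs ≤ N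
        row-≤ {j = j} c eq r = ℕ.≤-trans (ℕ.m≤n+m _ (suc j))
            (row-length μ N bound (subst (_< N) eq (bound c)) r)

        row-≤′ : ∀ {T i j xs} c → proj₂ (coords μ c) ≡ j → Row μ T i j xs → length xs ≤ N
        row-≤′ {j = j} c eq r = ℕ.≤-trans (ℕ.m≤n+m _ j)
            (row-length μ N bound (ℕ.<⇒≤ (subst (_< N) eq (bound c))) r)

        -- Common to both kinds of columns: the lower row is given from column `j` on, whether or
        -- not it has a cell there.
        add-top : ∀ {j c cs ks} → coords μ c ≡ (0 , j) →
          to μ (processed (entries cs) T₀) c ≡ to μ T₀ c →
          Row μ (processed (entries cs) T₀) 0 (suc j) (proj₁ (proj₁ (expected ks cs))) →
          Row μ (processed (entries cs) T₀) 1 j (proj₂ (proj₁ (expected ks cs))) →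
          process μ (entries cs) T₀ ≡ proj₂ (expected ks cs) →
          (∀ c → proj₂ (coords μ c) < j → to μ (processed (entries cs) T₀) c ≡ to μ T₀ c) →
          Processed j (c ∷ cs) (U ∷ ks)
        add-top {j} {c} {cs} {ks} p same upper lower cost untouched
          = mkProcessed
            (subst (λ T → Row μ T 0 j (proj₁ (proj₁ (expected (U ∷ ks) (c ∷ cs)))))
                (sym (processed-entries c cs)) S.upper)
            (subst (λ T → Row μ T 1 j (proj₂ (proj₁ (expected (U ∷ ks) (c ∷ cs)))))
                (sym (processed-entries c cs)) S.lower)
            (trans (process-entries c cs) (cong₂ _+_ S.cost cost))
            (λ c′ lt → trans (cong (λ T → to μ T c′) (processed-entries c cs))
                (trans (S.others c′ lt) (untouched c′ lt)))
          where
          module S = RowsSlid (slideTop μ N same p upper lower (end λ j′ _ → twoRowed j′)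
            (row-≤ c (cong proj₂ p) upper) (row-≤′ c (cong proj₂ p) lower))

        add-single : ∀ {j c cs ks} → coords μ c ≡ (0 , j) → (∀ j′ → j ≤ j′ → cellAt μ (1 , j′) ≡ nothing) →
          Processed (suc j) cs ks → Processed j (c ∷ cs) (U ∷ ks)
        add-single {j} {c} {cs} {ks} p none P = add-top {ks = ks} p
          (P.untouched c (subst (_< suc j) (sym (cong proj₂ p)) ℕ.≤-refl)) P.upper (extend P.lower) P.cost
          (λ c′ lt → P.untouched c′ (ℕ.m≤n⇒m≤1+n lt))
          where
          module P = Processed P
          extend : ∀ {T ys} → Row μ T 1 (suc j) ys → Row μ T 1 j ys
          extend (end _)         = end none
          extend (cell c q _ _) with trans (sym (at μ q)) (none (suc j) (ℕ.n≤1+n j))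
          ... | ()

        add-pair : ∀ {j c d cs ks} → coords μ c ≡ (0 , j) → coords μ d ≡ (1 , j) →
          Processed (suc j) cs ks → Processed j (c ∷ d ∷ cs) (U ∷ D ∷ ks)
        add-pair {j} {c} {d} {cs} {ks} p q P = add-top {cs = d ∷ cs} {ks = D ∷ ks} p
          (trans (cong (λ T → to μ T c) (processed-entries d cs))
              (trans (S.others c (inj₁ λ eq → ℕ.1+n≢n (trans (sym eq) (cong proj₁ p))))
            (P.untouched c (subst (_< suc j) (sym (cong proj₂ p)) ℕ.≤-refl))))
          (subst (λ T → Row μ T 0 (suc j) (proj₁ (proj₁ (expected (D ∷ ks) (d ∷ cs)))))
              (sym (processed-entries d cs))
                  (row-cong μ (λ c′ i≡ _ → S.others c′ (inj₁ λ eq → ℕ.1+n≢n (trans (sym eq) i≡))) P.upper))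
          (subst (λ T → Row μ T 1 j (proj₂ (proj₁ (expected (D ∷ ks) (d ∷ cs)))))
              (sym (processed-entries d cs)) S.row)
          (trans (process-entries d cs) (cong₂ _+_ S.cost P.cost))
          (λ c′ lt → trans (cong (λ T → to μ T c′) (processed-entries d cs))
              (trans (S.others c′ (inj₂ lt)) (P.untouched c′ (ℕ.m≤n⇒m≤1+n lt))))
          where
          module P = Processed P
          module S = RowSlid (slideRow μ N (P.untouched d (subst (_< suc j) (sym (cong proj₂ q)) ℕ.≤-refl)) q P.lower
            (end λ j′ _ → twoRowed j′) (row-≤ d (cong proj₂ q) P.lower))

  mapMaybe-distrib-concatMap : ∀ {A B C : Set} (f : B → Maybe C) (g : A → List B) xs →
      mapMaybe f (concatMap g xs) ≡ concatMap (mapMaybe f ∘ g) xs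
  mapMaybe-distrib-concatMap f g []       = refl
  mapMaybe-distrib-concatMap f g (x ∷ xs) = trans (mapMaybe-++ f (g x) (concatMap g xs))
      (cong (mapMaybe f (g x) ++_) (mapMaybe-distrib-concatMap f g xs))

  module _ (l δ : ℕ) .{{_ : NonZero l}} where

    shape : Partition
    shape = twoRows {l + δ} {l} (ℕ.m≤m+n l δ) (>-nonZero⁻¹ l)

    top : ∀ {j} → j < l + δ → Cell shape
    top j< = zero , fromℕ< j<

    top-coords : ∀ {j} (j< : j < l + δ) → coords shape (top j<) ≡ (0 , j)
    top-coords j< = cong (0 ,_) (Fin.toℕ-fromℕ< j<)

    bottom : ∀ {j} → j < l → Cell shape
    bottom j< = suc zero , fromℕ< j<

    bottom-coords : ∀ {j} (j< : j < l) → coords shape (bottom j<) ≡ (1 , j)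
    bottom-coords j< = cong (1 ,_) (Fin.toℕ-fromℕ< j<)

    right-of-top : ∀ j → l + δ ≤ j → cellAt shape (0 , j) ≡ nothing
    right-of-top j le with j <? l + δ
    ... | yes lt = contradiction le (ℕ.<⇒≱ lt)
    ... | no  _  = refl

    right-of-bottom : ∀ j → l ≤ j → cellAt shape (1 , j) ≡ nothing
    right-of-bottom j le with j <? l
    ... | yes lt = contradiction le (ℕ.<⇒≱ lt)
    ... | no  _  = refl

    column : ℕ → List (Cell shape)
    column j = mapMaybe (cellAt shape) ((0 , j) ∷ (1 , j) ∷ [])

    double-column : ∀ {j} (j<l : j < l) (j<m : j < l + δ) → column j ≡ top j<m ∷ bottom j<l ∷ []
    double-column j<l j<m rewrite at shape (top-coords j<m) | at shape (bottom-coords j<l) = refl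

    single-column : ∀ {j} → l ≤ j → (j<m : j < l + δ) → column j ≡ top j<m ∷ []
    single-column {j} l≤j j<m rewrite at shape (top-coords j<m) | right-of-bottom j l≤j = refl

    columnsFrom : ℕ → ℕ → List (Cell shape)
    columnsFrom j zero    = []
    columnsFrom j (suc n) = column j ++ columnsFrom (suc j) n

    columnwise≡ : columnwise shape ≡ columnsFrom 0 (l + δ)
    columnwise≡ = begin
      columnwise shape ≡⟨ mapMaybe-distrib-concatMap (cellAt shape) _ (upTo ((l + δ) ⊔ (l ⊔ 0))) ⟩
      concatMap column (upTo ((l + δ) ⊔ (l ⊔ 0)))
        ≡⟨ cong (concatMap column ∘ upTo)
            (ℕ.m≥n⇒m⊔n≡m (subst (_≤ l + δ) (sym (ℕ.⊔-identityʳ l)) (ℕ.m≤m+n l δ))) ⟩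
      concatMap column (upTo (l + δ)) ≡⟨ from id 0 (λ i → sym (ℕ.+-identityʳ i)) (l + δ) ⟩
      columnsFrom 0 (l + δ) ∎
      where
      open ≡-Reasoning
      from : ∀ f j → (∀ i → f i ≡ i + j) → ∀ n → concatMap column (applyUpTo f n) ≡ columnsFrom j n
      from f j eq zero    = refl
      from f j eq (suc n) = cong₂ (λ k cs → column k ++ cs) (eq 0)
        (from (f ∘ suc) (suc j) (λ i → trans (eq (suc i)) (sym (ℕ.+-suc i j))) n)

    shape-bound : ∀ c → proj₂ (coords shape c) < Defs.size shape
    shape-bound (zero , j)     = ℕ.<-≤-trans (Fin.toℕ<n j) (ℕ.m≤m+n (l + δ) (l + 0))
    shape-bound (suc zero , j) = ℕ.<-≤-trans (Fin.toℕ<n j) (ℕ.≤-trans (ℕ.m≤m+n l δ) (ℕ.m≤m+n (l + δ) (l + 0)))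

    module _ (T : Tableau shape) where

      -- The algorithm works from right to left, so the columns to the right of `j` form the
      -- induction hypothesis.
      singles : ∀ j n → l ≤ j → j + n ≡ l + δ → Processed shape T j (columnsFrom j n) (replicate n U)
      singles j zero    l≤j eq = mkProcessed
          (end λ j′ le → right-of-top j′ (ℕ.≤-trans (ℕ.≤-reflexive (trans (sym eq) (ℕ.+-identityʳ j))) le))
        (end λ j′ le → right-of-bottom j′ (ℕ.≤-trans l≤j le)) refl (λ _ _ → refl)
      singles j (suc n) l≤j eq = subst
          (λ cs → Processed shape T j (cs ++ columnsFrom (suc j) n) (replicate (suc n) U))
              (sym (single-column l≤j j<m))
        (add-single shape T (λ _ → refl) shape-bound (top-coords j<m)
            (λ j′ le → right-of-bottom j′ (ℕ.≤-trans l≤j le))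
          (singles (suc j) n (ℕ.m≤n⇒m≤1+n l≤j) (trans (sym (ℕ.+-suc j n)) eq)))
        where
        j<m : j < l + δ
        j<m = subst (j <_) eq (ℕ.m<m+n j ℕ.z<s)

      doubles : ∀ j n → j + n ≡ l → Processed shape T j (columnsFrom j (n + δ)) (letters n δ)
      doubles j zero    eq = singles j δ (ℕ.≤-reflexive (sym j≡l)) (cong (_+ δ) j≡l)
        where
        j≡l : j ≡ l
        j≡l = trans (sym (ℕ.+-identityʳ j)) eq
      doubles j (suc n) eq = subst
          (λ cs → Processed shape T j (cs ++ columnsFrom (suc j) (n + δ)) (letters (suc n) δ))
              (sym (double-column j<l j<m))
        (add-pair shape T (λ _ → refl) shape-bound (top-coords j<m) (bottom-coords j<l)
          (doubles (suc j) n (trans (sym (ℕ.+-suc j n)) eq)))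
        where
        j<l : j < l
        j<l = subst (j <_) eq (ℕ.m<m+n j ℕ.z<s)
        j<m : j < l + δ
        j<m = ℕ.<-≤-trans j<l (ℕ.m≤m+n l δ)

      exchanges-run : exchanges shape T ≡ proj₂ (run (letters l δ) (columnReading shape T))
      exchanges-run = subst (λ cs →
          process shape (entries shape T cs) T ≡ proj₂ (expected shape T (letters l δ) cs)) (sym columnwise≡)
        (Processed.cost (doubles 0 l refl))

-- Assembly: the average over all tableaux.

module Average where

  open import Defs
  open Insertion using (run; run-decode; decode)
  open Codes using (letters; cells; cells≡; sumCodes; sumCodes-cong; totalCost; totalCost-averageCost)
  open RationalArithmetic using (/-unique)
  open ColumnRecurrence using (averageCost)
  open Enumeration using (sum-tableaux; columnReading)
  open Columns using (shape; exchanges-run)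
  open import Data.List using (map)
  open import Data.List.Properties using (map-cong; map-id)
  open import Data.Nat using (ℕ; _+_; _*_; _!; NonZero)
  open import Data.Nat.ListAction using (sum)
  open import Data.Nat.Properties using (_!≢0)
  open import Data.Nat.Tactic.RingSolver using (solve-∀)
  open import Data.Product using (proj₂)
  import Data.Rational as ℚ
  open import Function using (id; _∘_)
  open import Relation.Binary.PropositionalEquality

  sum-exchanges : ∀ l δ .{{_ : NonZero l}} →
    sum (map (exchanges (shape l δ)) (tableaux (shape l δ))) ≡ totalCost l δ
  sum-exchanges l δ = begin
    sum (map (exchanges (shape l δ)) (tableaux (shape l δ)))
        ≡⟨ cong sum (map-cong (exchanges-run l δ) (tableaux (shape l δ))) ⟩
    sum (map (G ∘ columnReading (shape l δ)) (tableaux (shape l δ))) ≡⟨ sum-tableaux (shape l δ) G ⟩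
    sumCodes (size (shape l δ)) (G ∘ decode)
        ≡⟨ cong (λ n → sumCodes n (G ∘ decode)) (trans (lem l δ) (sym (cells≡ l δ))) ⟩
    sumCodes (cells l δ) (G ∘ decode)
      ≡⟨ sumCodes-cong (cells l δ)
          (λ {c} cd → trans (cong G (sym (map-id (decode c))))
              (cong proj₂ (run-decode (letters l δ) cd {id} id))) ⟩
    totalCost l δ ∎
    where
    open ≡-Reasoning
    G = proj₂ ∘ run (letters l δ)
    lem : ∀ l δ → l + δ + (l + 0) ≡ 2 * l + δ
    lem = solve-∀

  averageComplexity-unique : ∀ μ {x} →
    fromℕ (sum (map (exchanges μ) (tableaux μ))) ≡ fromℕ (size μ !) ℚ.* x → averageComplexity μ ≡ x
  averageComplexity-unique μ = /-unique (sum (map (exchanges μ) (tableaux μ))) (size μ !) {{size μ !≢0}}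

  averageComplexity≡averageCost : ∀ l δ .{{_ : NonZero l}} → averageComplexity (shape l δ) ≡ averageCost l δ
  averageComplexity≡averageCost l δ = averageComplexity-unique (shape l δ)
    (trans (cong fromℕ (sum-exchanges l δ)) (trans (totalCost-averageCost l δ)
      (cong (λ k → fromℕ (k !) ℚ.* averageCost l δ) (trans (cells≡ l δ) (lem l δ)))))
    where
    lem : ∀ l δ → 2 * l + δ ≡ l + δ + (l + 0)
    lem = solve-∀

open import Defs
open import Data.Nat using (ℕ; suc; _+_; NonZero; >-nonZero⁻¹)
open import Data.Nat.Properties using (m≤m+n)
open import Relation.Binary.PropositionalEquality using (_≡_; sym; trans)
open ClosedFormula using (closedForm≡averageCost)
open Average using (averageComplexity≡averageCost)

mainTheorem8 : ∀ (λ₂ δ : ℕ) .{{_ : NonZero λ₂}} →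
    averageComplexity (twoRows {λ₁ = λ₂ + δ} {λ₂} (m≤m+n λ₂ δ) (>-nonZero⁻¹ λ₂))
    ≡ ClosedForm.closedForm λ₂ δ
mainTheorem8 (suc m) δ = trans (averageComplexity≡averageCost (suc m) δ) (sym (closedForm≡averageCost m δ))
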